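{- Up to isomorphism, there are exactly 18 fullerene graphs with 60 vertices whose Clar number equals $\frac{60-12}{6}=8$. One of them is the buckminsterfullerene $\text{C}_{60}$, the fullerene graph on 60 vertices in which no two pentagonal faces share an edge.
   Context: A fullerene graph is a cubic 3-connected plane graph all of whose faces are pentagons or hexagons. Such a graph has exactly 12 pentagonal faces. Let $F$ be a fullerene graph. A set $\mathcal H$ of pairwise vertex-disjoint hexagonal faces of $F$ is a sextet pattern if $F$ has a perfect matching $M$ such that every hexagon in $\mathcal H$ is $M$-alternating; equivalently, $F-V(\mathcal H)$ has a perfect matching. The Clar number $c(F)$ is the maximum cardinality of a sextet pattern of $F$. A fullerene graph $F_n$ with $n$ vertices always satisfies $c(F_n)\le \lfloor (n-12)/6\rfloor$. It is called extremal if $c(F_n)=\frac{n-12}{6}$. The theorem says there are exactly 18 extremal fullerene graphs with 60 vertices. -}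

module Defs where

open import Data.Nat using (ℕ; zero; suc; _+_; _*_; _≤_; _<_)
open import Data.Fin using (Fin; zero; suc)
open import Data.Product using (Σ; ∃; _×_; _,_; proj₁; proj₂)
open import Data.Sum using (_⊎_)
open import Data.Empty using (⊥)
open import Data.List using (List; length; lookup)
open import Relation.Binary.PropositionalEquality using (_≡_; _≢_)
open import Relation.Nullary using (¬_)

-- Cubic maps (combinatorial embeddings of cubic graphs via rotation
-- systems).  Vertices are Fin n; each vertex v has three darts
-- (half-edges) (v , 0), (v , 1), (v , 2), cyclically ordered around v
-- by the rotation  rot : 0 ↦ 1 ↦ 2 ↦ 0.  The edges are given by the
-- involution α pairing darts.  Faces are the orbits of φ = σ ∘ α.

Dart : ℕ → Set
Dart n = Fin n × Fin 3

rot : Fin 3 → Fin 3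
rot zero = suc zero
rot (suc zero) = suc (suc zero)
rot (suc (suc zero)) = zero

record CubicMap (n : ℕ) : Set where
  field
    α       : Dart n → Dart n
    α-invol : ∀ d → α (α d) ≡ d

module _ {n : ℕ} (M : CubicMap n) where
  open CubicMap M

  nbr : Fin n → Fin 3 → Fin n
  nbr v i = proj₁ (α (v , i))

  Adj : Fin n → Fin n → Set
  Adj u v = ∃ λ i → nbr u i ≡ v

  φ : Dart n → Dart n
  φ d with α d
  ... | (w , j) = (w , rot j)

  iter : ℕ → Dart n → Dart n
  iter zero d = d
  iter (suc k) d = φ (iter k d)

  Simple : Set
  Simple = (∀ v i → nbr v i ≢ v)
         × (∀ v i j → i ≢ j → nbr v i ≢ nbr v j)

  data PathAvoiding (S : Fin n → Set) : Fin n → Fin n → Set where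
    here : ∀ {u} → PathAvoiding S u u
    step : ∀ {u w v} → Adj u w → ¬ S w → PathAvoiding S w v → PathAvoiding S u v

  ConnectedAvoiding : (Fin n → Set) → Set
  ConnectedAvoiding S = ∀ u v → ¬ S u → ¬ S v → PathAvoiding S u v

  Connected : Set
  Connected = ConnectedAvoiding (λ _ → ⊥)

  ThreeConnected : Set
  ThreeConnected = (4 ≤ n) × Connected
                 × (∀ a b → ConnectedAvoiding (λ x → x ≡ a ⊎ x ≡ b))

  FaceLen : Dart n → ℕ → Set
  FaceLen d k = (1 ≤ k) × (iter k d ≡ d)
              × (∀ j → 1 ≤ j → j < k → iter j d ≢ d)

  FaceReps : List (Dart n) → Set
  FaceReps R = (∀ d → ∃ λ i → ∃ λ j → iter j (lookup R i) ≡ d)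
             × (∀ i i' j → iter j (lookup R i) ≡ lookup R i' → i ≡ i')

  -- planar (genus 0) map: connected and Euler's formula V − E + F = 2,
  -- with E = 3n/2, written as 2(V + F) = 4 + 3V
  Planar : Set
  Planar = Connected × Σ (List (Dart n)) λ R →
             FaceReps R × (2 * (n + length R) ≡ 4 + 3 * n)

  Fullerene : Set
  Fullerene = Simple × Planar × ThreeConnected
            × (∀ d → FaceLen d 5 ⊎ FaceLen d 6)

  OnFace : Dart n → Fin n → Set
  OnFace d u = ∃ λ j → proj₁ (iter j d) ≡ u

  Covered : List (Dart n) → Fin n → Set
  Covered H u = ∃ λ i → OnFace (lookup H i) u

  -- H (one dart per face) is a sextet pattern: hexagonal faces, pairwise
  -- vertex-disjoint, and F − V(H) has a perfect matching (given as a
  -- fixed-point-free involution p along edges on the uncovered vertices)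
  SextetPattern : List (Dart n) → Set
  SextetPattern H =
      (∀ i → FaceLen (lookup H i) 6)
    × (∀ i i' → i ≢ i' → ∀ u → OnFace (lookup H i) u → ¬ OnFace (lookup H i') u)
    × Σ (Fin n → Fin n) λ p →
        ∀ v → ¬ Covered H v → Adj v (p v) × ¬ Covered H (p v) × p (p v) ≡ v

  IsClarNumber : ℕ → Set
  IsClarNumber k = (Σ (List (Dart n)) λ H → SextetPattern H × length H ≡ k)
                 × (∀ H → SextetPattern H → length H ≤ k)

  -- no two pentagonal faces share an edge (the faces on the two sides of
  -- the edge {d , α d} are the faces through d and through α d)
  IsolatedPentagons : Set
  IsolatedPentagons = ∀ d → FaceLen d 5 → ¬ FaceLen (α d) 5

Iso : ∀ {n} → CubicMap n → CubicMap n → Set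
Iso {n} M N = Σ (Fin n → Fin n) λ f → Σ (Fin n → Fin n) λ g →
    (∀ v → g (f v) ≡ v) × (∀ v → f (g v) ≡ v)
  × (∀ u v → Adj M u v → Adj N (f u) (f v))
  × (∀ u v → Adj N (f u) (f v) → Adj M u v)

{-# OPTIONS --safe #-}

-- Let H be a sextet pattern of a fullerene F on n vertices and match the
-- uncovered vertices in pairs.  Call the corner opposite to the matching edge at
-- an uncovered vertex an exit.  Along a face outside H, the remaining corners are
-- paired by the edges shared with H and by the matching edges, so every pentagon
-- has an exit; since there are at least 12 pentagons, 6|H| + 12 ≤ n.  If equality
-- holds, then every exit lies on a pentagon and every pentagon has exactly one.
-- Now regard the hexagons of H as tiles with six spokes and the matching edges as
-- tiles with four spokes (the edges leaving the tile).  By the above, every other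
-- face meets exactly three tiles, so F is a triangulation by tiles of degrees 6
-- and 4 in which each triangle crosses at most one exit.  For n = 60 there are at
-- most 8 + 6 tiles, and all such triangulations are found by an exhaustive search
-- over injectively named tiles, in which the three sides of a triangle determine
-- each other.  No planarity beyond the count of pentagons is needed: closed
-- configurations that do not name all 60 vertices contradict connectedness.
-- If the pentagons are isolated they cover all vertices, and the same search
-- applies with the 12 pentagons as tiles of degree 5 and no matching edges.
module Submission where

open import Defs
open import Data.Bool using (Bool; true; false; if_then_else_; _∧_; _∨_; not; T; T?)
open import Data.Bool.Properties using (T-≡)
open import Data.Empty using (⊥; ⊥-elim)
open import Data.Fin using (Fin; zero; suc; toℕ; fromℕ<; combine)
import Data.Fin.Properties as Fin
open import Data.Fin.Permutation using (Permutation; permutation)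
open import Data.List using (List; []; _∷_; _++_; length; map; concat; concatMap; filter; filterᵇ; lookup; reverse; applyUpTo; allFin)
open import Data.List.Membership.Propositional using (_∈_; _∉_; find; lose)
open import Data.List.Membership.Propositional.Properties
open import Data.List.Properties using (length-map; length-++; length-applyUpTo; length-tabulate; tabulate-lookup)
open import Data.List.Relation.Unary.All as All using (All; []; _∷_)
import Data.List.Relation.Unary.All.Properties as All
open import Data.List.Relation.Unary.AllPairs using (AllPairs; []; _∷_)
import Data.List.Relation.Unary.AllPairs.Properties as AllPairs
open import Data.List.Relation.Unary.Any as Any using (here; there)
open import Data.List.Relation.Unary.Any.Properties using (lookup-index)
open import Data.List.Relation.Unary.Unique.Propositional using (Unique)
import Data.List.Relation.Unary.Unique.Propositional.Properties as Unique
open import Data.Maybe as Maybe using (Maybe; just; nothing)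
open import Data.Nat using (ℕ; zero; suc; _+_; _*_; _∸_; _/_; _%_; _≤_; _<_; _≡ᵇ_; _<ᵇ_; z≤n; s≤s)
open import Data.Nat.Induction using (<-wellFounded)
open import Data.Nat.Properties hiding (_≟_)
open import Data.Nat.Solver using (module +-*-Solver)
open import Data.Product using (Σ; ∃; _×_; _,_; proj₁; proj₂)
open import Data.Product.Properties using (≡-dec)
open import Data.Sum using (_⊎_; inj₁; inj₂)
open import Data.Unit using (tt)
import Data.Vec as Vec
open import Data.Vec.Properties using (lookup∘tabulate)
open import Function using (_∘_; Equivalence)
open import Induction.WellFounded using (Acc; acc)
open import Relation.Binary.Definitions using (DecidableEquality)
open import Relation.Binary.PropositionalEquality
open import Relation.Nullary using (¬_; Dec; yes; no)
open import Relation.Nullary.Decidable using (map′)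
open import Algebra.Properties.CommutativeMonoid.Sum +-0-commutativeMonoid using (sum; sum-permute; sum-cong-≗)

-- The pigeonhole principle

-- The search has to capture an unknown fullerene, so it handles names only. Its invariant: some
-- injective map `ι` from names to spokes respects rotation and all recorded partners. The true
-- partner of a chosen spoke is either named or lies on a tile none of whose spokes is named, and
-- both possibilities are tried; injectivity makes a clash of names a genuine contradiction. A
-- closed state is compared with one of eighteen explicit graphs, a certificate telling where the
-- first dart goes; between cubic graphs an injective map preserving adjacency suffices.
--
-- The eighteen graphs are checked by evaluation. Their Clar number is 8 because each has a pattern
-- of 8 hexagons and 6|H| + 12 ≤ 60 for every pattern H. They are told apart by the integer ⟨ x , A⁵
-- x ⟩, A being the adjacency matrix and x(v) the number of closed walks of length five at v.
-- Without cycles shorter than five, x(v) is twice the number of 5-cycles through v, so the integer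
-- reflects how the pentagons lie to each other. For 3-connectedness, walks through a deleted vertex
-- are rerouted along the cycle that bounds the three faces around it.

Unique-lookup : ∀ {A : Set} {xs : List A} → Unique xs → ∀ i j → lookup xs i ≡ lookup xs j → i ≡ j
Unique-lookup (a ∷ u) zero zero e = refl
Unique-lookup (a ∷ u) zero (suc j) e = ⊥-elim (All.lookup a (∈-lookup j) e)
Unique-lookup (a ∷ u) (suc i) zero e = ⊥-elim (All.lookup a (∈-lookup i) (sym e))
Unique-lookup (a ∷ u) (suc i) (suc j) e = cong suc (Unique-lookup u i j e)

Unique-⊆-length : ∀ {A : Set} {xs ys : List A} → Unique xs → (∀ {x} → x ∈ xs → x ∈ ys) → length xs ≤ length ys
Unique-⊆-length {xs = xs} {ys} u sub = Fin.injective⇒≤ {f = λ i → Any.index (sub (∈-lookup {xs = xs} i))} λ {i} {j} e →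
  Unique-lookup u i j (trans (lookup-index (sub (∈-lookup i)))
    (trans (cong (lookup ys) e) (sym (lookup-index (sub (∈-lookup j))))))

Unique-length≤ : ∀ {n} {xs : List (Fin n)} → Unique xs → length xs ≤ n
Unique-length≤ {n} {xs} u = subst (length xs ≤_) (length-tabulate {n = n} (λ i → i)) (Unique-⊆-length u (λ {x} _ → ∈-allFin x))

-- A vertex outside `xs` could be prepended to it, giving more than `n` distinct elements.
Unique-full : ∀ {n} {xs : List (Fin n)} → Unique xs → n ≤ length xs → ∀ v → v ∈ xs
Unique-full {xs = xs} u n≤ v with Any.any? (v Fin.≟_) xs
... | yes i = i
... | no ∉ = ⊥-elim (<-irrefl refl (≤-trans (Unique-length≤ (All.¬Any⇒All¬ xs ∉ ∷ u)) n≤))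

injective⇒surjective : ∀ {n} (f : Fin n → Fin n) → (∀ {i j} → f i ≡ f j → i ≡ j) → ∀ v → ∃ λ u → f u ≡ v
injective⇒surjective {n} f inj v with ∈-map⁻ f (Unique-full (Unique.map⁺ inj (Unique.allFin⁺ n))
  (≤-reflexive (sym (trans (length-map f (allFin n)) (length-tabulate {n = n} (λ i → i))))) v)
... | u , _ , e = u , sym e

-- Search for triangulations by tiles

-- Spokes of a tile face are of class hx.  At each end of a matching edge, turning
-- from the matching edge twice leads to the spoke of class ax, once to the spoke of
-- class bx; the exit corner is passed on entering a tile along a bx spoke.
data Class : Set where
  hx ax bx none : Class

-- Spoke k of tile t, the tile being a face (hexn) or a matching edge (quadn).
data Name : Set where
  hexn quadn : (t k : ℕ) → Name

_==_ : Name → Name → Bool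
hexn t k == hexn t′ k′ = if t ≡ᵇ t′ then k ≡ᵇ k′ else false
quadn t k == quadn t′ k′ = if t ≡ᵇ t′ then k ≡ᵇ k′ else false
_ == _ = false

≡ᵇ-sound : ∀ m n → (m ≡ᵇ n) ≡ true → m ≡ n
≡ᵇ-sound m n e = ≡ᵇ⇒≡ m n (subst T (sym e) tt)

≡ᵇ-refl : ∀ n → (n ≡ᵇ n) ≡ true
≡ᵇ-refl zero = refl
≡ᵇ-refl (suc n) = ≡ᵇ-refl n

≢⇒≡ᵇ-false : ∀ m n → m ≢ n → (m ≡ᵇ n) ≡ false
≢⇒≡ᵇ-false m n m≢n with m ≡ᵇ n in e
... | true = ⊥-elim (m≢n (≡ᵇ-sound m n e))
... | false = refl

==-sound : ∀ n m → (n == m) ≡ true → n ≡ m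
==-sound (hexn t k) (hexn t′ k′) e with t ≡ᵇ t′ in et
... | true = cong₂ hexn (≡ᵇ-sound t t′ et) (≡ᵇ-sound k k′ e)
==-sound (quadn t k) (quadn t′ k′) e with t ≡ᵇ t′ in et
... | true = cong₂ quadn (≡ᵇ-sound t t′ et) (≡ᵇ-sound k k′ e)

==-refl : ∀ n → (n == n) ≡ true
==-refl (hexn t k) rewrite ≡ᵇ-refl t = ≡ᵇ-refl k
==-refl (quadn t k) rewrite ≡ᵇ-refl t = ≡ᵇ-refl k

clsn : Name → Class
clsn (hexn _ _) = hx
clsn (quadn _ 0) = ax
clsn (quadn _ 1) = bx
clsn (quadn _ 2) = ax
clsn (quadn _ _) = bx

exitᶜ : Class → ℕ
exitᶜ bx = 1
exitᶜ _ = 0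

tile spoke : Name → ℕ
tile (hexn t _) = t
tile (quadn t _) = t
spoke (hexn _ k) = k
spoke (quadn _ k) = k

isHex isA : Name → Bool
isHex (hexn _ _) = true
isHex _ = false
isA n with clsn n
... | ax = true
... | _ = false

Row : Set
Row = List (Maybe Name)

getR : Row → ℕ → Maybe Name
getR [] _ = nothing
getR (x ∷ xs) zero = x
getR (x ∷ xs) (suc k) = getR xs k

setR : Row → ℕ → Name → Row
setR [] _ _ = []
setR (x ∷ xs) zero v = just v ∷ xs
setR (x ∷ xs) (suc k) v = x ∷ setR xs k v

get : List Row → ℕ → ℕ → Maybe Name
get [] _ _ = nothing
get (x ∷ xs) zero k = getR x k
get (x ∷ xs) (suc t) k = get xs t k

set : List Row → ℕ → ℕ → Name → List Row
set [] _ _ _ = []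
set (x ∷ xs) zero k v = setR x k v ∷ xs
set (x ∷ xs) (suc t) k v = x ∷ set xs t k v

look : List Row → Name → Maybe Name
look r n = get r (tile n) (spoke n)

upd : List Row → Name → Name → List Row
upd r n m = set r (tile n) (spoke n) m

getR-setR : ∀ r k k′ v {u} → getR (setR r k v) k′ ≡ just u → (k ≡ k′ × v ≡ u) ⊎ getR r k′ ≡ just u
getR-setR (x ∷ r) zero zero v refl = inj₁ (refl , refl)
getR-setR (x ∷ r) zero (suc k′) v e = inj₂ e
getR-setR (x ∷ r) (suc k) zero v e = inj₂ e
getR-setR (x ∷ r) (suc k) (suc k′) v e with getR-setR r k k′ v e
... | inj₁ (refl , q) = inj₁ (refl , q)
... | inj₂ q = inj₂ q

get-set : ∀ r t k t′ k′ v {u} → get (set r t k v) t′ k′ ≡ just u →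
          (t ≡ t′ × k ≡ k′ × v ≡ u) ⊎ get r t′ k′ ≡ just u
get-set (x ∷ r) zero k zero k′ v e with getR-setR x k k′ v e
... | inj₁ (p , q) = inj₁ (refl , p , q)
... | inj₂ q = inj₂ q
get-set (x ∷ r) zero k (suc t′) k′ v e = inj₂ e
get-set (x ∷ r) (suc t) k zero k′ v e = inj₂ e
get-set (x ∷ r) (suc t) k (suc t′) k′ v e with get-set r t k t′ k′ v e
... | inj₁ (refl , q) = inj₁ (refl , q)
... | inj₂ q = inj₂ q

getR-nothings : ∀ (r : Row) k → All (_≡ nothing) r → getR r k ≡ nothing
getR-nothings [] k a = refl
getR-nothings (x ∷ r) zero (p ∷ a) = p
getR-nothings (x ∷ r) (suc k) (p ∷ a) = getR-nothings r k a

get-snoc : ∀ rs r t k {u} → All (_≡ nothing) r → get (rs ++ r ∷ []) t k ≡ just u →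
           t < length rs × get rs t k ≡ just u
get-snoc [] r zero k a e with trans (sym e) (getR-nothings r k a)
... | ()
get-snoc [] r (suc t) k a ()
get-snoc (x ∷ rs) r zero k a e = s≤s z≤n , e
get-snoc (x ∷ rs) r (suc t) k a e with get-snoc rs r t k a e
... | t< , e′ = s≤s t< , e′

length-set : ∀ rs t k v → length (set rs t k v) ≡ length rs
length-set [] t k v = refl
length-set (r ∷ rs) zero k v = refl
length-set (r ∷ rs) (suc t) k v = cong suc (length-set rs t k v)

nothings : ℕ → Row
nothings zero = []
nothings (suc n) = nothing ∷ nothings n

nothings-All : ∀ n → All (_≡ nothing) (nothings n)
nothings-All zero = []
nothings-All (suc n) = refl ∷ nothings-All n

-- `nt` is the number of tiles so far, hence also the name of the next tile. Row `t` of `rows` holds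
-- the known partners of the spokes of tile `t`.
record State : Set where
  constructor st
  field
    nt : ℕ
    names : List Name
    rows : List Row
open State

-- Tile faces have length m + 1: m is 5 for a sextet pattern, 4 for pentagons.
module Engine (m : ℕ) where

  rho rhi : Name → Name
  rho (hexn t k) = hexn t (if k ≡ᵇ m then 0 else suc k)
  rho (quadn t 0) = quadn t 1
  rho (quadn t 1) = quadn t 2
  rho (quadn t 2) = quadn t 3
  rho (quadn t _) = quadn t 0
  rhi (hexn t 0) = hexn t m
  rhi (hexn t (suc k)) = hexn t k
  rhi (quadn t 0) = quadn t 3
  rhi (quadn t (suc k)) = quadn t k

  -- Match x with w and propagate: nothing signals a contradiction.  Running out of
  -- fuel only stops the propagation, which is harmless.
  mutual
    link : ℕ → List Row → Name → Name → Maybe (List Row)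
    link zero r x w = just r
    link (suc f) r x w = link₁ f r x w (look r x) (look r w)

    link₁ : ℕ → List Row → Name → Name → Maybe Name → Maybe Name → Maybe (List Row)
    link₁ f r x w (just w′) _ = if w == w′ then just r else nothing
    link₁ f r x w nothing (just x′) = if x == x′ then just r else nothing
    link₁ f r x w nothing nothing =
      -- No spoke is its own partner, since `α` has no fixed point.
      if x == w then nothing else link₂ f x w (upd (upd r x w) w x)

    link₂ : ℕ → Name → Name → List Row → Maybe (List Row)
    link₂ f x w r = link₃ f x w (tri f r x w)

    link₃ : ℕ → Name → Name → Maybe (List Row) → Maybe (List Row)
    link₃ f x w nothing = nothing
    link₃ f x w (just r) = tri f r w x

    -- If y and z are matched, so are x = rho y with some w, and u = rhi z with rho w.
    tri : ℕ → List Row → Name → Name → Maybe (List Row)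
    tri f r y z = tri₁ f r y (rho y) (rhi z) (look r (rho y)) (look r (rhi z))

    tri₁ : ℕ → List Row → Name → Name → Name → Maybe Name → Maybe Name → Maybe (List Row)
    tri₁ f r y x u nothing nothing = just r
    tri₁ f r y x u nothing (just v) = tri₂ f r y x u (rhi v) x (rhi v)
    tri₁ f r y x u (just w) _ = tri₂ f r y x u w u (rho w)

    tri₂ : ℕ → List Row → (y x u w p q : Name) → Maybe (List Row)
    tri₂ f r y x u w p q =
      -- The three tiles around the face are entered along `y`, `w` and `u`; two of these of class
      -- `bx` would put two exits on one face.
      if 1 <ᵇ exitᶜ (clsn y) + (exitᶜ (clsn w) + exitᶜ (clsn u)) then nothing else link f r p q

  hexNames : ℕ → ℕ → List Name
  hexNames t zero = []
  hexNames t (suc k) = hexn t k ∷ hexNames t k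

  quadNames : ℕ → List Name
  quadNames t = quadn t 0 ∷ quadn t 1 ∷ quadn t 2 ∷ quadn t 3 ∷ []

  addHex addQuad : State → State
  addHex (st nt ns r) = st (suc nt) (ns ++ hexNames nt (suc m)) (r ++ nothings (suc m) ∷ [])
  addQuad (st nt ns r) = st (suc nt) (ns ++ quadNames nt) (r ++ nothings 4 ∷ [])

  mutual
    -- If `y` is matched with `z`, any match of `rho y` determines the third edge of the face
    -- between them. Choosing the spoke after a matched one thus makes every choice propagate at
    -- once.
    pick : List Row → List Name → Maybe Name
    pick r [] = nothing
    pick r (y ∷ ys) = pick₁ r y ys (look r y) (look r (rho y))

    pick₁ : List Row → Name → List Name → Maybe Name → Maybe Name → Maybe Name
    pick₁ r y ys (just _) nothing = just (rho y)
    pick₁ r y ys _ _ = pick r ys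

  module Search {Cert : Set} (leaf : State → List Cert → Maybe (List Cert)) (capH capA : ℕ) where

    -- A successful search consumes one certificate at each leaf that needs one and
    -- returns the others; it fails as soon as a leaf is rejected.
    mutual
      search : ℕ → State → List Cert → Maybe (List Cert)
      -- Unlike in `link`, running out of fuel must count as failure: an unexplored state could hide
      -- a graph.
      search zero s cs = nothing
      search (suc f) s cs = search₁ f s (pick (rows s) (names s)) cs

      search₁ : ℕ → State → Maybe Name → List Cert → Maybe (List Cert)
      search₁ f s nothing cs = leaf s cs
      search₁ f s (just x) cs = branch f s x cs

      -- All spokes of a new tile face are alike, so it is entered at spoke 0. A half turn of a
      -- matching edge exchanges its two spokes of each class, so spokes 0 and 1 represent all
      -- cases.
      branch quadA quadB : ℕ → State → Name → List Cert → Maybe (List Cert)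
      branch f s x cs = if length (filterᵇ isHex (names s)) <ᵇ capH
        then then-quadA f s x (try f (addHex s) x (hexn (nt s) 0) cs)
        else quadA f s x cs
      quadA f s x cs = if length (filterᵇ isA (names s)) <ᵇ capA
        then then-quadB f s x (try f (addQuad s) x (quadn (nt s) 0) cs)
        else old f s x (names s) cs
      quadB f s x cs = then-old f s x (names s) (try f (addQuad s) x (quadn (nt s) 1) cs)

      then-quadA then-quadB : ℕ → State → Name → Maybe (List Cert) → Maybe (List Cert)
      then-quadA f s x nothing = nothing
      then-quadA f s x (just cs) = quadA f s x cs
      then-quadB f s x nothing = nothing
      then-quadB f s x (just cs) = quadB f s x cs

      old : ℕ → State → Name → List Name → List Cert → Maybe (List Cert)
      old f s x [] cs = just cs
      old f s x (w ∷ ws) cs = then-old f s x ws (try f s x w cs)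

      then-old : ℕ → State → Name → List Name → Maybe (List Cert) → Maybe (List Cert)
      then-old f s x ws nothing = nothing
      then-old f s x ws (just cs) = old f s x ws cs

      try : ℕ → State → Name → Name → List Cert → Maybe (List Cert)
      try f s x w cs = try₁ f s (link 100 (rows s) x w) cs

      try₁ : ℕ → State → Maybe (List Row) → List Cert → Maybe (List Cert)
      try₁ f s nothing cs = just cs
      try₁ f (st nt ns _) (just r) cs = search f (st nt ns r) cs

  iterate : {A : Set} → ℕ → (A → A) → A → A
  iterate zero f x = x
  iterate (suc k) f x = f (iterate k f x)

  -- Abstract tile systems and soundness of the search

  -- What the search uses of a fullerene. The bounds count spokes rather than tiles: each tile face
  -- has `m + 1` of class `hx`, each matching edge two of class `ax`. Elements of class `none` are
  -- not spokes.
  record TileSystem (X : Set) (capH capA : ℕ) : Set where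
    field
      _≟_ : DecidableEquality X
      α ρ : X → X
      c : X → Class
      α-invol : ∀ x → α (α x) ≡ x
      α-nofix : ∀ x → α x ≢ x
      α-spoke : ∀ x → c x ≢ none → c (α x) ≢ none
      ρ-hx : ∀ x → c x ≡ hx → c (ρ x) ≡ hx
      ρ-ax : ∀ x → c x ≡ ax → c (ρ x) ≡ bx
      ρ-bx : ∀ x → c x ≡ bx → c (ρ x) ≡ ax
      orbit-hx : ∀ x → c x ≡ hx → iterate (suc m) ρ x ≡ x
      orbit-hx-min : ∀ x k → c x ≡ hx → k < m → iterate (suc k) ρ x ≢ x
      orbit-ax : ∀ x → c x ≡ ax → ρ (ρ (ρ (ρ x))) ≡ x
      orbit-bx : ∀ x → c x ≡ bx → ρ (ρ (ρ (ρ x))) ≡ x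
      orbit-ax-min : ∀ x → c x ≡ ax → ρ (ρ x) ≢ x
      -- A spoke is entered into the next tile by α and left along the next spoke by ρ.
      triangle : ∀ x → c x ≢ none → ρ (α (ρ (α (ρ (α x))))) ≡ x
      triangle-exits : ∀ x → c x ≢ none →
        exitᶜ (c (α x)) + (exitᶜ (c (α (ρ (α x)))) + exitᶜ (c (α (ρ (α (ρ (α x))))))) ≤ 1
      bound-hx : ∀ xs → Unique xs → All (λ x → c x ≡ hx) xs → length xs ≤ capH
      bound-ax : ∀ xs → Unique xs → All (λ x → c x ≡ ax) xs → length xs ≤ capA

  Ok : Name → Set
  Ok (hexn _ k) = k ≤ m
  Ok (quadn _ k) = k < 4

  rho-hex-last : ∀ t → rho (hexn t m) ≡ hexn t 0
  rho-hex-last t rewrite ≡ᵇ-refl m = refl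

  rho-hex-< : ∀ t {k} → k < m → rho (hexn t k) ≡ hexn t (suc k)
  rho-hex-< t {k} k<m rewrite ≢⇒≡ᵇ-false k m (λ { refl → <-irrefl refl k<m }) = refl

  rho-rhi : ∀ n → Ok n → rho (rhi n) ≡ n
  rho-rhi (hexn t zero) o = rho-hex-last t
  rho-rhi (hexn t (suc k)) o = rho-hex-< t o
  rho-rhi (quadn t 0) o = refl
  rho-rhi (quadn t 1) o = refl
  rho-rhi (quadn t 2) o = refl
  rho-rhi (quadn t 3) o = refl
  rho-rhi (quadn t (suc (suc (suc (suc k))))) (s≤s (s≤s (s≤s (s≤s ()))))

  iterate-comm : {A : Set} (f : A → A) (k : ℕ) (x : A) → iterate k f (f x) ≡ f (iterate k f x)
  iterate-comm f zero x = refl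
  iterate-comm f (suc k) x = cong f (iterate-comm f k x)

  iterate-+ : {A : Set} (f : A → A) (k l : ℕ) (x : A) → iterate (k + l) f x ≡ iterate k f (iterate l f x)
  iterate-+ f zero l x = refl
  iterate-+ f (suc k) l x = cong f (iterate-+ f k l x)

  module Soundness {X : Set} {capH capA : ℕ} (S : TileSystem X capH capA) where
    open TileSystem S

    ρ-spoke : ∀ x → c x ≢ none → c (ρ x) ≢ none
    ρ-spoke x s e with c x in cx
    ... | hx with trans (sym e) (ρ-hx x cx)
    ...   | ()
    ρ-spoke x s e | ax with trans (sym e) (ρ-ax x cx)
    ...   | ()
    ρ-spoke x s e | bx with trans (sym e) (ρ-bx x cx)
    ...   | ()
    ρ-spoke x s e | none = s refl

    -- The class of `ρ x` determines that of `x`, and on each class a power of `ρ` is the identity.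
    ρ-inj : ∀ x y → c x ≢ none → c y ≢ none → ρ x ≡ ρ y → x ≡ y
    ρ-inj x y sx sy e with c x in cx | c y in cy
    ... | none | _ = ⊥-elim (sx refl)
    ... | _ | none = ⊥-elim (sy refl)
    ... | hx | hx = trans (sym (orbit-hx x cx)) (trans (sym (iterate-comm ρ m x))
                      (trans (cong (iterate m ρ) e) (trans (iterate-comm ρ m y) (orbit-hx y cy))))
    ... | ax | ax = trans (sym (orbit-ax x cx)) (trans (cong (λ z → ρ (ρ (ρ z))) e) (orbit-ax y cy))
    ... | bx | bx = trans (sym (orbit-bx x cx)) (trans (cong (λ z → ρ (ρ (ρ z))) e) (orbit-bx y cy))
    ... | hx | ax with trans (sym (ρ-hx x cx)) (trans (cong c e) (ρ-ax y cy))
    ...   | ()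
    ρ-inj x y sx sy e | hx | bx with trans (sym (ρ-hx x cx)) (trans (cong c e) (ρ-bx y cy))
    ...   | ()
    ρ-inj x y sx sy e | ax | hx with trans (sym (ρ-ax x cx)) (trans (cong c e) (ρ-hx y cy))
    ...   | ()
    ρ-inj x y sx sy e | ax | bx with trans (sym (ρ-ax x cx)) (trans (cong c e) (ρ-bx y cy))
    ...   | ()
    ρ-inj x y sx sy e | bx | hx with trans (sym (ρ-bx x cx)) (trans (cong c e) (ρ-hx y cy))
    ...   | ()
    ρ-inj x y sx sy e | bx | ax with trans (sym (ρ-bx x cx)) (trans (cong c e) (ρ-ax y cy))
    ...   | ()

    -- An interpretation of the names as spokes. By `distinct`, equality of names decides equality
    -- of spokes; by `same-kind`, a position in the table belongs to one name only.
    record Named (ns : List Name) (nt : ℕ) (ι : Name → X) : Set where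
      field
        ok : ∀ {n} → n ∈ ns → Ok n
        old-tile : ∀ {n} → n ∈ ns → tile n < nt
        same-kind : ∀ {n n′} → n ∈ ns → n′ ∈ ns → tile n ≡ tile n′ → isHex n ≡ isHex n′
        rho∈ : ∀ {n} → n ∈ ns → rho n ∈ ns
        rhi∈ : ∀ {n} → n ∈ ns → rhi n ∈ ns
        ι-rho : ∀ {n} → n ∈ ns → ι (rho n) ≡ ρ (ι n)
        ι-cls : ∀ {n} → n ∈ ns → c (ι n) ≡ clsn n
        distinct : AllPairs (λ n n′ → ι n ≢ ι n′) ns

      ι-inj : ∀ {n n′} → n ∈ ns → n′ ∈ ns → ι n ≡ ι n′ → n ≡ n′
      ι-inj = go distinct
        where
        go : ∀ {ns} → AllPairs (λ n n′ → ι n ≢ ι n′) ns → ∀ {n n′} → n ∈ ns → n′ ∈ ns → ι n ≡ ι n′ → n ≡ n′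
        go (a ∷ p) (here refl) (here refl) e = refl
        go (a ∷ p) (here refl) (there j) e = ⊥-elim (All.lookup a j e)
        go (a ∷ p) (there i) (here refl) e = ⊥-elim (All.lookup a i (sym e))
        go (a ∷ p) (there i) (there j) e = go p i j e

      rho-rhi∈ : ∀ {n} → n ∈ ns → rho (rhi n) ≡ n
      rho-rhi∈ {n} i = rho-rhi n (ok i)

      ι-spoke : ∀ {n} → n ∈ ns → c (ι n) ≢ none
      ι-spoke {hexn _ _} i e with trans (sym (ι-cls i)) e
      ... | ()
      ι-spoke {quadn _ 0} i e with trans (sym (ι-cls i)) e
      ... | ()
      ι-spoke {quadn _ 1} i e with trans (sym (ι-cls i)) e
      ... | ()
      ι-spoke {quadn _ 2} i e with trans (sym (ι-cls i)) e
      ... | ()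
      ι-spoke {quadn _ (suc (suc (suc _)))} i e with trans (sym (ι-cls i)) e
      ... | ()

    module _ {ns : List Name} {nt : ℕ} {ι : Name → X} (N : Named ns nt ι) where
      open Named N

      record Matched (r : List Row) : Set where
        field
          size : length r ≡ nt
          at : ∀ {n w} → n ∈ ns → look r n ≡ just w → w ∈ ns × α (ι n) ≡ ι w
      open Matched

      ι-swap : ∀ {x w} → α (ι x) ≡ ι w → α (ι w) ≡ ι x
      ι-swap e = trans (cong α (sym e)) (α-invol _)

      name-≡ : ∀ {n x} → n ∈ ns → x ∈ ns → tile x ≡ tile n → spoke x ≡ spoke n → n ≡ x
      name-≡ {hexn _ _} {hexn _ _} n∈ x∈ refl refl = refl
      name-≡ {quadn _ _} {quadn _ _} n∈ x∈ refl refl = refl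
      name-≡ {hexn _ _} {quadn _ _} n∈ x∈ p q with same-kind x∈ n∈ p
      ... | ()
      name-≡ {quadn _ _} {hexn _ _} n∈ x∈ p q with same-kind x∈ n∈ p
      ... | ()

      Matched-upd : ∀ {r x w} → x ∈ ns → w ∈ ns → α (ι x) ≡ ι w → Matched r → Matched (upd r x w)
      Matched-upd {r} {x} {w} x∈ w∈ e M .size = trans (length-set r _ _ _) (size M)
      Matched-upd {r} {x} {w} x∈ w∈ e M .at {n} {u} n∈ l
        with get-set r (tile x) (spoke x) (tile n) (spoke n) w l
      ... | inj₂ l′ = at M n∈ l′
      ... | inj₁ (p , q , refl) = w∈ , trans (cong (α ∘ ι) (name-≡ n∈ x∈ p q)) e

      around : ∀ {y z} → y ∈ ns → α (ι y) ≡ ι z → ρ (α (ι z)) ≡ ι (rho y)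
      around y∈ e = trans (cong ρ (ι-swap e)) (sym (ι-rho y∈))

      -- The triangle law at `ι z` says that `ρ` of the left side is `ι z`, which is also `ρ` of the
      -- right side; `ρ` is then cancelled.
      closing : ∀ {y z} → y ∈ ns → z ∈ ns → α (ι y) ≡ ι z →
        α (ρ (α (ι (rho y)))) ≡ ι (rhi z)
      closing {y} {z} y∈ z∈ e = ρ-inj _ _
        (α-spoke _ (ρ-spoke _ (α-spoke _ (ι-spoke (rho∈ y∈))))) (ι-spoke (rhi∈ z∈))
        (begin
          ρ (α (ρ (α (ι (rho y)))))         ≡⟨ cong (λ a → ρ (α (ρ (α a)))) (sym (around y∈ e)) ⟩
          ρ (α (ρ (α (ρ (α (ι z))))))       ≡⟨ triangle (ι z) (ι-spoke z∈) ⟩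
          ι z                               ≡⟨ cong ι (sym (rho-rhi∈ z∈)) ⟩
          ι (rho (rhi z))                   ≡⟨ ι-rho (rhi∈ z∈) ⟩
          ρ (ι (rhi z))                     ∎)
        where open ≡-Reasoning

      third-edge : ∀ {y z w} → y ∈ ns → z ∈ ns → α (ι y) ≡ ι z → w ∈ ns → α (ι (rho y)) ≡ ι w →
        α (ι (rhi z)) ≡ ι (rho w)
      third-edge {y} {z} {w} y∈ z∈ e w∈ αx = begin
        α (ι (rhi z))                    ≡⟨ cong α (sym (closing y∈ z∈ e)) ⟩
        α (α (ρ (α (ι (rho y)))))        ≡⟨ α-invol _ ⟩
        ρ (α (ι (rho y)))                ≡⟨ cong ρ αx ⟩
        ρ (ι w)                          ≡⟨ sym (ι-rho w∈) ⟩
        ι (rho w)                        ∎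
        where open ≡-Reasoning

      second-edge : ∀ {y z v} → y ∈ ns → z ∈ ns → α (ι y) ≡ ι z → v ∈ ns → α (ι (rhi z)) ≡ ι v →
        α (ι (rho y)) ≡ ι (rhi v)
      second-edge {y} {z} {v} y∈ z∈ e v∈ αu = ρ-inj _ _
        (α-spoke _ (ι-spoke (rho∈ y∈))) (ι-spoke (rhi∈ v∈))
        (begin
          ρ (α (ι (rho y)))          ≡⟨ sym (α-invol _) ⟩
          α (α (ρ (α (ι (rho y)))))  ≡⟨ cong α (closing y∈ z∈ e) ⟩
          α (ι (rhi z))              ≡⟨ αu ⟩
          ι v                        ≡⟨ cong ι (sym (rho-rhi∈ v∈)) ⟩
          ι (rho (rhi v))            ≡⟨ ι-rho (rhi∈ v∈) ⟩
          ρ (ι (rhi v))              ∎)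
        where open ≡-Reasoning

      exits : ∀ {y z w} → y ∈ ns → z ∈ ns → α (ι y) ≡ ι z → w ∈ ns → α (ι (rho y)) ≡ ι w →
        α (ι (rhi z)) ≡ ι (rho w) → exitᶜ (clsn y) + (exitᶜ (clsn w) + exitᶜ (clsn (rhi z))) ≤ 1
      exits {y} {z} {w} y∈ z∈ e w∈ αx αu = subst (_≤ 1)
        (cong₂ _+_ (cong exitᶜ (trans (cong c (ι-swap e)) (ι-cls y∈)))
          (cong₂ _+_ (cong exitᶜ (trans (cong c αw) (ι-cls w∈)))
                     (cong exitᶜ (trans (cong c (trans (cong (α ∘ ρ ∘ α) (around y∈ e)) (closing y∈ z∈ e))) (ι-cls (rhi∈ z∈))))))
        (triangle-exits (ι z) (ι-spoke z∈))
        where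
        αw : α (ρ (α (ι z))) ≡ ι w
        αw = trans (cong α (around y∈ e)) αx

      Succeeds : Maybe (List Row) → Set
      Succeeds res = ∃ λ r → res ≡ just r × Matched r

      mutual
        -- A true match is never refuted: a partner recorded earlier has the same interpretation as
        -- the true one, hence the same name, and the triangle law makes every propagated match true
        -- as well.
        link-sound : ∀ f {r x w} → Matched r → x ∈ ns → w ∈ ns → α (ι x) ≡ ι w → Succeeds (link f r x w)
        link-sound zero {r} M x∈ w∈ e = r , refl , M
        link-sound (suc f) {r} {x} {w} M x∈ w∈ e =
          link₁-sound f M x∈ w∈ e (look r x) (look r w) refl refl

        link₁-sound : ∀ f {r x w} → Matched r → x ∈ ns → w ∈ ns → α (ι x) ≡ ι w →
          ∀ lx lw → look r x ≡ lx → look r w ≡ lw → Succeeds (link₁ f r x w lx lw)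
        link₁-sound f {r} {x} {w} M x∈ w∈ e (just w′) _ p _
          rewrite ι-inj w∈ (proj₁ (at M x∈ p)) (trans (sym e) (proj₂ (at M x∈ p))) | ==-refl w′ = r , refl , M
        link₁-sound f {r} {x} {w} M x∈ w∈ e nothing (just x′) _ q
          rewrite ι-inj x∈ (proj₁ (at M w∈ q)) (trans (sym (ι-swap e)) (proj₂ (at M w∈ q))) | ==-refl x′ = r , refl , M
        link₁-sound f {r} {x} {w} M x∈ w∈ e nothing nothing p q with x == w in x=w
        ... | true = ⊥-elim (α-nofix (ι x) (trans e (cong ι (sym (==-sound x w x=w)))))
        ... | false = link₂-sound f (Matched-upd w∈ x∈ (ι-swap e) (Matched-upd x∈ w∈ e M)) x∈ w∈ e

        link₂-sound : ∀ f {r x w} → Matched r → x ∈ ns → w ∈ ns → α (ι x) ≡ ι w → Succeeds (link₂ f x w r)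
        link₂-sound f {r} {x} {w} M x∈ w∈ e with tri f r x w | tri-sound f M x∈ w∈ e
        ... | _ | r′ , refl , M′ = tri-sound f M′ w∈ x∈ (ι-swap e)

        tri-sound : ∀ f {r y z} → Matched r → y ∈ ns → z ∈ ns → α (ι y) ≡ ι z → Succeeds (tri f r y z)
        tri-sound f {r} {y} {z} M y∈ z∈ e = tri₁-sound f M y∈ z∈ e _ _ refl refl

        tri₁-sound : ∀ f {r y z} → Matched r → y ∈ ns → z ∈ ns → α (ι y) ≡ ι z →
          ∀ lx lu → look r (rho y) ≡ lx → look r (rhi z) ≡ lu → Succeeds (tri₁ f r y (rho y) (rhi z) lx lu)
        tri₁-sound f {r} M y∈ z∈ e nothing nothing p q = r , refl , M
        tri₁-sound f {r} {y} {z} M y∈ z∈ e nothing (just v) p q =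
          tri₂-sound f M y∈ z∈ e w∈ αx αu (rho∈ y∈) w∈ αx
          where
          v∈ : v ∈ ns
          v∈ = proj₁ (at M (rhi∈ z∈) q)
          w∈ : rhi v ∈ ns
          w∈ = rhi∈ v∈
          αx : α (ι (rho y)) ≡ ι (rhi v)
          αx = second-edge y∈ z∈ e v∈ (proj₂ (at M (rhi∈ z∈) q))
          αu : α (ι (rhi z)) ≡ ι (rho (rhi v))
          αu = trans (proj₂ (at M (rhi∈ z∈) q)) (cong ι (sym (rho-rhi∈ v∈)))
        tri₁-sound f {r} {y} {z} M y∈ z∈ e (just w) lu p q =
          tri₂-sound f M y∈ z∈ e w∈ αx αu (rhi∈ z∈) (rho∈ w∈) αu
          where
          w∈ : w ∈ ns
          w∈ = proj₁ (at M (rho∈ y∈) p)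
          αx : α (ι (rho y)) ≡ ι w
          αx = proj₂ (at M (rho∈ y∈) p)
          αu : α (ι (rhi z)) ≡ ι (rho w)
          αu = third-edge y∈ z∈ e w∈ αx

        tri₂-sound : ∀ f {r y z w p q} → Matched r → y ∈ ns → z ∈ ns → α (ι y) ≡ ι z →
          w ∈ ns → α (ι (rho y)) ≡ ι w → α (ι (rhi z)) ≡ ι (rho w) →
          p ∈ ns → q ∈ ns → α (ι p) ≡ ι q →
          Succeeds (tri₂ f r y (rho y) (rhi z) w p q)
        tri₂-sound f {r} {y} {z} {w} M y∈ z∈ e w∈ αx αu p∈ q∈ αp
          with 1 <ᵇ exitᶜ (clsn y) + (exitᶜ (clsn w) + exitᶜ (clsn (rhi z))) in many
        ... | true = ⊥-elim (<⇒≱ (<ᵇ⇒< 1 _ (subst T (sym many) tt)) (exits y∈ z∈ e w∈ αx αu))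
        ... | false = link-sound f M p∈ q∈ αp

    -- Names are closed under `rhi`, which undoes `ρ`. Consequently, if one spoke of a tile is
    -- unnamed, the whole tile is, and it can be added as a new one.
    ι-ρ-back : ∀ {ns nt ι} (N : Named ns nt ι) {n} k ξ → c ξ ≢ none → n ∈ ns → ι n ≡ iterate k ρ ξ →
      ∃ λ n′ → n′ ∈ ns × ι n′ ≡ ξ
    ι-ρ-back N zero ξ s n∈ e = _ , n∈ , e
    ι-ρ-back {ι = ι} N {n} (suc k) ξ s n∈ e = ι-ρ-back N k ξ s (rhi∈ n∈) (ρ-inj _ _ (ι-spoke (rhi∈ n∈)) (spokes k)
        (trans (sym (ι-rho (rhi∈ n∈))) (trans (cong ι (rho-rhi∈ n∈)) e)))
      where
      open Named N
      spokes : ∀ k → c (iterate k ρ ξ) ≢ none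
      spokes zero = s
      spokes (suc k) = ρ-spoke _ (spokes k)

    extend : ℕ → (ι ν : Name → X) → Name → X
    extend nt ι ν n = if tile n ≡ᵇ nt then ν n else ι n

    extend-old : ∀ {nt ι ν n} → tile n < nt → extend nt ι ν n ≡ ι n
    extend-old {nt} {n = n} t<nt rewrite ≢⇒≡ᵇ-false (tile n) nt (λ { refl → <-irrefl refl t<nt }) = refl

    extend-new : ∀ {nt ι ν n} → tile n ≡ nt → extend nt ι ν n ≡ ν n
    extend-new {n = n} refl rewrite ≡ᵇ-refl (tile n) = refl

    Named-++ : ∀ {ns ns′ nt ι ν} → Named ns nt ι → Named ns′ (suc nt) ν → (∀ {n} → n ∈ ns′ → tile n ≡ nt) →
      (∀ {n n′} → n ∈ ns → n′ ∈ ns′ → ι n ≢ ν n′) → Named (ns ++ ns′) (suc nt) (extend nt ι ν)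
    Named-++ {ns} {ns′} {nt} {ι} {ν} N N′ new fresh = record
      { ok = λ i → case (∈-++⁻ ns i) N.ok N′.ok
      ; old-tile = λ i → case (∈-++⁻ ns i) (λ i → ≤-trans (N.old-tile i) (n≤1+n nt)) N′.old-tile
      ; same-kind = kinds
      ; rho∈ = λ i → case (∈-++⁻ ns i) (∈-++⁺ˡ ∘ N.rho∈) (∈-++⁺ʳ ns ∘ N′.rho∈)
      ; rhi∈ = λ i → case (∈-++⁻ ns i) (∈-++⁺ˡ ∘ N.rhi∈) (∈-++⁺ʳ ns ∘ N′.rhi∈)
      ; ι-rho = λ i → case (∈-++⁻ ns i)
          (λ i → trans (old (N.rho∈ i)) (trans (N.ι-rho i) (cong ρ (sym (old i)))))
          (λ i → trans (nu (N′.rho∈ i)) (trans (N′.ι-rho i) (cong ρ (sym (nu i)))))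
      ; ι-cls = λ i → case (∈-++⁻ ns i) (λ i → trans (cong c (old i)) (N.ι-cls i)) (λ i → trans (cong c (nu i)) (N′.ι-cls i))
      ; distinct = AllPairs.++⁺ (transport old N.distinct) (transport nu N′.distinct)
          (All.tabulate λ i → All.tabulate λ j e → fresh i j (trans (sym (old i)) (trans e (nu j))))
      }
      where
      module N = Named N
      module N′ = Named N′
      case : {A B C : Set} → A ⊎ B → (A → C) → (B → C) → C
      case (inj₁ a) f g = f a
      case (inj₂ b) f g = g b
      old : ∀ {n} → n ∈ ns → extend nt ι ν n ≡ ι n
      old {n} i = extend-old {nt} {ι} {ν} {n} (N.old-tile i)
      nu : ∀ {n} → n ∈ ns′ → extend nt ι ν n ≡ ν n
      nu {n} i = extend-new {nt} {ι} {ν} {n} (new i)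
      kinds : ∀ {n n′} → n ∈ ns ++ ns′ → n′ ∈ ns ++ ns′ → tile n ≡ tile n′ → isHex n ≡ isHex n′
      kinds i j e with ∈-++⁻ ns i | ∈-++⁻ ns j
      ... | inj₁ i | inj₁ j = N.same-kind i j e
      ... | inj₂ i | inj₂ j = N′.same-kind i j e
      ... | inj₁ i | inj₂ j = ⊥-elim (<-irrefl (trans e (new j)) (N.old-tile i))
      ... | inj₂ i | inj₁ j = ⊥-elim (<-irrefl (trans (sym e) (new i)) (N.old-tile j))
      transport : ∀ {ms} {f g : Name → X} → (∀ {n} → n ∈ ms → f n ≡ g n) →
        AllPairs (λ n n′ → g n ≢ g n′) ms → AllPairs (λ n n′ → f n ≢ f n′) ms
      transport h [] = []
      transport h (a ∷ as) = All.tabulate (λ j e → All.lookup a j (trans (sym (h (here refl))) (trans e (h (there j)))))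
        ∷ transport (h ∘ there) as

    turning : X → Name → X
    turning ξ n = iterate (spoke n) ρ ξ

    ∈-hexNames⁺ : ∀ t {k l} → k < l → hexn t k ∈ hexNames t l
    ∈-hexNames⁺ t {k} {suc l} (s≤s k≤l) with m≤n⇒m<n∨m≡n k≤l
    ... | inj₁ k<l = there (∈-hexNames⁺ t k<l)
    ... | inj₂ refl = here refl

    ∈-hexNames⁻ : ∀ t l {n} → n ∈ hexNames t l → ∃ λ k → k < l × n ≡ hexn t k
    ∈-hexNames⁻ t (suc l) (here refl) = l , ≤-refl , refl
    ∈-hexNames⁻ t (suc l) (there i) with ∈-hexNames⁻ t l i
    ... | k , k<l , e = k , ≤-trans k<l (n≤1+n l) , e

    Named-hexNames : ∀ t ξ → c ξ ≡ hx → Named (hexNames t (suc m)) (suc t) (turning ξ)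
    Named-hexNames t ξ cξ = record
      { ok = λ i → ok (∈-hexNames⁻ t (suc m) i)
      ; old-tile = λ i → lt (∈-hexNames⁻ t (suc m) i)
      ; same-kind = λ i j _ → trans (kind (∈-hexNames⁻ t (suc m) i)) (sym (kind (∈-hexNames⁻ t (suc m) j)))
      ; rho∈ = λ i → rho-in (∈-hexNames⁻ t (suc m) i)
      ; rhi∈ = λ i → rhi-in (∈-hexNames⁻ t (suc m) i)
      ; ι-rho = λ i → turned (∈-hexNames⁻ t (suc m) i)
      ; ι-cls = λ i → cls′ (∈-hexNames⁻ t (suc m) i)
      ; distinct = dist (suc m) ≤-refl
      }
      where
      In : Name → Set
      In n = ∃ λ k → k < suc m × n ≡ hexn t k
      ok : ∀ {n} → In n → Ok n
      ok (k , s≤s k≤m , refl) = k≤m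
      lt : ∀ {n} → In n → tile n < suc t
      lt (k , _ , refl) = ≤-refl
      kind : ∀ {n} → In n → isHex n ≡ true
      kind (k , _ , refl) = refl
      rho-in : ∀ {n} → In n → rho n ∈ hexNames t (suc m)
      rho-in (k , s≤s k≤m , refl) with m≤n⇒m<n∨m≡n k≤m
      ... | inj₁ k<m = subst (_∈ hexNames t (suc m)) (sym (rho-hex-< t k<m)) (∈-hexNames⁺ t (s≤s k<m))
      ... | inj₂ refl = subst (_∈ hexNames t (suc m)) (sym (rho-hex-last t)) (∈-hexNames⁺ t (s≤s z≤n))
      rhi-in : ∀ {n} → In n → rhi n ∈ hexNames t (suc m)
      rhi-in (zero , _ , refl) = ∈-hexNames⁺ t ≤-refl
      rhi-in (suc k , k<m , refl) = ∈-hexNames⁺ t (≤-trans (n≤1+n _) k<m)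
      turned : ∀ {n} → In n → turning ξ (rho n) ≡ ρ (turning ξ n)
      turned (k , s≤s k≤m , refl) with m≤n⇒m<n∨m≡n k≤m
      ... | inj₁ k<m = cong (turning ξ) (rho-hex-< t k<m)
      ... | inj₂ refl = trans (cong (turning ξ) (rho-hex-last t)) (sym (orbit-hx ξ cξ))
      ρ^-hx : ∀ k → c (iterate k ρ ξ) ≡ hx
      ρ^-hx zero = cξ
      ρ^-hx (suc k) = ρ-hx _ (ρ^-hx k)
      cls′ : ∀ {n} → In n → c (turning ξ n) ≡ clsn n
      cls′ (k , _ , refl) = ρ^-hx k
      <-distinct : ∀ k l → k < l → l ≤ m → iterate l ρ ξ ≢ iterate k ρ ξ
      <-distinct k (suc l) (s≤s k≤l) l<m e with m≤n⇒∃[o]m+o≡n k≤l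
      ... | d , refl = orbit-hx-min (iterate k ρ ξ) d (ρ^-hx k)
              (≤-trans (s≤s (m≤n+m d k)) l<m)
              (trans (sym (iterate-+ ρ (suc d) k ξ)) (trans (cong (λ j → iterate (suc j) ρ ξ) (+-comm d k)) e))
      dist : ∀ l → l ≤ suc m → AllPairs (λ n n′ → turning ξ n ≢ turning ξ n′) (hexNames t l)
      dist zero _ = []
      dist (suc l) (s≤s l≤m) = All.tabulate (λ i → earlier (∈-hexNames⁻ t l i)) ∷ dist l (≤-trans l≤m (n≤1+n m))
        where
        earlier : ∀ {n} → (∃ λ k → k < l × n ≡ hexn t k) → iterate l ρ ξ ≢ turning ξ n
        earlier (k , k<l , refl) = <-distinct k l k<l l≤m

    Named-quadNames : ∀ t ξ → c ξ ≡ ax → Named (quadNames t) (suc t) (turning ξ)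
    Named-quadNames t ξ cξ = record
      { ok = λ { (here refl) → s≤s z≤n ; (there (here refl)) → s≤s (s≤s z≤n)
               ; (there (there (here refl))) → s≤s (s≤s (s≤s z≤n)) ; (there (there (there (here refl)))) → ≤-refl }
      ; old-tile = λ { (here refl) → ≤-refl ; (there (here refl)) → ≤-refl
                     ; (there (there (here refl))) → ≤-refl ; (there (there (there (here refl)))) → ≤-refl }
      ; same-kind = λ i j _ → trans (kind i) (sym (kind j))
      ; rho∈ = λ { (here refl) → there (here refl) ; (there (here refl)) → there (there (here refl))
                 ; (there (there (here refl))) → there (there (there (here refl))) ; (there (there (there (here refl)))) → here refl }
      ; rhi∈ = λ { (here refl) → there (there (there (here refl))) ; (there (here refl)) → here refl
                 ; (there (there (here refl))) → there (here refl) ; (there (there (there (here refl)))) → there (there (here refl)) }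
      ; ι-rho = λ { (here refl) → refl ; (there (here refl)) → refl
                  ; (there (there (here refl))) → refl ; (there (there (there (here refl)))) → sym (orbit-ax ξ cξ) }
      ; ι-cls = λ { (here refl) → cξ ; (there (here refl)) → c₁
                  ; (there (there (here refl))) → c₂ ; (there (there (there (here refl)))) → c₃ }
      ; distinct = ((λ e → odd (cong c e) cξ c₁) ∷ (λ e → orbit-ax-min ξ cξ (sym e)) ∷ (λ e → odd (cong c e) cξ c₃) ∷ [])
                 ∷ ((λ e → odd (cong c (sym e)) c₂ c₁) ∷ (λ e → orbit-ax-min ξ cξ (sym (ρ-inj _ _ (λ z → none≢ax (trans (sym z) cξ)) (λ z → none≢ax (trans (sym z) c₂)) e))) ∷ [])
                 ∷ ((λ e → odd (cong c e) c₂ c₃) ∷ []) ∷ [] ∷ []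
      }
      where
      none≢ax : none ≢ ax
      none≢ax ()
      c₁ : c (ρ ξ) ≡ bx
      c₁ = ρ-ax ξ cξ
      c₂ : c (ρ (ρ ξ)) ≡ ax
      c₂ = ρ-bx _ c₁
      c₃ : c (ρ (ρ (ρ ξ))) ≡ bx
      c₃ = ρ-ax _ c₂
      odd : ∀ {p q} → p ≡ q → p ≡ ax → q ≡ bx → ⊥
      odd refl refl ()
      kind : ∀ {n} → n ∈ quadNames t → isHex n ≡ false
      kind (here refl) = refl
      kind (there (here refl)) = refl
      kind (there (there (here refl))) = refl
      kind (there (there (there (here refl)))) = refl

    Realized : State → Set
    Realized (st nt ns r) = ∃ λ ι → Σ (Named ns nt ι) λ N → Matched N r

    -- The search reaches the true configuration

    module Search-sound {Cert : Set} (leaf : State → List Cert → Maybe (List Cert)) (Goal : Set)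
      (leaf-sound : ∀ s cs {cs′} → Realized s → leaf s cs ≡ just cs′ → Goal) where
      open Search leaf capH capA

      -- The named spokes of the class together with the unnamed `ξ` are distinct, so the bound
      -- holds for one more than the named ones. Hence the search did try a new tile.
      fresh-bound : ∀ {ns nt ι} (N : Named ns nt ι) (P : Name → Bool) {κ : Class} {cap : ℕ} {ξ : X} →
        (∀ n → P n ≡ true → clsn n ≡ κ) → c ξ ≡ κ → (∀ {n} → n ∈ ns → ι n ≢ ξ) →
        (∀ xs → Unique xs → All (λ x → c x ≡ κ) xs → length xs ≤ cap) → (length (filterᵇ P ns) <ᵇ cap) ≡ true
      fresh-bound {ns} {ι = ι} N P {ξ = ξ} cls′ cξ fresh bound = Equivalence.to T-≡ (<⇒<ᵇ
        (subst (λ l → suc l ≤ _) (length-map ι (filterᵇ P ns))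
          (bound (ξ ∷ map ι (filterᵇ P ns))
            (All.map⁺ (All.tabulate λ i e → fresh (sub i) (sym e)) ∷ AllPairs.map⁺ (AllPairs.filter⁺ _ N.distinct))
            (cξ ∷ All.map⁺ (All.tabulate λ i → trans (N.ι-cls (sub i)) (cls′ _ (Equivalence.to T-≡ (sat i))))))))
        where
        module N = Named N
        sub : ∀ {n} → n ∈ filterᵇ P ns → n ∈ ns
        sub i = proj₁ (∈-filter⁻ (T? ∘ P) {xs = ns} i)
        sat : ∀ {n} → n ∈ filterᵇ P ns → T (P n)
        sat i = proj₂ (∈-filter⁻ (T? ∘ P) {xs = ns} i)

      isHex-cls : ∀ n → isHex n ≡ true → clsn n ≡ hx
      isHex-cls (hexn _ _) e = refl

      isA-cls : ∀ n → isA n ≡ true → clsn n ≡ ax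
      isA-cls (quadn t 0) e = refl
      isA-cls (quadn t 2) e = refl

      pick-sound : ∀ r ys {x} → pick r ys ≡ just x → ∃ λ y → y ∈ ys × x ≡ rho y
      pick-sound r (y ∷ ys) e with look r y | look r (rho y)
      pick-sound r (y ∷ ys) refl | just _ | nothing = y , here refl , refl
      ... | just _ | just _ = let y′ , i , p = pick-sound r ys e in y′ , there i , p
      ... | nothing | just _ = let y′ , i , p = pick-sound r ys e in y′ , there i , p
      ... | nothing | nothing = let y′ , i , p = pick-sound r ys e in y′ , there i , p

      Matched-fresh : ∀ {ns ns′ nt ι ν r row} {N : Named ns nt ι} (N′ : Named (ns ++ ns′) (suc nt) (extend nt ι ν)) →
        All (_≡ nothing) row → (∀ {n} → n ∈ ns′ → tile n ≡ nt) → Matched N r → Matched N′ (r ++ row ∷ [])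
      Matched-fresh {nt = nt} {r = r} {row} N′ blank new M .Matched.size =
        trans (length-++ r) (trans (+-comm (length r) 1) (cong suc (Matched.size M)))
      Matched-fresh {ns} {ns′} {nt} {ι} {ν} {r} {row} {N} N′ blank new M .Matched.at {n} {w} i l
        with get-snoc r row (tile n) (spoke n) blank l | ∈-++⁻ ns i
      ... | t< , l′ | inj₂ j = ⊥-elim (<-irrefl (trans (new j) (sym (Matched.size M))) t<)
      ... | t< , l′ | inj₁ j with Matched.at M j l′
      ...   | w∈ , e = ∈-++⁺ˡ w∈ , trans (cong α (kept j)) (trans e (sym (kept w∈)))
        where
        kept : ∀ {n} → n ∈ ns → extend nt ι ν n ≡ ι n
        kept {n} i = extend-old {nt} {ι} {ν} {n} (Named.old-tile N i)

      Realized-hex : ∀ {ns nt r ι} (N : Named ns nt ι) → Matched N r → ∀ ξ → c ξ ≡ hx →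
        (∀ {n} → n ∈ ns → ι n ≢ ξ) →
        Σ (Named (ns ++ hexNames nt (suc m)) (suc nt) (extend nt ι (turning ξ))) λ N′ →
          Matched N′ (r ++ nothings (suc m) ∷ [])
      Realized-hex {ns} {nt} {r} {ι} N M ξ cξ fresh = N′ , Matched-fresh N′ (nothings-All (suc m)) new M
        where
        new : ∀ {n} → n ∈ hexNames nt (suc m) → tile n ≡ nt
        new i with ∈-hexNames⁻ nt (suc m) i
        ... | _ , _ , refl = refl
        N′ : Named (ns ++ hexNames nt (suc m)) (suc nt) (extend nt ι (turning ξ))
        N′ = Named-++ N (Named-hexNames nt ξ cξ) new λ {n} {n′} i j e →
          let _ , i′ , e′ = ι-ρ-back N (spoke n′) ξ (λ z → none≢hx (trans (sym z) cξ)) i e in fresh i′ e′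
          where
          none≢hx : none ≢ hx
          none≢hx ()

      Realized-quad : ∀ {ns nt r ι} (N : Named ns nt ι) → Matched N r → ∀ ξ → c ξ ≡ ax →
        (∀ {n} → n ∈ ns → ι n ≢ ξ) →
        Σ (Named (ns ++ quadNames nt) (suc nt) (extend nt ι (turning ξ))) λ N′ →
          Matched N′ (r ++ nothings 4 ∷ [])
      Realized-quad {ns} {nt} {r} {ι} N M ξ cξ fresh = N′ , Matched-fresh N′ (nothings-All 4) new M
        where
        new : ∀ {n} → n ∈ quadNames nt → tile n ≡ nt
        new (here refl) = refl
        new (there (here refl)) = refl
        new (there (there (here refl))) = refl
        new (there (there (there (here refl)))) = refl
        N′ : Named (ns ++ quadNames nt) (suc nt) (extend nt ι (turning ξ))
        N′ = Named-++ N (Named-quadNames nt ξ cξ) new λ {n} {n′} i j e →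
          let _ , i′ , e′ = ι-ρ-back N (spoke n′) ξ (λ z → none≢ax (trans (sym z) cξ)) i e in fresh i′ e′
          where
          none≢ax : none ≢ ax
          none≢ax ()

      -- Failure is passed on, so success of a branch yields success of each of its alternatives,
      -- started from some intermediate list of certificates. This and the next three lemmas extract
      -- them.
      branch-quadA : ∀ f s x cs {cs′} → branch f s x cs ≡ just cs′ → ∃ λ cs″ → quadA f s x cs″ ≡ just cs′
      branch-quadA f s x cs e with length (filterᵇ isHex (names s)) <ᵇ capH
      ... | false = cs , e
      ... | true with try f (addHex s) x (hexn (nt s) 0) cs
      ...   | just cs″ = cs″ , e

      quadA-old : ∀ f s x cs {cs′} → quadA f s x cs ≡ just cs′ → ∃ λ cs″ → old f s x (names s) cs″ ≡ just cs′
      quadA-old f s x cs e with length (filterᵇ isA (names s)) <ᵇ capA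
      ... | false = cs , e
      ... | true with try f (addQuad s) x (quadn (nt s) 0) cs
      ...   | just cs₁ with try f (addQuad s) x (quadn (nt s) 1) cs₁
      ...     | just cs₂ = cs₂ , e

      branch-hex : ∀ f s x cs {cs′} → branch f s x cs ≡ just cs′ → (length (filterᵇ isHex (names s)) <ᵇ capH) ≡ true →
        ∃ λ cs″ → try f (addHex s) x (hexn (nt s) 0) cs ≡ just cs″
      branch-hex f s x cs e b rewrite b with try f (addHex s) x (hexn (nt s) 0) cs
      ... | just cs″ = cs″ , refl

      quadA-quads : ∀ f s x cs {cs′} → quadA f s x cs ≡ just cs′ → (length (filterᵇ isA (names s)) <ᵇ capA) ≡ true →
        (∃ λ cs″ → try f (addQuad s) x (quadn (nt s) 0) cs ≡ just cs″) ×
        (∃ λ cs₁ → ∃ λ cs″ → try f (addQuad s) x (quadn (nt s) 1) cs₁ ≡ just cs″)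
      quadA-quads f s x cs e b rewrite b with try f (addQuad s) x (quadn (nt s) 0) cs
      ... | just cs₁ with try f (addQuad s) x (quadn (nt s) 1) cs₁ in e₁
      ...   | just cs₂ = (cs₁ , refl) , (cs₁ , cs₂ , e₁)

      mutual
        search-sound : ∀ f s cs {cs′} → Realized s → search f s cs ≡ just cs′ → Goal
        search-sound (suc f) s cs R e with pick (rows s) (names s) in p
        ... | nothing = leaf-sound s cs R e
        ... | just x with R | pick-sound (rows s) (names s) p
        ...   | ι , N , M | y , y∈ , refl = branch-sound f s cs N M (Named.rho∈ N y∈) e

        -- Follows the alternative that is true in `X`: the partner of `ι x` is named, or it is a
        -- spoke of an unnamed tile, distinguished by its class.
        branch-sound : ∀ f s {x} cs {cs′ ι} (N : Named (names s) (nt s) ι) → Matched N (rows s) → x ∈ names s →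
          branch f s x cs ≡ just cs′ → Goal
        branch-sound f s {x} cs {ι = ι} N M x∈ e with Any.any? (λ n → ι n ≟ α (ι x)) (names s)
        ... | yes named with find named
        ...   | w , w∈ , ιw with branch-quadA f s x cs e
        ...     | cs₁ , e₁ with quadA-old f s x cs₁ e₁
        ...       | cs₂ , e₂ = old-sound f s cs₂ (names s) N M x∈ w∈ w∈ (sym ιw) e₂
        branch-sound f s {x} cs {ι = ι} N M x∈ e | no unnamed with branch-quadA f s x cs e | c (α (ι x)) in cη
        ... | cs₁ , e₁ | none = ⊥-elim (α-spoke _ (Named.ι-spoke N x∈) cη)
        ... | cs₁ , e₁ | hx with branch-hex f s x cs e (fresh-bound N isHex isHex-cls cη unnamed′ bound-hx)
          where
          unnamed′ : ∀ {n} → n ∈ names s → ι n ≢ α (ι x)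
          unnamed′ i e = unnamed (lose i e)
        ...   | cs₂ , e₂ with Realized-hex N M (α (ι x)) cη (λ i e → unnamed (lose i e))
        ...     | N′ , M′ = try-sound f (addHex s) _ cs N′ M′ (∈-++⁺ˡ x∈) (∈-++⁺ʳ (names s) (∈-hexNames⁺ (nt s) (s≤s z≤n)))
                    (trans (cong α (extend-old {nt s} {ι} {turning (α (ι x))} {x} (Named.old-tile N x∈)))
                           (sym (extend-new {nt s} {ι} {turning (α (ι x))} {hexn (nt s) 0} refl))) e₂
        branch-sound f s {x} cs {ι = ι} N M x∈ e | no unnamed | cs₁ , e₁ | ax
          with quadA-quads f s x cs₁ e₁ (fresh-bound N isA isA-cls cη (λ i e → unnamed (lose i e)) bound-ax)
        ... | (cs₂ , e₂) , _ with Realized-quad N M (α (ι x)) cη (λ i e → unnamed (lose i e))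
        ...   | N′ , M′ = try-sound f (addQuad s) _ cs₁ N′ M′ (∈-++⁺ˡ x∈) (∈-++⁺ʳ (names s) (here refl))
                    (trans (cong α (extend-old {nt s} {ι} {turning (α (ι x))} {x} (Named.old-tile N x∈)))
                           (sym (extend-new {nt s} {ι} {turning (α (ι x))} {quadn (nt s) 0} refl))) e₂
        branch-sound f s {x} cs {ι = ι} N M x∈ e | no unnamed | cs₁ , e₁ | bx
          with quadA-quads f s x cs₁ e₁ (fresh-bound N isA isA-cls cξ unnamed′ bound-ax)
          where
          -- On a matching edge `ρ³` inverts `ρ`. Naming the tile from this `ax` spoke makes the
          -- spoke by which it is entered number 1.
          ξ : X
          ξ = ρ (ρ (ρ (α (ι x))))
          cξ : c ξ ≡ ax
          cξ = ρ-bx _ (ρ-ax _ (ρ-bx _ cη))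
          unnamed′ : ∀ {n} → n ∈ names s → ι n ≢ ξ
          unnamed′ i e = unnamed (lose (Named.rho∈ N i) (trans (Named.ι-rho N i) (trans (cong ρ e) (orbit-bx _ cη))))
        ... | _ , cs₂ , _ , e₂
          with Realized-quad N M (ρ (ρ (ρ (α (ι x))))) (ρ-bx _ (ρ-ax _ (ρ-bx _ cη)))
            (λ i e → unnamed (lose (Named.rho∈ N i) (trans (Named.ι-rho N i) (trans (cong ρ e) (orbit-bx _ cη)))))
        ...   | N′ , M′ = try-sound f (addQuad s) _ cs₂ N′ M′ (∈-++⁺ˡ x∈) (∈-++⁺ʳ (names s) (there (here refl)))
                    (trans (cong α (extend-old {nt s} {ι} {turning (ρ (ρ (ρ (α (ι x)))))} {x} (Named.old-tile N x∈)))
                      (trans (sym (orbit-bx _ cη))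
                           (sym (extend-new {nt s} {ι} {turning (ρ (ρ (ρ (α (ι x)))))} {quadn (nt s) 1} refl)))) e₂

        old-sound : ∀ f s {x w} cs ws {cs′ ι} (N : Named (names s) (nt s) ι) → Matched N (rows s) →
          x ∈ names s → w ∈ names s → w ∈ ws → α (ι x) ≡ ι w → old f s x ws cs ≡ just cs′ → Goal
        old-sound f s {x} cs (w ∷ ws) N M x∈ w∈ i αx e with try f s x w cs in eᵗ
        old-sound f s {x} cs (w ∷ ws) N M x∈ w∈ (here refl) αx e | just cs₁ = try-sound f s w cs N M x∈ w∈ αx eᵗ
        old-sound f s {x} cs (w ∷ ws) N M x∈ w∈ (there i) αx e | just cs₁ = old-sound f s cs₁ ws N M x∈ w∈ i αx e

        try-sound : ∀ f s {x} w cs {cs′ ι} (N : Named (names s) (nt s) ι) → Matched N (rows s) →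
          x ∈ names s → w ∈ names s → α (ι x) ≡ ι w → try f s x w cs ≡ just cs′ → Goal
        try-sound f s {x} w cs {ι = ι} N M x∈ w∈ αx e with link 100 (rows s) x w | link-sound N 100 M x∈ w∈ αx
        ... | _ | r , refl , M′ = search-sound f (st (nt s) (names s) r) cs (ι , N , M′) e

-- Comparison of a complete state with a given graph

-- By finiteness `G` is bijective. At each vertex it sends the three distinct neighbours to three
-- distinct neighbours, which are all there are; so adjacency is reflected too.
Iso-from-injective : ∀ {n} {M N : CubicMap n} → Simple N → (G : Fin n → Fin n) →
  (∀ {u v} → G u ≡ G v → u ≡ v) → (∀ u i → Adj M (G u) (G (nbr N u i))) → Iso M N
Iso-from-injective {n} {M} {N} simple G inj hom = f , G , Gf , fG , reflects , preserves
  where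
  f : Fin n → Fin n
  f v = proj₁ (injective⇒surjective G inj v)
  Gf : ∀ v → G (f v) ≡ v
  Gf v = proj₂ (injective⇒surjective G inj v)
  fG : ∀ u → f (G u) ≡ u
  fG u = inj (Gf (G u))
  preserves : ∀ u v → Adj N (f u) (f v) → Adj M u v
  preserves u v (i , e) = subst₂ (Adj M) (Gf u) (trans (cong G e) (Gf v)) (hom (f u) i)
  reflects : ∀ u v → Adj M u v → Adj N (f u) (f v)
  reflects u v (i , e) = j , inj
    (trans (sym (proj₂ (hom (f u) j))) (trans (cong₂ (nbr M) (Gf u) kj) (trans e (sym (Gf v)))))
    where
    k : Fin 3 → Fin 3
    k j = proj₁ (hom (f u) j)
    k-inj : ∀ {j j′} → k j ≡ k j′ → j ≡ j′
    k-inj {j} {j′} q with j Fin.≟ j′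
    ... | yes j≡j′ = j≡j′
    ... | no j≢j′ = ⊥-elim (proj₂ simple (f u) j j′ j≢j′ (inj
            (trans (sym (proj₂ (hom (f u) j))) (trans (cong (nbr M (G (f u))) q) (proj₂ (hom (f u) j′))))))
    j : Fin 3
    j = proj₁ (injective⇒surjective k k-inj i)
    kj : k j ≡ i
    kj = proj₂ (injective⇒surjective k k-inj i)

all-Fin : ∀ n → (Fin n → Bool) → Bool
all-Fin zero p = true
all-Fin (suc n) p = if p zero then all-Fin n (λ i → p (suc i)) else false

all-Fin-sound : ∀ n p → all-Fin n p ≡ true → ∀ i → p i ≡ true
all-Fin-sound (suc n) p e i with p zero in p₀
all-Fin-sound (suc n) p e zero | true = p₀
all-Fin-sound (suc n) p e (suc i) | true = all-Fin-sound n (λ i → p (suc i)) e i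

all-List : {A : Set} → (A → Bool) → List A → Bool
all-List p [] = true
all-List p (x ∷ xs) = if p x then all-List p xs else false

all-List-sound : {A : Set} (p : A → Bool) (xs : List A) → all-List p xs ≡ true → ∀ {x} → x ∈ xs → p x ≡ true
all-List-sound p (x ∷ xs) e i with p x in px
all-List-sound p (x ∷ xs) e (here refl) | true = px
all-List-sound p (x ∷ xs) e (there i) | true = all-List-sound p xs e i

_∈ᵇ_ : Name → List Name → Bool
n ∈ᵇ [] = false
n ∈ᵇ (x ∷ xs) = if n == x then true else n ∈ᵇ xs

∈ᵇ-sound : ∀ n xs → n ∈ᵇ xs ≡ true → n ∈ xs
∈ᵇ-sound n (x ∷ xs) e with n == x in q
... | true = here (==-sound n x q)
... | false = there (∈ᵇ-sound n xs e)

distinctᵇ : List Name → Bool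
distinctᵇ [] = true
distinctᵇ (x ∷ xs) = if x ∈ᵇ xs then false else distinctᵇ xs

∈ᵇ-complete : ∀ {n xs} → n ∈ xs → n ∈ᵇ xs ≡ true
∈ᵇ-complete {n} (here refl) rewrite ==-refl n = refl
∈ᵇ-complete {n} {x ∷ xs} (there i) with n == x
... | true = refl
... | false = ∈ᵇ-complete i

distinctᵇ-sound : ∀ xs → distinctᵇ xs ≡ true → Unique xs
distinctᵇ-sound [] e = []
distinctᵇ-sound (x ∷ xs) e with x ∈ᵇ xs in q
... | false = All.tabulate (λ i r → false≢true (trans (sym q) (∈ᵇ-complete (subst (_∈ xs) (sym r) i))))
            ∷ distinctᵇ-sound xs e
  where
  false≢true : false ≢ true
  false≢true ()

nth : {A : Set} → A → List A → ℕ → A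
nth a [] _ = a
nth a (x ∷ xs) zero = x
nth a (x ∷ xs) (suc k) = nth a xs k

nth-∈ : {A : Set} (a : A) (xs : List A) → ∀ {k} → k < length xs → nth a xs k ∈ xs
nth-∈ a (x ∷ xs) {zero} _ = here refl
nth-∈ a (x ∷ xs) {suc k} (s≤s k<) = there (nth-∈ a xs k<)

nth-injective : {A : Set} (a : A) {xs : List A} → Unique xs → ∀ k l → k < length xs → l < length xs →
  nth a xs k ≡ nth a xs l → k ≡ l
nth-injective a (_ ∷ _) zero zero _ _ e = refl
nth-injective a {_ ∷ xs} (u ∷ _) zero (suc l) _ (s≤s l<) e = ⊥-elim (All.lookup u (nth-∈ a xs l<) e)
nth-injective a {_ ∷ xs} (u ∷ _) (suc k) zero (s≤s k<) _ e = ⊥-elim (All.lookup u (nth-∈ a xs k<) (sym e))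
nth-injective a (_ ∷ us) (suc k) (suc l) (s≤s k<) (s≤s l<) e = cong suc (nth-injective a us k l k< l< e)

isJust : {A : Set} → Maybe A → Bool
isJust (just _) = true
isJust nothing = false

-- A leaf is claimed to be the given graph, its first vertex being placed at root and
-- its first dart at the given turn from that spoke, possibly reversing orientation.
record Cert (k : ℕ) : Set where
  constructor cert
  field
    graph : ℕ
    root : Name
    dart : ℕ
    mirrored : Bool

clamp : ∀ n → ℕ → Fin (suc n)
clamp zero _ = zero
clamp (suc n) zero = zero
clamp (suc n) (suc k) = suc (clamp n k)

module Leaves (m : ℕ) {k n : ℕ} (L : Fin (suc k) → CubicMap n) where
  open Engine m

  isPrim : Name → Bool
  isPrim w with clsn w
  ... | bx = false
  ... | _ = true

  -- A vertex is named by its spoke of class hx or ax.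
  prim : Name → Name
  prim w with clsn w
  ... | bx = rho w
  ... | _ = w

  -- The index counts turns from the naming spoke. On a tile face, one and two turns give the sides
  -- towards `rho x` and `rhi x`; at a matching edge, one turn gives the matching edge and two turns
  -- the `bx` spoke `rhi x` at the same vertex.
  neighbour : List Row → Name → Fin 3 → Maybe Name
  neighbour r x zero = Maybe.map prim (look r x)
  neighbour r x (suc zero) = just (prim (rho x))
  neighbour r x@(hexn _ _) (suc (suc zero)) = just (rhi x)
  neighbour r x@(quadn _ _) (suc (suc zero)) = Maybe.map prim (look r (rhi x))

  _is_ : Maybe Name → Name → Bool
  nothing is w = false
  just x is w = x == w

  joined : List Row → Name → Name → Bool
  joined r x w = if neighbour r x zero is w then true else
    (if neighbour r x (suc zero) is w then true else neighbour r x (suc (suc zero)) is w)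

  NDart : Set
  NDart = Name × Fin 3

  -- A dart is written as a naming spoke with a number of turns. Arriving along a `bx` spoke means
  -- arriving two turns after the `ax` spoke of that vertex.
  αᴺ : List Row → NDart → NDart
  αᴺ r (x , zero) = land (look r x)
    where
    land : Maybe Name → NDart
    land nothing = x , zero
    land (just w) with clsn w
    ... | bx = rho w , suc (suc zero)
    ... | _ = w , zero
  αᴺ r (x@(hexn _ _) , suc zero) = rho x , suc (suc zero)
  αᴺ r (x@(quadn _ _) , suc zero) = rho (rho x) , suc zero
  αᴺ r (x@(hexn _ _) , suc (suc zero)) = rhi x , suc zero
  αᴺ r (x@(quadn _ _) , suc (suc zero)) = land (look r (rhi x))
    where
    land : Maybe Name → NDart
    land nothing = x , zero
    land (just w) with clsn w
    ... | bx = rho w , suc (suc zero)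
    ... | _ = w , zero

  turnᴺ : Bool → Fin 3 → NDart → NDart
  turnᴺ _ zero d = d
  turnᴺ false (suc zero) (x , i) = x , rot i
  turnᴺ true (suc zero) (x , i) = x , rot (rot i)
  turnᴺ false (suc (suc zero)) (x , i) = x , rot (rot i)
  turnᴺ true (suc (suc zero)) (x , i) = x , rot i

  -- In the given graphs the dart 0 of every vertex but the first leads to an
  -- earlier vertex, so a placement is determined by that of the first vertex.
  place : List Row → Bool → CubicMap n → List (Fin n) → List NDart → ℕ → List NDart
  place r b N [] placed l = placed
  place r b N (v ∷ vs) placed l = place r b N vs
    (αᴺ r (parent (CubicMap.α N (v , zero))) ∷ placed) (suc l)
    where
    parent : Dart n → NDart
    -- `placed` starts with the latest vertex, whose number is `l`, so vertex `u` is at position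
    -- `l ∸ toℕ u`.
    parent (u , i) = turnᴺ b i (nth (hexn 0 0 , zero) placed (l ∸ toℕ u))

  drop-first : List (Fin n) → List (Fin n)
  drop-first [] = []
  drop-first (_ ∷ vs) = vs

  placement : List Row → Cert k → List Name
  placement r (cert g x j b) =
    reverse (map proj₁ (place r b (L (clamp k g)) (drop-first (allFin n)) ((x , clamp 2 j) ∷ []) 0))

  -- These tests are exactly what `Iso-from-injective` asks for, wherever the placement comes from;
  -- a bad certificate can only make the search fail.
  fits : List Name → List Row → CubicMap n → List Name → Bool
  fits ns r N F = if length F ≡ᵇ n
    then (if distinctᵇ F
      then all-Fin n (λ u → good u (at u))
      else false) else false
    where
    at : Fin n → Name
    at u = nth (hexn 0 0) F (toℕ u)
    good : Fin n → Name → Bool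
    good u x = if x ∈ᵇ ns then (if isPrim x
      then all-Fin 3 (λ i → joined r x (at (nbr N u i))) else false) else false

  leaf : State → List (Cert k) → Maybe (List (Cert k))
  leaf (st _ [] r) cs = nothing
  -- `pick` only notices spokes that follow a matched one, so it is tested here that every spoke is
  -- matched. If fewer than `n` vertices are named in a closed state, connectedness is violated and
  -- no certificate is used.
  leaf (st _ ns@(_ ∷ _) r) cs = if all-List (λ x → isJust (look r x)) ns
    then (if length (filterᵇ isPrim ns) <ᵇ n then just cs else use cs) else nothing
    where
    use : List (Cert k) → Maybe (List (Cert k))
    use [] = nothing
    use (q ∷ cs) = if fits ns r (L (clamp k (Cert.graph q))) (placement r q) then just cs else nothing

  -- The run starts with `branch` at a given spoke because nothing is matched in the initial state,
  -- where `pick` would find no spoke.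
  record Exhausted (capH capA : ℕ) (s : State) (x : Name) : Set where
    constructor exhausted
    field
      {fuel} : ℕ
      {certs rest} : List (Cert k)
      run : Search.branch leaf capH capA fuel s x certs ≡ just rest

-- Tilings of fullerenes

turn : ∀ {n} → Dart n → Dart n
turn (v , i) = v , rot i

turn³ : ∀ {n} (d : Dart n) → turn (turn (turn d)) ≡ d
turn³ (v , zero) = refl
turn³ (v , suc zero) = refl
turn³ (v , suc (suc zero)) = refl

turn-≢ : ∀ {n} (d : Dart n) → turn d ≢ d
turn-≢ (v , zero) ()
turn-≢ (v , suc zero) ()
turn-≢ (v , suc (suc zero)) ()

turn-inj : ∀ {n} {d e : Dart n} → turn d ≡ turn e → d ≡ e
turn-inj {d = d} {e} p = trans (sym (turn³ d)) (trans (cong (λ x → turn (turn x)) p) (turn³ e))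

_≟ᵈ_ : ∀ {n} → DecidableEquality (Dart n)
_≟ᵈ_ = ≡-dec Fin._≟_ Fin._≟_

same-vertex : ∀ {n} (d e : Dart n) → proj₁ d ≡ proj₁ e → e ≡ d ⊎ e ≡ turn d ⊎ e ≡ turn (turn d)
same-vertex (v , zero) (v , zero) refl = inj₁ refl
same-vertex (v , zero) (v , suc zero) refl = inj₂ (inj₁ refl)
same-vertex (v , zero) (v , suc (suc zero)) refl = inj₂ (inj₂ refl)
same-vertex (v , suc zero) (v , zero) refl = inj₂ (inj₂ refl)
same-vertex (v , suc zero) (v , suc zero) refl = inj₁ refl
same-vertex (v , suc zero) (v , suc (suc zero)) refl = inj₂ (inj₁ refl)
same-vertex (v , suc (suc zero)) (v , zero) refl = inj₂ (inj₁ refl)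
same-vertex (v , suc (suc zero)) (v , suc zero) refl = inj₂ (inj₂ refl)
same-vertex (v , suc (suc zero)) (v , suc (suc zero)) refl = inj₁ refl

turns : ∀ {n} → Fin 3 → Dart n → Dart n
turns zero d = d
turns (suc zero) d = turn d
turns (suc (suc zero)) d = turn (turn d)

turns-onto : ∀ {n} (d : Dart n) i → ∃ λ j → turns j d ≡ (proj₁ d , i)
turns-onto d i with same-vertex d (proj₁ d , i) refl
... | inj₁ e = zero , sym e
... | inj₂ (inj₁ e) = suc zero , sym e
... | inj₂ (inj₂ e) = suc (suc zero) , sym e

record CubicTiles {n : ℕ} (M : CubicMap n) (m capH capA : ℕ) : Set where
  field
    system : Engine.TileSystem m (Dart n) capH capA
  open Engine.TileSystem system public
  field
    same-α : ∀ d → α d ≡ CubicMap.α M d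
    ρ-pair : ∀ d → c d ≡ bx → ρ d ≡ turn d
    ρ-at-hx : ∀ d → c d ≡ hx → ρ d ≡ turn (CubicMap.α M (turn d))
    ρ-at-ax : ∀ d → c d ≡ ax → ρ d ≡ turn (CubicMap.α M (turn d))
    primary-inj : ∀ {d e} → c d ≡ hx ⊎ c d ≡ ax → c e ≡ hx ⊎ c e ≡ ax → proj₁ d ≡ proj₁ e → d ≡ e

-- Faces as orbits of `φ`

module Faces {n : ℕ} (M : CubicMap n) where
  open CubicMap M

  SameFace : Dart n → Dart n → Set
  SameFace d e = ∃ λ j → iter M j d ≡ e

  α-inj : ∀ {d e} → α d ≡ α e → d ≡ e
  α-inj {d} {e} p = trans (sym (α-invol d)) (trans (cong α p) (α-invol e))

  φ-α : ∀ d → φ M (α d) ≡ turn d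
  φ-α d = cong turn (α-invol d)

  φ-inj : ∀ {d e} → φ M d ≡ φ M e → d ≡ e
  φ-inj p = α-inj (turn-inj p)

  iter-+ : ∀ a b d → iter M (a + b) d ≡ iter M a (iter M b d)
  iter-+ zero b d = refl
  iter-+ (suc a) b d = cong (φ M) (iter-+ a b d)

  iter-suc : ∀ a d → iter M a (φ M d) ≡ iter M (suc a) d
  iter-suc zero d = refl
  iter-suc (suc a) d = cong (φ M) (iter-suc a d)

  iter-inj : ∀ a {d e} → iter M a d ≡ iter M a e → d ≡ e
  iter-inj zero p = p
  iter-inj (suc a) p = iter-inj a (φ-inj p)

  SameFace-trans : ∀ {d e f} → SameFace d e → SameFace e f → SameFace d f
  SameFace-trans {d} (a , refl) (b , refl) = b + a , iter-+ b a d

  iter-reduce : ∀ {d k} → 1 ≤ k → iter M k d ≡ d → ∀ j → ∃ λ j′ → j′ < k × iter M j d ≡ iter M j′ d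
  iter-reduce 1≤k p zero = 0 , 1≤k , refl
  iter-reduce 1≤k p (suc j) with iter-reduce 1≤k p j
  ... | j′ , j′<k , q with m≤n⇒m<n∨m≡n j′<k
  ...   | inj₁ sj′<k = suc j′ , sj′<k , cong (φ M) q
  ...   | inj₂ refl = 0 , 1≤k , trans (cong (φ M) q) p

  FaceLen-φ : ∀ {d k} → FaceLen M d k → FaceLen M (φ M d) k
  FaceLen-φ {d} {k} (1≤k , p , q) = 1≤k , trans (iter-suc k d) (cong (φ M) p) ,
    λ j 1≤j j<k e → q j 1≤j j<k (φ-inj (trans (sym (iter-suc j d)) e))

  FaceLen-iter : ∀ j {d k} → FaceLen M d k → FaceLen M (iter M j d) k
  FaceLen-iter zero l = l
  FaceLen-iter (suc j) l = FaceLen-φ (FaceLen-iter j l)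

  FaceLen-unique : ∀ {d k l} → FaceLen M d k → FaceLen M d l → ¬ k < l
  FaceLen-unique (1≤k , p , _) (_ , _ , q) k<l = q _ 1≤k k<l p

  SameFace-sym : ∀ {d e k} → FaceLen M d k → SameFace d e → SameFace e d
  SameFace-sym {d} {k = k} (1≤k , p , _) (j , refl) with iter-reduce 1≤k p j
  ... | j′ , j′<k , q with m≤n⇒∃ j′<k
    where
    m≤n⇒∃ : ∀ {a b} → a < b → ∃ λ o → o + a ≡ b
    m≤n⇒∃ {zero} {b} _ = b , +-identityʳ b
    m≤n⇒∃ {suc a} (s≤s l) with m≤n⇒∃ l
    ... | o , refl = o , +-suc o a
  ...   | o , refl = o , trans (cong (iter M o) q) (trans (sym (iter-+ o j′ d)) p)

  iter-distinct : ∀ {d k} → FaceLen M d k → ∀ a o → suc o + a < k → iter M (suc o + a) d ≢ iter M a d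
  iter-distinct {d} (_ , _ , q) a o l e =
    q (suc o) (s≤s z≤n) (≤-trans (s≤s (m≤m+n (suc o) a)) l)
      (iter-inj a (trans (sym (iter-+ a (suc o) d)) (trans (cong (λ k → iter M k d) (+-comm a (suc o))) e)))
    where open import Data.Nat.Properties using (m≤m+n; +-comm)

module SimpleFaces {n : ℕ} (M : CubicMap n) (simple : Simple M)
                   (faces : ∀ d → FaceLen M d 5 ⊎ FaceLen M d 6) where
  open CubicMap M
  open Faces M public

  α-moves : ∀ d → proj₁ (α d) ≢ proj₁ d
  α-moves (v , i) = proj₁ simple v i

  α-≢ : ∀ d → α d ≢ d
  α-≢ d p = α-moves d (cong proj₁ p)

  φ²-moves : ∀ d → proj₁ (φ M (φ M d)) ≢ proj₁ d
  φ²-moves d p = proj₂ simple (proj₁ (α d)) (rot (proj₂ (α d))) (proj₂ (α d))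
    (λ q → turn-≢ (α d) (cong (proj₁ (α d) ,_) q)) (trans p (cong proj₁ (sym (α-invol d))))

  -- An edge with the same face on both sides is impossible for faces of length five or six:
  -- following the face forwards from `d`, or onwards from `α d` back to `d`, each possible distance
  -- gives a loop, a double edge or a fixed point of `turn`.
  off-reverse : ∀ d j → iter M j d ≢ α d
  off-reverse d j e with faces d
  ... | inj₁ (1≤5 , p , _) with iter-reduce 1≤5 p j
  ...   | 0 , _ , q = α-≢ d (trans (sym e) q)
  ...   | 1 , _ , q = turn-≢ (α d) (trans (sym q) e)
  ...   | 2 , _ , q = α-moves (φ M d) (cong proj₁ (trans (sym q) e))
  ...   | 3 , _ , q = φ²-moves (φ M d) (cong proj₁ (trans (sym q) e))
  ...   | 4 , _ , q = turn-≢ d (trans (sym (φ-α d)) (trans (cong (φ M) (trans (sym e) q)) p))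
  ...   | suc (suc (suc (suc (suc _)))) , s≤s (s≤s (s≤s (s≤s (s≤s ())))) , _
  off-reverse d j e | inj₂ (1≤6 , p , _) with iter-reduce 1≤6 p j
  ...   | 0 , _ , q = α-≢ d (trans (sym e) q)
  ...   | 1 , _ , q = turn-≢ (α d) (trans (sym q) e)
  ...   | 2 , _ , q = α-moves (φ M d) (cong proj₁ (trans (sym q) e))
  ...   | 3 , _ , q = φ²-moves (φ M d) (cong proj₁ (trans (sym q) e))
  ...   | 4 , _ , q = α-moves (turn d) (cong proj₁ (trans (cong (φ M) (sym (trans (cong (φ M) (trans (sym q) e)) (φ-α d)))) p))
  ...   | 5 , _ , q = turn-≢ d (trans (sym (φ-α d)) (trans (cong (φ M) (trans (sym e) q)) p))
  ...   | suc (suc (suc (suc (suc (suc _))))) , s≤s (s≤s (s≤s (s≤s (s≤s (s≤s ()))))) , _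

  -- Since `turn d` is `φ (α d)`, such a face would contain both `d` and `α d`. It follows that a
  -- face passes each vertex only once.
  face-turn : ∀ {d} → ¬ SameFace d (turn d)
  face-turn {d} (zero , e) = turn-≢ d (sym e)
  face-turn {d} (suc j , e) = off-reverse d j (φ-inj (trans e (sym (φ-α d))))

  sym-face : ∀ {d e} → SameFace d e → SameFace e d
  sym-face {d} s with faces d
  ... | inj₁ l = SameFace-sym l s
  ... | inj₂ l = SameFace-sym l s

  face-vertex-inj : ∀ {d e} → SameFace d e → proj₁ d ≡ proj₁ e → e ≡ d
  face-vertex-inj {d} {e} s p with same-vertex d e p
  ... | inj₁ q = q
  ... | inj₂ (inj₁ refl) = ⊥-elim (face-turn s)
  ... | inj₂ (inj₂ refl) = ⊥-elim (face-turn (subst (SameFace _) (sym (turn³ d)) (sym-face s)))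

  -- Tile faces and matching edges as a tile system

  module Tiling (m : ℕ)
    (OnT : Dart n → Set) (OnT? : ∀ d → Dec (OnT d))
    (OnT-φ : ∀ {d} → OnT d → OnT (φ M d)) (OnT-φ⁻ : ∀ {d} → OnT (φ M d) → OnT d)
    (OnT-turn : ∀ {d} → OnT d → ¬ OnT (turn d)) (OnT-len : ∀ {d} → OnT d → FaceLen M d (suc m))
    (p : Fin n → Fin n)
    (match : ∀ v → ¬ (∃ λ i → OnT (v , i)) → Adj M v (p v) × ¬ (∃ λ i → OnT (p v , i)) × p (p v) ≡ v)
    where

    Bare : Fin n → Set
    Bare v = ¬ (∃ λ i → OnT (v , i))

    Paired : Dart n → Set
    Paired d = Bare (proj₁ d) × proj₁ (α d) ≡ p (proj₁ d)

    Exit : Dart n → Set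
    Exit d = Paired (turn d)

    Paired-α : ∀ {d} → Paired d → Paired (α d)
    Paired-α {d} (bare , e) = subst Bare (sym e) (proj₁ (proj₂ (match _ bare))) ,
      trans (cong proj₁ (α-invol d)) (trans (sym (proj₂ (proj₂ (match _ bare)))) (cong p (sym e)))

    -- The corner at d lies between the darts turn² d and d.
    data Corner (d : Dart n) : Set where
      inside : OnT d → Corner d
      prev-tile : OnT (turn (turn d)) → Corner d
      next-tile : OnT (turn d) → Corner d
      prev-pair : Paired (turn (turn d)) → Corner d
      next-pair : Paired d → Corner d
      exit : Exit d → Corner d

    bare-vertex : ∀ d → ¬ OnT d → ¬ OnT (turn d) → ¬ OnT (turn (turn d)) → Bare (proj₁ d)
    bare-vertex d t₀ t₁ t₂ (i , t) with same-vertex d (proj₁ d , i) refl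
    ... | inj₁ e = t₀ (subst OnT e t)
    ... | inj₂ (inj₁ e) = t₁ (subst OnT e t)
    ... | inj₂ (inj₂ e) = t₂ (subst OnT e t)

    abstract
      corner : ∀ d → Corner d
      corner d with OnT? d | OnT? (turn d) | OnT? (turn (turn d))
      ... | yes t | _ | _ = inside t
      ... | _ | yes t | _ = next-tile t
      ... | _ | _ | yes t = prev-tile t
      ... | no t₀ | no t₁ | no t₂ with match (proj₁ d) (bare-vertex d t₀ t₁ t₂)
      ...   | (i , e) , _ with same-vertex d (proj₁ d , i) refl
      ...     | inj₁ refl = next-pair (bare-vertex d t₀ t₁ t₂ , e)
      ...     | inj₂ (inj₁ refl) = exit (bare-vertex d t₀ t₁ t₂ , e)
      ...     | inj₂ (inj₂ refl) = prev-pair (bare-vertex d t₀ t₁ t₂ , e)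

    class : ∀ {d} → Corner d → Class
    class (prev-tile _) = hx
    class (exit _) = ax
    class (prev-pair _) = bx
    class _ = none

    c : Dart n → Class
    c d = class (corner d)

    OnT-turn² : ∀ {d} → OnT d → ¬ OnT (turn (turn d))
    OnT-turn² {d} t t₂ = OnT-turn t₂ (subst OnT (sym (turn³ d)) t)

    Paired-turn : ∀ {d} → Paired d → ¬ Paired (turn d)
    Paired-turn {v , i} (_ , e) (_ , e′) =
      proj₂ simple v (rot i) i (λ q → turn-≢ (v , i) (cong (v ,_) q)) (trans e′ (sym e))

    Paired-turn² : ∀ {d} → Paired d → ¬ Paired (turn (turn d))
    Paired-turn² {d} t t₂ = Paired-turn t₂ (subst Paired (sym (turn³ d)) t)

    -- Alternatives of different classes exclude each other, so the class of a dart can be read off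
    -- any description of its corner.
    class-unique : ∀ {d} (a b : Corner d) → class a ≡ class b
    class-unique (inside x) (inside y) = refl
    class-unique (inside x) (prev-tile y) = ⊥-elim (OnT-turn² x y)
    class-unique (inside x) (next-tile y) = refl
    class-unique (inside x) (prev-pair (b , _)) = ⊥-elim (b (_ , x))
    class-unique (inside x) (next-pair y) = refl
    class-unique (inside x) (exit (b , _)) = ⊥-elim (b (_ , x))
    class-unique (prev-tile x) (inside y) = ⊥-elim (OnT-turn² y x)
    class-unique (prev-tile x) (prev-tile y) = refl
    class-unique (prev-tile x) (next-tile y) = ⊥-elim (OnT-turn y x)
    class-unique (prev-tile x) (prev-pair (b , _)) = ⊥-elim (b (_ , x))
    class-unique (prev-tile x) (next-pair (b , _)) = ⊥-elim (b (_ , x))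
    class-unique (prev-tile x) (exit (b , _)) = ⊥-elim (b (_ , x))
    class-unique (next-tile x) (inside y) = refl
    class-unique (next-tile x) (prev-tile y) = ⊥-elim (OnT-turn x y)
    class-unique (next-tile x) (next-tile y) = refl
    class-unique (next-tile x) (prev-pair (b , _)) = ⊥-elim (b (_ , x))
    class-unique (next-tile x) (next-pair y) = refl
    class-unique (next-tile x) (exit (b , _)) = ⊥-elim (b (_ , x))
    class-unique (prev-pair (b , _)) (inside y) = ⊥-elim (b (_ , y))
    class-unique (prev-pair (b , _)) (prev-tile y) = ⊥-elim (b (_ , y))
    class-unique (prev-pair (b , _)) (next-tile y) = ⊥-elim (b (_ , y))
    class-unique (prev-pair x) (prev-pair y) = refl
    class-unique (prev-pair x) (next-pair y) = ⊥-elim (Paired-turn² y x)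
    class-unique (prev-pair x) (exit y) = ⊥-elim (Paired-turn y x)
    class-unique (next-pair x) (inside y) = refl
    class-unique (next-pair (b , _)) (prev-tile y) = ⊥-elim (b (_ , y))
    class-unique (next-pair x) (next-tile y) = refl
    class-unique (next-pair x) (prev-pair y) = ⊥-elim (Paired-turn² x y)
    class-unique (next-pair x) (next-pair y) = refl
    class-unique (next-pair x) (exit y) = ⊥-elim (Paired-turn x y)
    class-unique (exit (b , _)) (inside y) = ⊥-elim (b (_ , y))
    class-unique (exit (b , _)) (prev-tile y) = ⊥-elim (b (_ , y))
    class-unique (exit (b , _)) (next-tile y) = ⊥-elim (b (_ , y))
    class-unique (exit x) (prev-pair y) = ⊥-elim (Paired-turn x y)
    class-unique (exit x) (next-pair y) = ⊥-elim (Paired-turn y x)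
    class-unique (exit x) (exit y) = refl

    c-of : ∀ {d} (a : Corner d) → c d ≡ class a
    c-of {d} a = class-unique (corner d) a

    hx-tile : ∀ d → c d ≡ hx → OnT (turn (turn d))
    hx-tile d e with corner d
    hx-tile d refl | prev-tile t = t

    ax-exit : ∀ d → c d ≡ ax → Exit d
    ax-exit d e with corner d
    ax-exit d refl | exit t = t

    bx-pair : ∀ d → c d ≡ bx → Paired (turn (turn d))
    bx-pair d e with corner d
    bx-pair d refl | prev-pair t = t

    -- The darts of class `none` are those along tile sides and matching edges, a property of the
    -- edge and not of its direction.
    spoke-α : ∀ d → c d ≢ none → c (α d) ≢ none
    spoke-α d s e with corner (α d)
    ... | inside t = s (c-of (next-tile (subst OnT (φ-α d) (OnT-φ t))))
    ... | next-tile t = s (c-of (inside (OnT-φ⁻ t)))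
    ... | next-pair q = s (c-of (next-pair (subst Paired (α-invol d) (Paired-α q))))

    -- The next spoke of a tile: at the vertex before it on a tile face, and
    -- around the two ends of a matching edge.
    ρ : Dart n → Dart n
    ρ d with c d
    ... | bx = turn d
    ... | _ = turn (α (turn d))

    ρ-pair : ∀ d → c d ≡ bx → ρ d ≡ turn d
    ρ-pair d e rewrite e = refl

    ρ-skip : ∀ d → c d ≢ bx → ρ d ≡ turn (α (turn d))
    ρ-skip d e with c d
    ... | hx = refl
    ... | ax = refl
    ... | bx = ⊥-elim (e refl)
    ... | none = refl

    ρ-at-hx : ∀ d → c d ≡ hx → ρ d ≡ turn (α (turn d))
    ρ-at-hx d e = ρ-skip d λ e′ → hx≢bx (trans (sym e) e′)
      where
      hx≢bx : hx ≢ bx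
      hx≢bx ()

    ρ-at-ax : ∀ d → c d ≡ ax → ρ d ≡ turn (α (turn d))
    ρ-at-ax d e = ρ-skip d λ e′ → ax≢bx (trans (sym e) e′)
      where
      ax≢bx : ax ≢ bx
      ax≢bx ()

    -- On a tile face `ρ` walks against `φ`; thus the length of the face becomes the order of `ρ`.
    turn²ρ-hx : ∀ d → c d ≡ hx → φ M (turn (turn (ρ d))) ≡ turn (turn d)
    turn²ρ-hx d e rewrite ρ-at-hx d e | turn³ (α (turn d)) = φ-α (turn d)

    ρ-hx : ∀ d → c d ≡ hx → c (ρ d) ≡ hx
    ρ-hx d e = c-of (prev-tile (OnT-φ⁻ (subst OnT (sym (turn²ρ-hx d e)) (hx-tile d e))))

    ρ-ax : ∀ d → c d ≡ ax → c (ρ d) ≡ bx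
    ρ-ax d e rewrite ρ-at-ax d e =
      c-of (prev-pair (subst Paired (sym (turn³ _)) (Paired-α (ax-exit d e))))

    ρ-bx : ∀ d → c d ≡ bx → c (ρ d) ≡ ax
    ρ-bx d e rewrite ρ-pair d e = c-of (exit (bx-pair d e))

    open Engine m using (iterate; TileSystem)

    hx-iterate : ∀ k d → c d ≡ hx → c (iterate k ρ d) ≡ hx × iter M k (turn (turn (iterate k ρ d))) ≡ turn (turn d)
    hx-iterate zero d e = e , refl
    hx-iterate (suc k) d e with hx-iterate k d e
    ... | e′ , q = ρ-hx _ e′ , trans (sym (iter-suc k _)) (trans (cong (iter M k) (turn²ρ-hx _ e′)) q)

    orbit-hx : ∀ d → c d ≡ hx → iterate (suc m) ρ d ≡ d
    orbit-hx d e with hx-iterate (suc m) d e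
    ... | e′ , q = turn-inj (turn-inj (trans (sym (proj₁ (proj₂ (OnT-len (hx-tile _ e′))))) q))

    orbit-hx-min : ∀ d k → c d ≡ hx → k < m → iterate (suc k) ρ d ≢ d
    orbit-hx-min d k e k<m q with hx-iterate (suc k) d e
    ... | _ , r = proj₂ (proj₂ (OnT-len (hx-tile d e))) (suc k) (s≤s z≤n) (s≤s k<m)
                    (trans (cong (λ x → iter M (suc k) (turn (turn x))) (sym q)) r)

    ρ²-ax : ∀ d → c d ≡ ax → ρ (ρ d) ≡ turn (turn (α (turn d)))
    ρ²-ax d e = trans (ρ-pair (ρ d) (ρ-ax d e)) (cong turn (ρ-at-ax d e))

    orbit-ax : ∀ d → c d ≡ ax → ρ (ρ (ρ (ρ d))) ≡ d
    orbit-ax d e = begin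
      ρ (ρ (ρ (ρ d)))                            ≡⟨ ρ²-ax _ (ρ-bx _ (ρ-ax d e)) ⟩
      turn (turn (α (turn (ρ (ρ d)))))           ≡⟨ cong (λ x → turn (turn (α (turn x)))) (ρ²-ax d e) ⟩
      turn (turn (α (turn (turn (turn (α (turn d))))))) ≡⟨ cong (λ x → turn (turn (α x))) (turn³ _) ⟩
      turn (turn (α (α (turn d))))               ≡⟨ cong (λ x → turn (turn x)) (α-invol _) ⟩
      turn (turn (turn d))                       ≡⟨ turn³ d ⟩
      d                                          ∎
      where open ≡-Reasoning

    orbit-bx : ∀ d → c d ≡ bx → ρ (ρ (ρ (ρ d))) ≡ d
    orbit-bx d e = turn-inj (trans (sym (ρ-pair _ e₄)) (trans (orbit-ax (ρ d) (ρ-bx d e)) (ρ-pair d e)))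
      where
      e₄ : c (ρ (ρ (ρ (ρ d)))) ≡ bx
      e₄ = ρ-ax _ (ρ-bx _ (ρ-ax _ (ρ-bx d e)))

    orbit-ax-min : ∀ d → c d ≡ ax → ρ (ρ d) ≢ d
    orbit-ax-min d e q = α-moves (turn d) (cong proj₁ (trans (sym (ρ²-ax d e)) q))

    -- At the corner of `d`, the boundary edge arriving (`Prev`) or leaving (`Next`) is a tile side
    -- or a matching edge. Such an edge is `Next` at one end and `Prev` at the other, which pairs
    -- corners.
    Prev Next : Dart n → Set
    Prev d = OnT (turn (turn d)) ⊎ Paired (turn (turn d))
    Next d = OnT (turn d) ⊎ Paired d

    Prev-class : ∀ {d} → Prev d → c d ≢ none
    Prev-class (inj₁ t) e with trans (sym (c-of (prev-tile t))) e
    ... | ()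
    Prev-class (inj₂ t) e with trans (sym (c-of (prev-pair t))) e
    ... | ()

    Next-class : ∀ {d} → Next d → c d ≡ none
    Next-class (inj₁ t) = c-of (next-tile t)
    Next-class (inj₂ t) = c-of (next-pair t)

    Next-φ : ∀ {d} → Next d → Prev (φ M d)
    Next-φ {d} (inj₁ t) = inj₁ (subst OnT (sym (turn³ (α d))) (OnT-φ⁻ (subst OnT (sym (φ-α d)) t)))
    Next-φ {d} (inj₂ q) = inj₂ (subst Paired (sym (turn³ (α d))) (Paired-α q))

    Prev-φ : ∀ {d} → Prev (φ M d) → Next d
    Prev-φ {d} (inj₁ t) = inj₁ (subst OnT (φ-α d) (OnT-φ (subst OnT (turn³ (α d)) t)))
    Prev-φ {d} (inj₂ q) = inj₂ (subst Paired (α-invol d) (Paired-α (subst Paired (turn³ (α d)) q)))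

    OnT-iter⁻ : ∀ j {d} → OnT (iter M j d) → OnT d
    OnT-iter⁻ zero t = t
    OnT-iter⁻ (suc j) t = OnT-iter⁻ j (OnT-φ⁻ t)

    sides : ∀ {d} j → ¬ OnT d → (∃ λ j → Exit (iter M j d)) ⊎ Next (iter M j d) ⊎ Prev (iter M j d)
    sides {d} j out with corner (iter M j d)
    ... | inside t = ⊥-elim (out (OnT-iter⁻ j t))
    ... | prev-tile t = inj₂ (inj₂ (inj₁ t))
    ... | next-tile t = inj₂ (inj₁ (inj₁ t))
    ... | prev-pair q = inj₂ (inj₂ (inj₂ q))
    ... | next-pair q = inj₂ (inj₁ (inj₂ q))
    ... | exit q = inj₁ (j , q)

    not-both : ∀ {d} → Next d → Prev d → ⊥
    not-both a b = Prev-class b (Next-class a)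

    -- If the following corner were `Prev`, this one would be `Next` as well, which is excluded. So
    -- without an exit the following corner starts the next pair.
    after-Prev : ∀ {d} j → ¬ OnT d → Prev (iter M j d) → (∃ λ j → Exit (iter M j d)) ⊎ Prev (iter M (2 + j) d)
    after-Prev j out b with sides (suc j) out
    ... | inj₁ q = inj₁ q
    ... | inj₂ (inj₁ a) = inj₂ (Next-φ a)
    ... | inj₂ (inj₂ b′) = ⊥-elim (not-both (Prev-φ b′) b)

    -- Tile sides and matching edges pair up the corners of a face without exits.
    pentagon-exit : ∀ {d} → FaceLen M d 5 → ¬ OnT d → ∃ λ j → Exit (iter M j d)
    pentagon-exit {d} (_ , p , _) out with sides 0 out
    ... | inj₁ q = q
    ... | inj₂ (inj₁ a) with after-Prev 1 out (Next-φ a)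
    ...   | inj₁ q = q
    ...   | inj₂ b with after-Prev 3 out b
    ...     | inj₁ q = q
    ...     | inj₂ b′ = ⊥-elim (not-both a (subst Prev p b′))
    pentagon-exit {d} (_ , p , _) out | inj₂ (inj₂ b) with after-Prev 0 out b
    ...   | inj₁ q = q
    ...   | inj₂ b₂ with after-Prev 2 out b₂
    ...     | inj₁ q = q
    ...     | inj₂ b₄ = ⊥-elim (not-both (Prev-φ (subst Prev (sym p) b)) b₄)

    -- The equality case: faces outside the tiles are triangles

    module Triangles (exit-len : ∀ {d} → Exit d → FaceLen M d 5)
                     (exit-unique : ∀ {d e} → Exit d → Exit e → SameFace d e → d ≡ e) where

      across : Dart n → Dart n
      across d = ρ (α d)

      exits : Dart n → ℕ
      exits d = exitᶜ (c (α d))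

      -- Passing a tile from a spoke crosses either an exit corner or a tile side.
      data Pass (d : Dart n) : Set where
        short : Exit (φ M d) → across d ≡ φ M d → exits d ≡ 1 → Pass d
        long : c (φ M d) ≡ none → across d ≡ φ M (φ M d) → exits d ≡ 0 → Pass d

      pass : ∀ d → c d ≢ none → Pass d
      pass d s with c (α d) in e
      ... | none = ⊥-elim (spoke-α d s e)
      ... | bx = short (bx-pair _ e) (ρ-pair _ e) (cong exitᶜ e)
      ... | ax = long (c-of (next-pair (ax-exit _ e))) (ρ-at-ax _ e) (cong exitᶜ e)
      ... | hx = long (c-of (next-tile (hx-tile _ e))) (ρ-at-hx _ e) (cong exitᶜ e)

      ρ-spoke : ∀ {d} κ → c d ≡ κ → κ ≢ none → c (ρ d) ≢ none
      ρ-spoke hx e _ rewrite ρ-hx _ e = λ ()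
      ρ-spoke ax e _ rewrite ρ-ax _ e = λ ()
      ρ-spoke bx e _ rewrite ρ-bx _ e = λ ()
      ρ-spoke none _ s = ⊥-elim (s refl)

      across-spoke : ∀ d → c d ≢ none → c (across d) ≢ none
      across-spoke d s = ρ-spoke _ refl (spoke-α d s)

      -- Uniqueness would make the two exits equal, but fewer than five steps along a pentagon never
      -- return to the start.
      exits-apart : ∀ {d e} o → Exit d → Exit e → iter M (suc o) d ≡ e → o < 4 → ⊥
      exits-apart {d} o x y r o<4 =
        proj₂ (proj₂ (exit-len x)) (suc o) (s≤s z≤n) (s≤s o<4)
          (trans r (sym (exit-unique x y (suc o , r))))

      period : ∀ {d} j → Exit (iter M j d) → iter M 5 d ≡ d
      period {d} j x with faces d
      ... | inj₁ (_ , q , _) = q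
      ... | inj₂ l = ⊥-elim (FaceLen-unique (exit-len x) (FaceLen-iter j l) ≤-refl)

      -- A face outside the tiles is passed in three steps: a hexagon has three
      -- tile sides, a pentagon two tile sides and one exit.
      three-steps : ∀ d → c d ≢ none → across (across (across d)) ≡ d ×
        exits d + (exits (across d) + exits (across (across d))) ≤ 1
      three-steps d s with pass d s | pass (across d) (across-spoke d s)
                         | pass (across (across d)) (across-spoke _ (across-spoke d s))
      ... | short x a _ | short y b _ | _ =
        ⊥-elim (exits-apart 0 x y (cong (φ M) (sym a)) (s≤s z≤n))
      ... | short x a _ | long _ b _ | short z _ _ =
        ⊥-elim (exits-apart 2 x z (cong (φ M) (sym (trans b (cong (λ e → φ M (φ M e)) a)))) (s≤s (s≤s (s≤s z≤n))))
      ... | long _ _ _ | short y b _ | short z _ _ =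
        ⊥-elim (exits-apart 0 y z (cong (φ M) (sym b)) (s≤s z≤n))
      ... | short x a ex | long _ b ey | long _ g ez =
        trans g (trans (cong (λ e → φ M (φ M e)) (trans b (cong (λ e → φ M (φ M e)) a))) (period 1 x)) ,
        subst (_≤ 1) (sym (cong₂ _+_ ex (cong₂ _+_ ey ez))) ≤-refl
      ... | long _ a ex | short y b ey | long _ g ez =
        trans g (trans (cong (λ e → φ M (φ M e)) (trans b (cong (φ M) a))) (period 3 (subst (λ e → Exit (φ M e)) a y))) ,
        subst (_≤ 1) (sym (cong₂ _+_ ex (cong₂ _+_ ey ez))) ≤-refl
      ... | long _ a ex | long _ b ey | short z g ez =
        trans g (trans (cong (φ M) ba) (period 5 (subst (λ e → Exit (φ M e)) ba z))) ,
        subst (_≤ 1) (sym (cong₂ _+_ ex (cong₂ _+_ ey ez))) ≤-refl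
        where
        ba : across (across d) ≡ iter M 4 d
        ba = trans b (cong (λ e → φ M (φ M e)) a)
      ... | long _ a ex | long _ b ey | long w g ez with faces d
      -- Three tile sides take six steps. On a pentagon the corner after five steps, of class
      -- `none`, would be the spoke `d` itself.
      ...   | inj₁ (_ , q , _) = ⊥-elim (s (trans (cong c (sym (trans (cong (φ M) ba) q))) w))
        where
        ba : across (across d) ≡ iter M 4 d
        ba = trans b (cong (λ e → φ M (φ M e)) a)
      ...   | inj₂ (_ , q , _) = trans g (trans (cong (λ e → φ M (φ M e)) (trans b (cong (λ e → φ M (φ M e)) a))) q) ,
        subst (_≤ 1) (sym (cong₂ _+_ ex (cong₂ _+_ ey ez))) z≤n

      tileSystem : ∀ {capH capA} →
        (∀ xs → Unique xs → All (λ x → c x ≡ hx) xs → length xs ≤ capH) →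
        (∀ xs → Unique xs → All (λ x → c x ≡ ax) xs → length xs ≤ capA) →
        TileSystem (Dart n) capH capA
      tileSystem bound-hx bound-ax = record
        { _≟_ = _≟ᵈ_ ; α = α ; ρ = ρ ; c = c
        ; α-invol = α-invol ; α-nofix = α-≢ ; α-spoke = spoke-α
        ; ρ-hx = ρ-hx ; ρ-ax = ρ-ax ; ρ-bx = ρ-bx
        ; orbit-hx = orbit-hx ; orbit-hx-min = orbit-hx-min
        ; orbit-ax = orbit-ax ; orbit-bx = orbit-bx ; orbit-ax-min = orbit-ax-min
        ; triangle = λ d s → proj₁ (three-steps d s)
        ; triangle-exits = λ d s → proj₂ (three-steps d s)
        ; bound-hx = bound-hx ; bound-ax = bound-ax
        }

      Primary : Dart n → Set
      Primary d = c d ≡ hx ⊎ c d ≡ ax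

      tile-not-bare : ∀ {d} i → OnT (proj₁ d , i) → ¬ Exit d
      tile-not-bare i t (bare , _) = bare (i , t)

      primary-turn : ∀ {d} → Primary d → ¬ Primary (turn d)
      primary-turn {d} (inj₁ a) (inj₁ b) = OnT-turn (hx-tile d a) (hx-tile (turn d) b)
      primary-turn {d} (inj₁ a) (inj₂ b) = tile-not-bare _ (hx-tile d a) (ax-exit (turn d) b)
      primary-turn {d} (inj₂ a) (inj₁ b) = tile-not-bare _ (hx-tile (turn d) b) (ax-exit d a)
      primary-turn {d} (inj₂ a) (inj₂ b) = Paired-turn (ax-exit d a) (ax-exit (turn d) b)

      -- This lets a vertex be represented by a spoke: a tile vertex has a single `hx` spoke, an
      -- uncovered vertex a single `ax` spoke.
      primary-inj : ∀ {d e} → Primary d → Primary e → proj₁ d ≡ proj₁ e → d ≡ e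
      primary-inj {d} {e} p q r with same-vertex d e r
      ... | inj₁ refl = refl
      ... | inj₂ (inj₁ refl) = ⊥-elim (primary-turn p q)
      ... | inj₂ (inj₂ refl) = ⊥-elim (primary-turn q (subst Primary (sym (turn³ d)) p))

      cubicTiles : ∀ {capH capA} →
        (∀ xs → Unique xs → All (λ x → c x ≡ hx) xs → length xs ≤ capH) →
        (∀ xs → Unique xs → All (λ x → c x ≡ ax) xs → length xs ≤ capA) →
        CubicTiles M m capH capA
      cubicTiles bound-hx bound-ax = record
        { system = tileSystem bound-hx bound-ax
        ; same-α = λ _ → refl
        ; ρ-pair = ρ-pair ; ρ-at-hx = ρ-at-hx ; ρ-at-ax = ρ-at-ax
        ; primary-inj = primary-inj
        }


-- Closed states describe the whole graph

module Leaf-sound {n m capH capA : ℕ} {M : CubicMap n} (T : CubicTiles M m capH capA)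
  (connected : Connected M) {k : ℕ} (L : Fin (suc k) → CubicMap n) (L-simple : ∀ g → Simple (L g)) where

  open CubicMap M using (α-invol) renaming (α to αᴹ)
  open CubicTiles T hiding (α; α-invol)
  open Engine m hiding (iterate; TileSystem)
  open Soundness system using (Named; Matched; Realized; ∈-hexNames⁺; module Search-sound)
  open Leaves m L

  Primary : Dart n → Set
  Primary d = c d ≡ hx ⊎ c d ≡ ax

  module _ {ns : List Name} {nt : ℕ} {ι : Name → Dart n} (N : Named ns nt ι) {r : List Row} (Mt : Matched N r) where
    open Named N
    open Matched Mt

    V : Name → Fin n
    V x = proj₁ (ι x)

    isPrim-primary : ∀ {x} → x ∈ ns → isPrim x ≡ true → Primary (ι x)
    isPrim-primary {hexn _ _} i e = inj₁ (ι-cls i)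
    isPrim-primary {quadn _ 0} i e = inj₂ (ι-cls i)
    isPrim-primary {quadn _ 2} i e = inj₂ (ι-cls i)
    isPrim-primary {quadn _ 1} i ()
    isPrim-primary {quadn _ (suc (suc (suc _)))} i ()

    IsNeighbour : Fin n → Name → Set
    IsNeighbour v w = w ∈ ns × isPrim w ≡ true × V w ≡ v

    prim-sound : ∀ {w} → w ∈ ns → IsNeighbour (V w) (prim w)
    prim-sound {hexn _ _} i = i , refl , refl
    prim-sound {quadn _ 0} i = i , refl , refl
    prim-sound {quadn _ 1} i = rho∈ i , refl , cong proj₁ (trans (ι-rho i) (ρ-pair _ (ι-cls i)))
    prim-sound {quadn _ 2} i = i , refl , refl
    prim-sound {quadn _ (suc (suc (suc _)))} i = rho∈ i , refl , cong proj₁ (trans (ι-rho i) (ρ-pair _ (ι-cls i)))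

    look-sound : ∀ {x w} d → x ∈ ns → ι x ≡ d → Maybe.map prim (look r x) ≡ just w → IsNeighbour (proj₁ (αᴹ d)) w
    look-sound {x} d i refl e with look r x in l
    look-sound {x} d i refl refl | just w =
      let w∈ , q = at i l ; a , b , e = prim-sound w∈ in a , b , trans e (cong proj₁ (trans (sym q) (same-α d)))

    ρ-primary : ∀ {d} → Primary d → ρ d ≡ turn (αᴹ (turn d))
    ρ-primary (inj₁ e) = ρ-at-hx _ e
    ρ-primary (inj₂ e) = ρ-at-ax _ e

    neighbour-sound : ∀ {x} i {w} → x ∈ ns → isPrim x ≡ true → neighbour r x i ≡ just w →
      IsNeighbour (proj₁ (αᴹ (turns i (ι x)))) w
    neighbour-sound zero x∈ e l = look-sound _ x∈ refl l
    neighbour-sound {x} (suc zero) x∈ e refl =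
      let a , b , q = prim-sound (rho∈ x∈) in
      a , b , trans q (cong proj₁ (trans (ι-rho x∈) (ρ-primary (isPrim-primary x∈ e))))
    neighbour-sound {hexn t k} (suc (suc zero)) x∈ e refl = rhi∈ x∈ , prim-rhi k , cong proj₁ (sym q)
      where
      prim-rhi : ∀ k → isPrim (rhi (hexn t k)) ≡ true
      prim-rhi zero = refl
      prim-rhi (suc k) = refl
      cls-rhi : ∀ k → clsn (rhi (hexn t k)) ≡ hx
      cls-rhi zero = refl
      cls-rhi (suc k) = refl
      x′ : Dart n
      x′ = ι (rhi (hexn t k))
      q : αᴹ (turn (turn (ι (hexn t k)))) ≡ turn x′
      q = trans (cong (λ d → αᴹ (turn (turn d)))
            (trans (cong ι (sym (rho-rhi∈ x∈))) (trans (ι-rho (rhi∈ x∈)) (ρ-at-hx x′ (trans (ι-cls (rhi∈ x∈)) (cls-rhi k))))))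
            (trans (cong αᴹ (turn³ _)) (α-invol _))
    neighbour-sound {quadn t k} (suc (suc zero)) x∈ e l = look-sound _ (rhi∈ x∈) q l
      where
      cls-rhi : ∀ k → isPrim (quadn t k) ≡ true → k < 4 → clsn (rhi (quadn t k)) ≡ bx
      cls-rhi 0 _ _ = refl
      cls-rhi 2 _ _ = refl
      q : ι (rhi (quadn t k)) ≡ turn (turn (ι (quadn t k)))
      q = sym (trans (cong (λ d → turn (turn d))
            (trans (cong ι (sym (rho-rhi∈ x∈))) (trans (ι-rho (rhi∈ x∈))
              (ρ-pair _ (trans (ι-cls (rhi∈ x∈)) (cls-rhi k e (ok x∈)))))))
            (turn³ _))

    neighbour-adj : ∀ {x} i {w} → x ∈ ns → isPrim x ≡ true → neighbour r x i ≡ just w → Adj M (V x) (V w)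
    neighbour-adj i x∈ e l with neighbour-sound i x∈ e l
    ... | _ , _ , q = proj₂ (turns i (ι _)) , trans (cong (λ v → proj₁ (αᴹ (v , proj₂ (turns i (ι _))))) (sym (turns-vertex i (ι _)))) (sym q)
      where
      turns-vertex : ∀ i d → proj₁ (turns i d) ≡ proj₁ d
      turns-vertex zero d = refl
      turns-vertex (suc zero) d = refl
      turns-vertex (suc (suc zero)) d = refl

    Closed : Set
    Closed = ∀ {x} → x ∈ ns → isJust (look r x) ≡ true

    neighbour-closed : Closed → ∀ {x} i → x ∈ ns → ∃ λ w → neighbour r x i ≡ just w
    neighbour-closed cl {x} zero x∈ with look r x | cl x∈
    ... | just w | _ = prim w , refl
    neighbour-closed cl (suc zero) x∈ = _ , refl
    neighbour-closed cl {hexn _ _} (suc (suc zero)) x∈ = _ , refl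
    neighbour-closed cl {x@(quadn _ _)} (suc (suc zero)) x∈ with look r (rhi x) | cl (rhi∈ x∈)
    ... | just w | _ = prim w , refl

    Placed : Fin n → Set
    Placed v = ∃ λ x → x ∈ ns × isPrim x ≡ true × V x ≡ v

    closed-step : Closed → ∀ {u v} → Placed u → Adj M u v → Placed v
    closed-step cl (x , x∈ , e , refl) (i , q) with turns-onto (ι x) i
    ... | j , p with neighbour-closed cl j x∈
    ...   | w , l with neighbour-sound j x∈ e l
    ...     | w∈ , pw , s = w , w∈ , pw , trans s (trans (cong (λ d → proj₁ (αᴹ d)) p) q)

    closed-walk : Closed → ∀ {u v} → PathAvoiding M (λ _ → ⊥) u v → Placed u → Placed v
    closed-walk cl here pl = pl
    closed-walk cl (step a _ w) pl = closed-walk cl w (closed-step cl pl a)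

    -- All neighbours of a named vertex are named when every spoke is matched, so by connectedness
    -- the named vertices are all vertices.
    closed-size : Closed → ∀ {x} → x ∈ ns → n ≤ length (filterᵇ isPrim ns)
    closed-size cl x∈ = subst₂ _≤_ (length-tabulate {n = n} (λ i → i)) (length-map V (filterᵇ isPrim ns))
      (Unique-⊆-length (Unique.allFin⁺ n) λ {v} _ → covers v)
      where
      covers : ∀ v → v ∈ map V (filterᵇ isPrim ns)
      covers v with prim-sound x∈
      ... | w∈ , pw , _ with closed-walk cl (connected _ v (λ ()) (λ ())) (_ , w∈ , pw , refl)
      ...   | y , y∈ , py , refl = ∈-map⁺ V (∈-filter⁺ (T? ∘ isPrim) y∈ (Equivalence.from T-≡ py))

    -- Distinct names are distinct spokes, and distinct spokes of class `hx` or `ax` sit at distinct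
    -- vertices; hence the placement is injective on vertices.
    fits-sound : ∀ {N′ F} → Simple N′ → fits ns r N′ F ≡ true → Iso M N′
    fits-sound {N′} {F} simple′ e with length F ≡ᵇ n in lenᵇ
    ... | true with distinctᵇ F in dis
    ...   | true = Iso-from-injective {M = M} {N = N′} simple′ (V ∘ F′) inj hom
      where
      F′ : Fin n → Name
      F′ u = nth (hexn 0 0) F (toℕ u)
      len : length F ≡ n
      len = ≡ᵇ-sound _ _ lenᵇ
      good : ∀ u → F′ u ∈ ns × isPrim (F′ u) ≡ true × (∀ i → Adj M (V (F′ u)) (V (F′ (nbr N′ u i))))
      good u with F′ u ∈ᵇ ns in mem | all-Fin-sound n _ e u
      ... | true | e₁ with isPrim (F′ u) in pr
      ...   | true = ∈ᵇ-sound _ _ mem , refl , λ i → edge i (all-Fin-sound 3 (λ i → joined r (F′ u) (F′ (nbr N′ u i))) e₁ i)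
        where
        is-sound : ∀ {mw w} → mw is w ≡ true → mw ≡ just w
        is-sound {just x} {w} q = cong just (==-sound x w q)
        edge : ∀ i → joined r (F′ u) (F′ (nbr N′ u i)) ≡ true → Adj M (V (F′ u)) (V (F′ (nbr N′ u i)))
        edge i e₂ with neighbour r (F′ u) zero is F′ (nbr N′ u i) in a
        ... | true = neighbour-adj zero (∈ᵇ-sound _ _ mem) pr (is-sound a)
        ... | false with neighbour r (F′ u) (suc zero) is F′ (nbr N′ u i) in b
        ...   | true = neighbour-adj (suc zero) (∈ᵇ-sound _ _ mem) pr (is-sound b)
        ...   | false = neighbour-adj (suc (suc zero)) (∈ᵇ-sound _ _ mem) pr (is-sound e₂)
      hom : ∀ u i → Adj M (V (F′ u)) (V (F′ (nbr N′ u i)))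
      hom u = proj₂ (proj₂ (good u))
      inj : ∀ {u v} → V (F′ u) ≡ V (F′ v) → u ≡ v
      inj {u} {v} q with good u | good v
      ... | u∈ , pu , _ | v∈ , pv , _ = Fin.toℕ-injective (nth-injective (hexn 0 0) (distinctᵇ-sound F dis) (toℕ u) (toℕ v)
        (subst (toℕ u <_) (sym len) (Fin.toℕ<n u)) (subst (toℕ v <_) (sym len) (Fin.toℕ<n v))
        (ι-inj u∈ v∈ (primary-inj (isPrim-primary u∈ pu) (isPrim-primary v∈ pv) q)))

  leaf-sound : ∀ s cs {cs′} → Realized s → leaf s cs ≡ just cs′ → ∃ λ g → Iso M (L g)
  leaf-sound (st _ (x ∷ ns) r) cs (ι , N , Mt) e with all-List (λ x → isJust (look r x)) (x ∷ ns) in cl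
  ... | true with length (filterᵇ isPrim (x ∷ ns)) <ᵇ n in small
  ...   | true = ⊥-elim (<⇒≱ (<ᵇ⇒< _ n (Equivalence.from T-≡ small)) (closed-size N Mt (all-List-sound _ _ cl) (here refl)))
  leaf-sound (st _ (x ∷ ns) r) (q ∷ cs) (ι , N , Mt) e | true | false
    with fits (x ∷ ns) r (L (clamp k (Cert.graph q))) (placement r q) in ft
  ... | true = clamp k (Cert.graph q) ,
    fits-sound N Mt {L (clamp k (Cert.graph q))} {placement r q} (L-simple (clamp k (Cert.graph q))) ft

  open Search-sound leaf (∃ λ g → Iso M (L g)) leaf-sound
  open Search leaf capH capA

  no-names : ∀ {ι} → Named [] 0 ι
  no-names = record
    { ok = λ () ; old-tile = λ () ; same-kind = λ () ; rho∈ = λ () ; rhi∈ = λ ()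
    ; ι-rho = λ () ; ι-cls = λ () ; distinct = [] }

  classify-from-quad : ∀ {d} → c d ≡ ax → Exhausted capH capA (addQuad (st 0 [] [])) (quadn 0 0) →
    ∃ λ g → Iso M (L g)
  classify-from-quad {d} e (exhausted {f} {cs} s)
    with Realized-quad {r = []} {ι = λ _ → d} no-names (record { size = refl ; at = λ () }) d e (λ ())
  ... | N , Mt = branch-sound f (addQuad (st 0 [] [])) cs N Mt (here refl) s

  classify-from-hex : ∀ {d} → c d ≡ hx → Exhausted capH capA (addHex (st 0 [] [])) (hexn 0 0) →
    ∃ λ g → Iso M (L g)
  classify-from-hex {d} e (exhausted {f} {cs} s)
    with Realized-hex {r = []} {ι = λ _ → d} no-names (record { size = refl ; at = λ () }) d e (λ ())
  ... | N , Mt = branch-sound f (addHex (st 0 [] [])) cs N Mt (∈-hexNames⁺ 0 (s≤s z≤n)) s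

-- Counting pentagons and exits

AllPairs-lookup : ∀ {A : Set} {R : A → A → Set} (xs : List A) →
  (∀ i j → i ≢ j → R (lookup xs i) (lookup xs j)) → AllPairs R xs
AllPairs-lookup {R = R} xs f = subst (AllPairs R) (tabulate-lookup xs) (AllPairs.tabulate⁺ (λ {i} {j} → f i j))

module FaceCount {n : ℕ} (M : CubicMap n) (simple : Simple M)
                 (faces : ∀ d → FaceLen M d 5 ⊎ FaceLen M d 6) where
  open SimpleFaces M simple faces public

  OtherFace : Dart n → Dart n → Set
  OtherFace d e = ¬ SameFace d e

  Pent : Dart n → Set
  Pent d = FaceLen M d 5

  pent? : ∀ d → Dec (Pent d)
  pent? d with faces d
  ... | inj₁ l = yes l
  ... | inj₂ l = no λ l′ → FaceLen-unique l′ l ≤-refl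

  Pent-φ⁻ : ∀ {d} → Pent (φ M d) → Pent d
  Pent-φ⁻ {d} l with faces d
  ... | inj₁ l′ = l′
  ... | inj₂ l′ = ⊥-elim (FaceLen-unique l (FaceLen-φ l′) ≤-refl)

  SameFace-Pent : ∀ {d e} → SameFace d e → Pent d → Pent e
  SameFace-Pent (j , refl) l = FaceLen-iter j l

  orbit : ℕ → Dart n → List (Dart n)
  orbit k d = applyUpTo (λ j → iter M j d) k

  ∈-orbit⁻ : ∀ k {d e} → e ∈ orbit k d → SameFace d e
  ∈-orbit⁻ k {d} i with ∈-applyUpTo⁻ (λ j → iter M j d) i
  ... | j , _ , refl = j , refl

  ∈-orbit⁺ : ∀ {k d e} → FaceLen M d k → SameFace d e → e ∈ orbit k d
  ∈-orbit⁺ {k} {d} (1≤k , p , _) (j , refl) with iter-reduce 1≤k p j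
  ... | j′ , j′<k , q = subst (_∈ orbit k d) (sym q) (∈-applyUpTo⁺ (λ j → iter M j d) j′<k)

  orbit-Unique : ∀ {k d} → FaceLen M d k → Unique (orbit k d)
  orbit-Unique {k} {d} l = Unique.applyUpTo⁺₁ _ k λ {i} {j} i<j j<k e → apart i j i<j j<k e
    where
    apart : ∀ i j → i < j → j < k → iter M i d ≢ iter M j d
    apart i j i<j j<k e with m≤n⇒∃[o]m+o≡n i<j
    ... | o , refl = iter-distinct l i o (subst (_< k) (cong suc (+-comm i o)) j<k)
                       (trans (cong (λ j → iter M (suc j) d) (+-comm o i)) (sym e))

  len : Dart n → ℕ
  len d with faces d
  ... | inj₁ _ = 5
  ... | inj₂ _ = 6

  len-FaceLen : ∀ d → FaceLen M d (len d)
  len-FaceLen d with faces d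
  ... | inj₁ l = l
  ... | inj₂ l = l

  Disjoint-concat : ∀ {A : Set} (f : Dart n → List A) {R : Dart n → Dart n → Set} {rs} →
    (∀ {d} → d ∈ rs → Unique (f d)) → AllPairs R rs →
    (∀ {d e} → d ∈ rs → e ∈ rs → R d e → ∀ {x} → x ∈ f d × x ∈ f e → ⊥) → Unique (concat (map f rs))
  Disjoint-concat f u rs dis = Unique.concat⁺ (All.map⁺ (All.tabulate u)) (AllPairs.map⁺ (go rs dis))
    where
    go : ∀ {R rs} → AllPairs R rs → (∀ {d e} → d ∈ rs → e ∈ rs → R d e → ∀ {x} → x ∈ f d × x ∈ f e → ⊥) →
      AllPairs (λ d e → ∀ {x} → x ∈ f d × x ∈ f e → ⊥) rs
    go [] dis = []
    go (a ∷ as) dis = All.tabulate (λ j {x} → dis (here refl) (there j) (All.lookup a j) {x})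
                    ∷ go as (λ i j → dis (there i) (there j))

  faceVerts : ℕ → Dart n → List (Fin n)
  faceVerts k d = map proj₁ (orbit k d)

  abstract
    allVerts : ℕ → List (Dart n) → List (Fin n)
    allVerts k rs = concat (map (faceVerts k) rs)

    ∈-faceVerts⁻ : ∀ k {d v} → v ∈ faceVerts k d → OnFace M d v
    ∈-faceVerts⁻ k i with ∈-map⁻ proj₁ i
    ... | e , j , refl with ∈-orbit⁻ k j
    ...   | o , refl = o , refl

    ∈-faceVerts⁺ : ∀ {k d v} → FaceLen M d k → OnFace M d v → v ∈ faceVerts k d
    ∈-faceVerts⁺ l (j , refl) = ∈-map⁺ proj₁ (∈-orbit⁺ l (j , refl))

    faceVerts-Unique : ∀ {k d} → FaceLen M d k → Unique (faceVerts k d)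
    faceVerts-Unique {k} {d} l = AllPairs.map⁺ (go (λ i → ∈-orbit⁻ k i) (orbit-Unique l))
      where
      go : ∀ {xs} → (∀ {x} → x ∈ xs → SameFace d x) → Unique xs → AllPairs (λ x y → proj₁ x ≢ proj₁ y) xs
      go s [] = []
      go s (a ∷ as) = All.tabulate (λ j e → All.lookup a j
          (sym (face-vertex-inj (SameFace-trans (sym-face (s (here refl))) (s (there j))) e)))
        ∷ go (λ i → s (there i)) as

    allVerts-Unique : ∀ {k rs} → All (λ d → FaceLen M d k) rs →
      AllPairs (λ d e → ∀ u → OnFace M d u → ¬ OnFace M e u) rs → Unique (allVerts k rs)
    allVerts-Unique {k} ls dis = Disjoint-concat (faceVerts k) (λ i → faceVerts-Unique (All.lookup ls i)) dis
      λ _ _ r (i , j) → r _ (∈-faceVerts⁻ k i) (∈-faceVerts⁻ k j)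

    allVerts-length : ∀ k rs → length (allVerts k rs) ≡ length rs * k
    allVerts-length k [] = refl
    allVerts-length k (d ∷ rs) = trans (length-++ (faceVerts k d))
      (cong₂ _+_ (trans (length-map proj₁ (orbit k d)) (length-applyUpTo _ k)) (allVerts-length k rs))

    ∈-allVerts⁻ : ∀ k rs {v} → v ∈ allVerts k rs → ∃ λ d → d ∈ rs × OnFace M d v
    ∈-allVerts⁻ k rs i with ∈-concat⁻′ (map (faceVerts k) rs) i
    ... | vs , j , q with ∈-map⁻ (faceVerts k) q
    ...   | d , d∈ , refl = d , d∈ , ∈-faceVerts⁻ k j

    ∈-allVerts⁺ : ∀ {k rs d v} → d ∈ rs → FaceLen M d k → OnFace M d v → v ∈ allVerts k rs
    ∈-allVerts⁺ {k} d∈ l o = ∈-concat⁺′ (∈-faceVerts⁺ l o) (∈-map⁺ (faceVerts k) d∈)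

  darts-Unique-length : ∀ {ds : List (Dart n)} → Unique ds → length ds ≤ n * 3
  darts-Unique-length {ds} u = subst (_≤ n * 3) (length-map code ds) (Unique-length≤ (Unique.map⁺ code-inj u))
    where
    code : Dart n → Fin (n * 3)
    code (v , i) = combine v i
    code-inj : ∀ {d e} → code d ≡ code e → d ≡ e
    code-inj {v , i} {w , j} q with Fin.combine-injective v i w j q
    ... | refl , refl = refl

  module _ (R : List (Dart n)) (reps : FaceReps M R) (euler : 2 * (n + length R) ≡ 4 + 3 * n) where

    pents : List (Dart n)
    pents = filter pent? R

    reps-apart : AllPairs OtherFace R
    reps-apart = AllPairs-lookup R λ i i′ i≢i′ (j , e) → i≢i′ (proj₂ reps i i′ j e)

    pents-apart : AllPairs OtherFace pents
    pents-apart = AllPairs.filter⁺ pent? reps-apart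

    pents-Pent : All Pent pents
    pents-Pent = All.all-filter pent? R

    all-darts-Unique : Unique (concat (map (λ d → orbit (len d) d) R))
    all-darts-Unique = Disjoint-concat (λ d → orbit (len d) d) (λ {d} _ → orbit-Unique (len-FaceLen d)) reps-apart
      λ {d} {e} _ _ other (i , j) → other (SameFace-trans (∈-orbit⁻ (len d) i) (sym-face (∈-orbit⁻ (len e) j)))

    -- A pentagon has five darts and is counted once more among the pentagons, so every face
    -- contributes six.
    weight : ∀ rs → length (concat (map (λ d → orbit (len d) d) rs)) + length (filter pent? rs) ≡ length rs * 6
    weight [] = refl
    weight (d ∷ rs) rewrite length-++ (orbit (len d) d) {concat (map (λ d → orbit (len d) d) rs)}
                          | length-applyUpTo (λ j → iter M j d) (len d) with faces d
    ... | inj₁ l = trans (cong (5 +_) (+-suc _ _)) (cong (6 +_) (weight rs))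
    ... | inj₂ l = cong (6 +_) (weight rs)

    -- By Euler's formula 6|R| = 3n + 12, while the orbits of the faces are disjoint sets among the
    -- 3n darts. The pentagons make up for the difference.
    twelve-pents : 12 ≤ length pents
    twelve-pents = +-cancelˡ-≤ (n * 3) 12 (length pents) (begin
      n * 3 + 12            ≡⟨ six-faces ⟨
      length R * 6          ≡⟨ weight R ⟨
      length (concat (map (λ d → orbit (len d) d) R)) + length pents
                            ≤⟨ +-monoˡ-≤ (length pents) (darts-Unique-length all-darts-Unique) ⟩
      n * 3 + length pents  ∎)
      where
      open ≤-Reasoning
      six-faces : length R * 6 ≡ n * 3 + 12
      six-faces = +-cancelˡ-≡ (n * 6) _ _ (trans
        (solve 2 (λ a b → a :* con 6 :+ b :* con 6 := con 3 :* (con 2 :* (a :+ b))) refl n (length R))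
        (trans (cong (3 *_) euler)
          (solve 1 (λ a → con 3 :* (con 4 :+ con 3 :* a) := a :* con 6 :+ (a :* con 3 :+ con 12)) refl n)))
        where open +-*-Solver

  -- Sextet patterns and their exits

  module Pattern (H : List (Dart n)) (sextet : SextetPattern M H) where

    hex-len : ∀ i → FaceLen M (lookup H i) 6
    hex-len = proj₁ sextet

    OnHex : Dart n → Set
    OnHex d = ∃ λ i → SameFace (lookup H i) d

    OnHex? : ∀ d → Dec (OnHex d)
    OnHex? d = Fin.any? λ i → map′ (λ (j , e) → toℕ j , e) (λ s → near i s)
        (Fin.any? {6} λ j → iter M (toℕ j) (lookup H i) ≟ᵈ d)
      where
      near : ∀ i → SameFace (lookup H i) d → ∃ λ (j : Fin 6) → iter M (toℕ j) (lookup H i) ≡ d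
      near i (j , e) with iter-reduce (s≤s z≤n) (proj₁ (proj₂ (hex-len i))) j
      ... | j′ , j′<6 , q = fromℕ< j′<6 ,
        trans (cong (λ k → iter M k (lookup H i)) (Fin.toℕ-fromℕ< j′<6)) (trans (sym q) e)

    OnHex-φ : ∀ {d} → OnHex d → OnHex (φ M d)
    OnHex-φ (i , j , e) = i , suc j , cong (φ M) e

    OnHex-φ⁻ : ∀ {d} → OnHex (φ M d) → OnHex d
    OnHex-φ⁻ (i , s) = i , SameFace-trans s (sym-face (1 , refl))

    OnHex-len : ∀ {d} → OnHex d → FaceLen M d 6
    OnHex-len (i , j , refl) = FaceLen-iter j (hex-len i)

    -- Two darts at one vertex cannot lie on the same hexagon, which passes the vertex once, nor on
    -- different ones, which are disjoint.
    OnHex-turn : ∀ {d} → OnHex d → ¬ OnHex (turn d)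
    OnHex-turn {d} (i , j , e) (i′ , j′ , e′) with i Fin.≟ i′
    ... | yes refl = face-turn (SameFace-trans (sym-face (j , e)) (j′ , e′))
    ... | no i≢i′ = proj₁ (proj₂ sextet) i i′ i≢i′ (proj₁ d) (j , cong proj₁ e) (j′ , cong proj₁ e′)

    covered : ∀ {v} → Covered M H v → ∃ λ k → OnHex (v , k)
    covered (i , j , refl) = _ , i , j , refl

    covers : ∀ {v} → (∃ λ k → OnHex (v , k)) → Covered M H v
    covers (k , i , j , e) = i , j , cong proj₁ e

    partner : Fin n → Fin n
    partner = proj₁ (proj₂ (proj₂ sextet))

    match : ∀ v → ¬ (∃ λ k → OnHex (v , k)) →
      Adj M v (partner v) × ¬ (∃ λ k → OnHex (partner v , k)) × partner (partner v) ≡ v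
    match v bare with proj₂ (proj₂ (proj₂ sextet)) v (λ cv → bare (covered cv))
    ... | a , b , e = a , (λ o → b (covers o)) , e

    open Tiling 5 OnHex OnHex? OnHex-φ OnHex-φ⁻ OnHex-turn OnHex-len partner match

    hex-verts : List (Fin n)
    hex-verts = allVerts 6 H

    hex-verts-Unique : Unique hex-verts
    hex-verts-Unique = allVerts-Unique (All.tabulate len6) (AllPairs-lookup H (proj₁ (proj₂ sextet)))
      where
      len6 : ∀ {d} → d ∈ H → FaceLen M d 6
      len6 i = subst (λ d → FaceLen M d 6) (sym (lookup-index i)) (hex-len (Any.index i))

    ∈-hex-verts⁺ : ∀ {v} → (∃ λ k → OnHex (v , k)) → v ∈ hex-verts
    ∈-hex-verts⁺ (k , i , j , e) = ∈-allVerts⁺ {rs = H} (∈-lookup i) (hex-len i) (j , cong proj₁ e)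

    ∈-hex-verts⁻ : ∀ {v} → v ∈ hex-verts → ∃ λ k → OnHex (v , k)
    ∈-hex-verts⁻ i with ∈-allVerts⁻ 6 H i
    ... | d , d∈ , j , refl = _ , Any.index d∈ , j , cong (iter M j) (sym (lookup-index d∈))

    exits-of : ∀ rs → All Pent rs → AllPairs OtherFace rs → ∃ λ es → length es ≡ length rs ×
      (∀ {e} → e ∈ es → Exit e × ∃ λ r → r ∈ rs × SameFace r e) × AllPairs OtherFace es
    exits-of [] [] [] = [] , refl , (λ ()) , []
    exits-of (r ∷ rs) (l ∷ ls) (a ∷ as) with exits-of rs ls as
                                           | pentagon-exit l (λ o → FaceLen-unique l (OnHex-len o) ≤-refl)
    ... | es , len≡ , ex , ap | j , x = iter M j r ∷ es , cong suc len≡ ,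
          (λ { (here refl) → x , r , here refl , j , refl
             ; (there i) → let y , r′ , r′∈ , s = ex i in y , r′ , there r′∈ , s }) ,
          (All.tabulate λ i same → let _ , r′ , r′∈ , s = ex i in
            All.lookup a r′∈ (SameFace-trans (j , refl) (SameFace-trans same (sym-face s)))) ∷ ap

    exit-at-vertex : ∀ {d e} → Exit d → Exit e → proj₁ d ≡ proj₁ e → d ≡ e
    exit-at-vertex {d} {e} x y r with same-vertex d e r
    ... | inj₁ refl = refl
    ... | inj₂ (inj₁ refl) = ⊥-elim (Paired-turn x y)
    ... | inj₂ (inj₂ refl) = ⊥-elim (Paired-turn y (subst Paired (cong turn (sym (turn³ d))) x))

    module Exits (R : List (Dart n)) (reps : FaceReps M R) (euler : 2 * (n + length R) ≡ 4 + 3 * n) where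

      abstract
        all-exits : ∃ λ es → length es ≡ length (pents R reps euler) ×
          (∀ {e} → e ∈ es → Exit e × ∃ λ r → r ∈ pents R reps euler × SameFace r e) × AllPairs OtherFace es
        all-exits = exits-of (pents R reps euler) (pents-Pent R reps euler) (pents-apart R reps euler)

      es : List (Dart n)
      es = proj₁ all-exits

      es-Exit : ∀ {e} → e ∈ es → Exit e
      es-Exit i = proj₁ (proj₁ (proj₂ (proj₂ all-exits)) i)

      es-Pent : ∀ {e} → e ∈ es → Pent e
      es-Pent i with proj₂ (proj₁ (proj₂ (proj₂ all-exits)) i)
      ... | r , r∈ , s = SameFace-Pent s (All.lookup (pents-Pent R reps euler) r∈)

      es-apart : AllPairs OtherFace es
      es-apart = proj₂ (proj₂ (proj₂ all-exits))

      es-length : 12 ≤ length es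
      es-length = subst (12 ≤_) (sym (proj₁ (proj₂ all-exits))) (twelve-pents R reps euler)

      exit-verts : List (Fin n)
      exit-verts = map proj₁ es

      verts : List (Fin n)
      verts = hex-verts ++ exit-verts

      -- Exits lie at uncovered vertices, and a vertex has at most one exit, so exits on different
      -- faces lie at different vertices.
      verts-Unique : Unique verts
      verts-Unique = Unique.++⁺ hex-verts-Unique (AllPairs.map⁺ (go es-Exit es-apart)) λ {v} (i , j) → apart i j
        where
        go : ∀ {xs} → (∀ {x} → x ∈ xs → Exit x) → AllPairs OtherFace xs → AllPairs (λ x y → proj₁ x ≢ proj₁ y) xs
        go ex [] = []
        go ex (a ∷ as) = All.tabulate (λ j e → All.lookup a j
            (0 , exit-at-vertex (ex (here refl)) (ex (there j)) e)) ∷ go (λ i → ex (there i)) as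
        apart : ∀ {v} → v ∈ hex-verts → v ∈ exit-verts → ⊥
        apart i j with ∈-map⁻ proj₁ j
        ... | e , e∈ , refl = proj₁ (es-Exit e∈) (∈-hex-verts⁻ i)

      verts-length : length verts ≡ length H * 6 + length es
      verts-length = trans (length-++ hex-verts) (cong₂ _+_ (allVerts-length 6 H) (length-map proj₁ es))

      size-bound : length H * 6 + 12 ≤ n
      size-bound = ≤-trans (+-monoʳ-≤ (length H * 6) es-length)
        (subst (_≤ n) verts-length (Unique-length≤ verts-Unique))

      module Extremal (extremal : n ≤ length H * 6 + 12) where

        full : ∀ v → v ∈ verts
        full = Unique-full verts-Unique (≤-trans extremal
          (≤-trans (+-monoʳ-≤ (length H * 6) es-length) (≤-reflexive (sym verts-length))))

        -- By `full` the vertex of the exit is covered by a hexagon, which is impossible, or is that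
        -- of a chosen exit, which must then be the same one. So all exits inherit the properties of
        -- the chosen ones.
        Exit-∈ : ∀ {d} → Exit d → d ∈ es
        Exit-∈ {d} x = located (∈-++⁻ hex-verts (full (proj₁ d)))
          where
          at-exit : (∃ λ e → e ∈ es × proj₁ d ≡ proj₁ e) → d ∈ es
          at-exit (e , e∈ , q) = subst (_∈ es) (sym (exit-at-vertex {d} {e} x (es-Exit e∈) q)) e∈
          located : proj₁ d ∈ hex-verts ⊎ proj₁ d ∈ exit-verts → d ∈ es
          located (inj₁ i) = ⊥-elim (proj₁ x (∈-hex-verts⁻ i))
          located (inj₂ i) = at-exit (∈-map⁻ proj₁ i)

        Exit-unique : ∀ {d e} → Exit d → Exit e → SameFace d e → d ≡ e
        Exit-unique x y s = go es-apart (Exit-∈ x) (Exit-∈ y) s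
          where
          go : ∀ {xs} → AllPairs OtherFace xs → ∀ {d e} → d ∈ xs → e ∈ xs → SameFace d e → d ≡ e
          go (a ∷ as) (here refl) (here refl) s = refl
          go (a ∷ as) (here refl) (there j) s = ⊥-elim (All.lookup a j s)
          go (a ∷ as) (there i) (here refl) s = ⊥-elim (All.lookup a i (sym-face s))
          go (a ∷ as) (there i) (there j) s = go as i j s

        open Triangles (λ x → es-Pent (Exit-∈ x)) Exit-unique public

        es-bound : length es ≤ 12
        es-bound = +-cancelˡ-≤ (length H * 6) _ 12
          (≤-trans (subst (_≤ n) verts-length (Unique-length≤ verts-Unique)) extremal)

        primaries-bound : ∀ {κ} {ys : List (Fin n)} (xs : List (Dart n)) → (∀ {d} → c d ≡ κ → Primary d) →
          (∀ {d} → c d ≡ κ → proj₁ d ∈ ys) → Unique xs → All (λ d → c d ≡ κ) xs → length xs ≤ length ys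
        primaries-bound xs pr sub u a = subst (_≤ _) (length-map proj₁ xs)
          (Unique-⊆-length (AllPairs.map⁺ (go u a)) λ i → let d , d∈ , q = ∈-map⁻ proj₁ i in
            subst (_∈ _) (sym q) (sub (All.lookup a d∈)))
          where
          go : ∀ {xs} → Unique xs → All (λ d → c d ≡ _) xs → AllPairs (λ x y → proj₁ x ≢ proj₁ y) xs
          go [] [] = []
          go (u ∷ us) (a ∷ as) = All.tabulate (λ i q → All.lookup u i
            (primary-inj (pr a) (pr (All.lookup as i)) q)) ∷ go us as

        bound-hx : ∀ xs → Unique xs → All (λ d → c d ≡ hx) xs → length xs ≤ length H * 6
        bound-hx xs u a = subst (length xs ≤_) (allVerts-length 6 H)
          (primaries-bound xs inj₁ (λ e → ∈-hex-verts⁺ (_ , hx-tile _ e)) u a)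

        bound-ax : ∀ xs → Unique xs → All (λ d → c d ≡ ax) xs → length xs ≤ 12
        bound-ax xs u a = ≤-trans (primaries-bound {ys = exit-verts} xs inj₂ (λ e → ∈-map⁺ proj₁ (Exit-∈ (ax-exit _ e))) u a)
            (subst (_≤ 12) (sym (length-map proj₁ es)) es-bound)

        module Classification (H≡8 : length H ≡ 8) (connected : Connected M)
                              {k : ℕ} (L : Fin (suc k) → CubicMap n) (L-simple : ∀ g → Simple (L g)) where

          -- Supplies the root of the search: an exit is a spoke of class `ax`, so its matching edge
          -- can be tile 0.
          some-exit : ∃ Exit
          some-exit = let e , e∈ = member (≤-trans (s≤s z≤n) es-length) in e , es-Exit e∈
            where
            member : ∀ {xs : List (Dart n)} → 0 < length xs → ∃ λ x → x ∈ xs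
            member {x ∷ _} _ = x , here refl

          classify : Leaves.Exhausted 5 L 48 12 (Engine.addQuad 5 (st 0 [] [])) (quadn 0 0) → ∃ λ g → Iso M (L g)
          classify = from-exit (proj₁ some-exit) (proj₂ some-exit)
            where
            bound : ∀ xs → Unique xs → All (λ d → c d ≡ hx) xs → length xs ≤ 48
            bound xs u a = subst (λ h → length xs ≤ h * 6) H≡8 (bound-hx xs u a)
            from-exit : ∀ d → Exit d → Leaves.Exhausted 5 L 48 12 (Engine.addQuad 5 (st 0 [] [])) (quadn 0 0) →
              ∃ λ g → Iso M (L g)
            from-exit d x = Leaf-sound.classify-from-quad (cubicTiles bound bound-ax) connected L L-simple {d} (c-of {d} (exit x))

  -- Isolated pentagons as tiles

  module Isolated (isolated : IsolatedPentagons M)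
                  (R : List (Dart n)) (reps : FaceReps M R) (euler : 2 * (n + length R) ≡ 4 + 3 * n) (n≤60 : n ≤ 60) where

    -- The faces of `d` and of `turn d`, which is `φ (α d)`, lie on the two sides of the edge of
    -- `d`.
    Pent-turn : ∀ {d} → Pent d → ¬ Pent (turn d)
    Pent-turn {d} l l′ = isolated d l (Pent-φ⁻ {CubicMap.α M d} (subst Pent (sym (φ-α d)) l′))

    pent-verts : List (Fin n)
    pent-verts = allVerts 5 (pents R reps euler)

    Pent-vertex : ∀ {d e} → Pent d → Pent e → proj₁ d ≡ proj₁ e → d ≡ e
    Pent-vertex {d} {e} x y r with same-vertex d e r
    ... | inj₁ refl = refl
    ... | inj₂ (inj₁ refl) = ⊥-elim (Pent-turn {d} x y)
    ... | inj₂ (inj₂ refl) = ⊥-elim (Pent-turn {e} y (subst Pent (sym (turn³ d)) x))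

    pent-verts-Unique : Unique pent-verts
    pent-verts-Unique = allVerts-Unique (pents-Pent R reps euler) (go (pents-Pent R reps euler) (pents-apart R reps euler))
      where
      go : ∀ {rs} → All Pent rs → AllPairs OtherFace rs → AllPairs (λ d e → ∀ u → OnFace M d u → ¬ OnFace M e u) rs
      go [] [] = []
      go (l ∷ ls) (a ∷ as) = All.tabulate (λ i u (j , p) (j′ , p′) → All.lookup a i
        (SameFace-trans (j , Pent-vertex (FaceLen-iter j l) (FaceLen-iter j′ (All.lookup ls i)) (trans p (sym p′)))
          (sym-face (j′ , refl)))) ∷ go ls as

    every-vertex : ∀ v → ∃ λ i → Pent (v , i)
    every-vertex v = on-pent (∈-allVerts⁻ 5 (pents R reps euler) (Unique-full pent-verts-Unique enough v))
      where
      enough : n ≤ length pent-verts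
      enough = ≤-trans n≤60 (≤-trans (*-monoˡ-≤ 5 (twelve-pents R reps euler))
        (≤-reflexive (sym (allVerts-length 5 (pents R reps euler)))))
      on-pent : (∃ λ d → d ∈ pents R reps euler × OnFace M d v) → ∃ λ i → Pent (v , i)
      on-pent (d , d∈ , j , e) = proj₂ (iter M j d) ,
        subst (λ w → Pent (w , proj₂ (iter M j d))) e (FaceLen-iter j (All.lookup (pents-Pent R reps euler) d∈))

    -- Every vertex lies on a tile, so the condition on the partner function is vacuous and the
    -- identity serves; 4 is one less than the length of a pentagon.
    open Tiling 4 Pent pent? FaceLen-φ Pent-φ⁻ Pent-turn (λ l → l) (λ v → v) (λ v bare → ⊥-elim (bare (every-vertex v)))

    no-exit : ∀ {d} → ¬ Exit d
    no-exit (bare , _) = bare (every-vertex _)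

    open Triangles (λ x → ⊥-elim (no-exit x)) (λ x → ⊥-elim (no-exit x))

    bound-hx : ∀ xs → Unique xs → All (λ d → c d ≡ hx) xs → length xs ≤ 60
    bound-hx xs u a = ≤-trans (subst (_≤ n) (length-map proj₁ xs) (Unique-length≤ (AllPairs.map⁺ (go u a)))) n≤60
      where
      go : ∀ {xs} → Unique xs → All (λ d → c d ≡ hx) xs → AllPairs (λ x y → proj₁ x ≢ proj₁ y) xs
      go [] [] = []
      go (u ∷ us) (a ∷ as) = All.tabulate (λ i q → All.lookup u i
        (primary-inj (inj₁ a) (inj₁ (All.lookup as i)) q)) ∷ go us as

    bound-ax : ∀ xs → Unique xs → All (λ d → c d ≡ ax) xs → length xs ≤ 0
    bound-ax [] u a = z≤n
    bound-ax (d ∷ _) u (a ∷ _) = ⊥-elim (no-exit (ax-exit d a))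

    module Classification (v₀ : Fin n) (connected : Connected M)
                          {k : ℕ} (L : Fin (suc k) → CubicMap n) (L-simple : ∀ g → Simple (L g)) where
      classify : Leaves.Exhausted 4 L 60 0 (Engine.addHex 4 (st 0 [] [])) (hexn 0 0) → ∃ λ g → Iso M (L g)
      classify = from-pent (v₀ , proj₁ (every-vertex v₀)) (proj₂ (every-vertex v₀))
        where
        from-pent : ∀ d → Pent d → Leaves.Exhausted 4 L 60 0 (Engine.addHex 4 (st 0 [] [])) (hexn 0 0) →
          ∃ λ g → Iso M (L g)
        from-pent d l = Leaf-sound.classify-from-hex (cubicTiles bound-hx bound-ax) connected L L-simple {turn d}
          (c-of {turn d} (prev-tile (subst Pent (sym (turn³ d)) l)))

-- Decision procedures for a given cubic map

∧-true : ∀ a {b} → a ∧ b ≡ true → a ≡ true × b ≡ true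
∧-true true e = refl , e

not-true : ∀ {a} → not a ≡ true → a ≢ true
not-true {false} _ ()

_≡ᶠ_ : ∀ {n} → Fin n → Fin n → Bool
i ≡ᶠ j = toℕ i ≡ᵇ toℕ j

≡ᶠ-sound : ∀ {n} {i j : Fin n} → (i ≡ᶠ j) ≡ true → i ≡ j
≡ᶠ-sound e = Fin.toℕ-injective (≡ᵇ-sound _ _ e)

≡ᶠ-refl : ∀ {n} (i : Fin n) → (i ≡ᶠ i) ≡ true
≡ᶠ-refl i = ≡ᵇ-refl (toℕ i)

_≡ᵈ_ : ∀ {n} → Dart n → Dart n → Bool
(v , i) ≡ᵈ (w , j) = (v ≡ᶠ w) ∧ (i ≡ᶠ j)

≡ᵈ-sound : ∀ {n} {d e : Dart n} → (d ≡ᵈ e) ≡ true → d ≡ e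
≡ᵈ-sound {d = v , i} {w , j} e with ∧-true (v ≡ᶠ w) e
... | p , q = cong₂ _,_ (≡ᶠ-sound p) (≡ᶠ-sound q)

≡ᵈ-refl : ∀ {n} (d : Dart n) → (d ≡ᵈ d) ≡ true
≡ᵈ-refl (v , i) rewrite ≡ᶠ-refl v = ≡ᶠ-refl i

all-Darts : ∀ n → (Dart n → Bool) → Bool
all-Darts n p = all-Fin n λ v → all-Fin 3 λ i → p (v , i)

all-Darts-sound : ∀ {n} p → all-Darts n p ≡ true → ∀ d → p d ≡ true
all-Darts-sound {n} p e (v , i) =
  all-Fin-sound 3 (λ i → p (v , i)) (all-Fin-sound n (λ v → all-Fin 3 λ i → p (v , i)) e v) i

_∈ᶠ_ : ∀ {n} → Fin n → List (Fin n) → Bool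
v ∈ᶠ [] = false
v ∈ᶠ (w ∷ ws) = if v ≡ᶠ w then true else v ∈ᶠ ws

∈ᶠ-sound : ∀ {n} {v : Fin n} ws → v ∈ᶠ ws ≡ true → v ∈ ws
∈ᶠ-sound {v = v} (w ∷ ws) e with v ≡ᶠ w in q
... | true = here (≡ᶠ-sound q)
... | false = there (∈ᶠ-sound ws e)

∈ᶠ-complete : ∀ {n} {v : Fin n} {ws} → v ∈ ws → v ∈ᶠ ws ≡ true
∈ᶠ-complete {v = v} (here refl) rewrite ≡ᶠ-refl v = refl
∈ᶠ-complete {v = v} {w ∷ ws} (there i) with v ≡ᶠ w
... | true = refl
... | false = ∈ᶠ-complete i

PathAvoiding-++ : ∀ {n} {M : CubicMap n} {S u v w} → PathAvoiding M S u v → PathAvoiding M S v w → PathAvoiding M S u w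
PathAvoiding-++ here q = q
PathAvoiding-++ (step a s p) q = step a s (PathAvoiding-++ p q)

Adj-sym : ∀ {n} (M : CubicMap n) {u v} → Adj M u v → Adj M v u
Adj-sym M {u} (i , refl) = proj₂ (CubicMap.α M (u , i)) , cong proj₁ (CubicMap.α-invol M (u , i))

PathAvoiding-sym : ∀ {n} (M : CubicMap n) {S u v} → ¬ S u → PathAvoiding M S u v → PathAvoiding M S v u
PathAvoiding-sym M s here = here
PathAvoiding-sym M s (step a s′ p) = PathAvoiding-++ (PathAvoiding-sym M s′ p) (step (Adj-sym M a) s here)

module Check {n : ℕ} (M : CubicMap n) where
  open CubicMap M
  open Faces M

  apartᵇ : Fin n → Fin n → Fin n → Fin n → Bool
  apartᵇ v a b c = not (a ≡ᶠ v) ∧ not (b ≡ᶠ v) ∧ not (c ≡ᶠ v) ∧ not (a ≡ᶠ b) ∧ not (a ≡ᶠ c) ∧ not (b ≡ᶠ c)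

  simple-atᵇ : Fin n → Bool
  simple-atᵇ v = apartᵇ v (nbr M v zero) (nbr M v (suc zero)) (nbr M v (suc (suc zero)))

  simpleᵇ : Bool
  simpleᵇ = all-Fin n simple-atᵇ

  apart-sound : ∀ v a b c → apartᵇ v a b c ≡ true → (a ≢ v × b ≢ v × c ≢ v) × (a ≢ b × a ≢ c × b ≢ c)
  apart-sound v a b c e with ∧-true (not (a ≡ᶠ v)) e
  ... | p₀ , e₁ with ∧-true (not (b ≡ᶠ v)) e₁
  ... | p₁ , e₂ with ∧-true (not (c ≡ᶠ v)) e₂
  ... | p₂ , e₃ with ∧-true (not (a ≡ᶠ b)) e₃
  ... | q₀ , e₄ with ∧-true (not (a ≡ᶠ c)) e₄
  ... | q₁ , q₂ = (apart p₀ , apart p₁ , apart p₂) , (apart q₀ , apart q₁ , apart q₂)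
    where
    apart : ∀ {a b : Fin n} → not (a ≡ᶠ b) ≡ true → a ≢ b
    apart {a} e refl = not-true e (≡ᶠ-refl a)

  simple-sound : simpleᵇ ≡ true → Simple M
  simple-sound e = loops , multi
    where
    at : ∀ v → _
    at v = apart-sound v (nbr M v zero) (nbr M v (suc zero)) (nbr M v (suc (suc zero)))
      (all-Fin-sound n simple-atᵇ e v)
    loops : ∀ v i → nbr M v i ≢ v
    loops v zero = proj₁ (proj₁ (at v))
    loops v (suc zero) = proj₁ (proj₂ (proj₁ (at v)))
    loops v (suc (suc zero)) = proj₂ (proj₂ (proj₁ (at v)))
    multi : ∀ v i j → i ≢ j → nbr M v i ≢ nbr M v j
    multi v zero zero i≢i = ⊥-elim (i≢i refl)
    multi v zero (suc zero) _ = proj₁ (proj₂ (at v))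
    multi v zero (suc (suc zero)) _ = proj₁ (proj₂ (proj₂ (at v)))
    multi v (suc zero) zero _ = ≢-sym (proj₁ (proj₂ (at v)))
    multi v (suc zero) (suc zero) i≢i = ⊥-elim (i≢i refl)
    multi v (suc zero) (suc (suc zero)) _ = proj₂ (proj₂ (proj₂ (at v)))
    multi v (suc (suc zero)) zero _ = ≢-sym (proj₁ (proj₂ (proj₂ (at v))))
    multi v (suc (suc zero)) (suc zero) _ = ≢-sym (proj₂ (proj₂ (proj₂ (at v))))
    multi v (suc (suc zero)) (suc (suc zero)) i≢i = ⊥-elim (i≢i refl)

  -- Meant for e = φ d, so that the face of d has length k + 1.
  lenᵇ : ℕ → Dart n → Dart n → Bool
  lenᵇ zero d e = e ≡ᵈ d
  lenᵇ (suc k) d e = not (e ≡ᵈ d) ∧ lenᵇ k d (φ M e)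

  lenᵇ-sound : ∀ k d → lenᵇ k d (φ M d) ≡ true → FaceLen M d (suc k)
  lenᵇ-sound k d e = s≤s z≤n , trans (cong (λ j → iter M j d) (+-comm 1 k)) (proj₁ (go 1 k e)) , λ j 1≤j j<k → proj₂ (go 1 k e) j 1≤j (subst (j <_) (sym (+-comm k 1)) j<k)
    where
    go : ∀ a k → lenᵇ k d (iter M a d) ≡ true →
      iter M (k + a) d ≡ d × (∀ j → a ≤ j → j < k + a → iter M j d ≢ d)
    go a zero e = ≡ᵈ-sound e , λ j a≤j j<a _ → <⇒≱ j<a a≤j
    go a (suc k) e with ∧-true (not (iter M a d ≡ᵈ d)) e
    ... | p , q with go (suc a) k q
    ...   | r , s = trans (cong (λ j → iter M j d) (sym (+-suc k a))) r , λ j a≤j j< q′ → case j a≤j j< q′ (m≤n⇒m<n∨m≡n a≤j)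
      where
      case : ∀ j → a ≤ j → j < suc k + a → iter M j d ≡ d → a < j ⊎ a ≡ j → ⊥
      case j a≤j j< q′ (inj₁ a<j) = s j a<j (subst (j <_) (sym (+-suc k a)) j<) q′
      case j a≤j j< q′ (inj₂ refl) = not-true p (trans (cong (_≡ᵈ d) q′) (≡ᵈ-refl d))

  reachᵇ : ℕ → Dart n → Dart n → Bool
  reachᵇ zero e d = false
  reachᵇ (suc k) e d = if e ≡ᵈ d then true else reachᵇ k (φ M e) d

  reachᵇ-sound : ∀ k e d → reachᵇ k e d ≡ true → SameFace e d
  reachᵇ-sound (suc k) e d q with e ≡ᵈ d in r
  ... | true = 0 , ≡ᵈ-sound r
  ... | false = SameFace-trans (1 , refl) (reachᵇ-sound k (φ M e) d q)

  dartCode : Dart n → ℕ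
  dartCode (v , i) = 3 * toℕ v + toℕ i

  faceOf : ℕ → Dart n → Dart n → List ℕ
  faceOf zero d e = []
  faceOf (suc k) d e = if e ≡ᵈ d then [] else dartCode e ∷ faceOf k d (φ M e)

  _∈ℕ_ : ℕ → List ℕ → Bool
  c ∈ℕ [] = false
  c ∈ℕ (x ∷ xs) = if c ≡ᵇ x then true else c ∈ℕ xs

  -- The position of the first face containing the code, or the number of faces if there is none.
  owner : List (List ℕ) → ℕ → ℕ
  owner [] c = 0
  owner (f ∷ fs) c = if c ∈ℕ f then 0 else suc (owner fs c)

  -- Opens a new face for each dart not on an earlier one. The result is certified afterwards by
  -- `repsᵇ`.
  collect : List (Dart n) → List (Dart n) → List (List ℕ) → List (Dart n) × List (List ℕ)
  collect [] rs fs = rs , fs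
  collect (d ∷ ds) rs fs = if owner fs (dartCode d) <ᵇ length fs then collect ds rs fs
    else collect ds (rs ++ d ∷ []) (fs ++ (dartCode d ∷ faceOf 6 d (φ M d)) ∷ [])

  module Reps (v₀ : Fin n) (Rfs : List (Dart n) × List (List ℕ)) where

    R : List (Dart n)
    R = proj₁ Rfs

    face# : Dart n → ℕ
    face# d = owner (proj₂ Rfs) (dartCode d)

    indexedᵇ : ℕ → List (Dart n) → Bool
    indexedᵇ k [] = true
    indexedᵇ k (r ∷ rs) = (face# r ≡ᵇ k) ∧ indexedᵇ (suc k) rs

    indexed-sound : ∀ k rs → indexedᵇ k rs ≡ true → ∀ i → face# (lookup rs i) ≡ k + toℕ i
    indexed-sound k (r ∷ rs) e zero = trans (≡ᵇ-sound _ k (proj₁ (∧-true (face# r ≡ᵇ k) e))) (sym (+-identityʳ k))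
    indexed-sound k (r ∷ rs) e (suc i) =
      trans (indexed-sound (suc k) rs (proj₂ (∧-true (face# r ≡ᵇ k) e)) i) (sym (+-suc k (toℕ i)))

    lensᵇ : List (Dart n) → Bool
    lensᵇ [] = true
    lensᵇ (r ∷ rs) = (lenᵇ 4 r (φ M r) ∨ lenᵇ 5 r (φ M r)) ∧ lensᵇ rs

    lens-sound : ∀ rs → lensᵇ rs ≡ true → ∀ {r} → r ∈ rs → FaceLen M r 5 ⊎ FaceLen M r 6
    lens-sound (r ∷ rs) e i with ∧-true (lenᵇ 4 r (φ M r) ∨ lenᵇ 5 r (φ M r)) e
    lens-sound (r ∷ rs) e (there i) | _ , q = lens-sound rs q i
    lens-sound (r ∷ rs) e (here refl) | p , _ with lenᵇ 4 r (φ M r) in l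
    ... | true = inj₁ (lenᵇ-sound 4 r l)
    ... | false = inj₂ (lenᵇ-sound 5 r p)

    -- Invariance under `φ` makes the face number constant on faces, which with `indexedᵇ` separates
    -- the representatives; `reachᵇ` shows that they meet every face.
    dartᵇ : Dart n → ℕ → Bool
    dartᵇ d f = (face# (φ M d) ≡ᵇ f) ∧ (f <ᵇ length R) ∧ reachᵇ 6 (nth (v₀ , zero) R f) d

    repsᵇ : Bool
    repsᵇ = indexedᵇ 0 R ∧ lensᵇ R ∧ all-Darts n (λ d → dartᵇ d (face# d))

    module Sound (ok : repsᵇ ≡ true) where

      indexed : ∀ i → face# (lookup R i) ≡ toℕ i
      indexed = indexed-sound 0 R (proj₁ (∧-true (indexedᵇ 0 R) ok))

      darts : ∀ d → dartᵇ d (face# d) ≡ true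
      darts = all-Darts-sound (λ d → dartᵇ d (face# d)) (proj₂ (∧-true (lensᵇ R) (proj₂ (∧-true (indexedᵇ 0 R) ok))))

      face#-φ : ∀ d → face# (φ M d) ≡ face# d
      face#-φ d = ≡ᵇ-sound _ _ (proj₁ (∧-true (face# (φ M d) ≡ᵇ face# d) (darts d)))

      face#-iter : ∀ j d → face# (iter M j d) ≡ face# d
      face#-iter zero d = refl
      face#-iter (suc j) d = trans (face#-φ _) (face#-iter j d)

      covering : ∀ d → ∃ λ r → r ∈ R × SameFace r d
      covering d with ∧-true (face# d <ᵇ length R) (proj₂ (∧-true (face# (φ M d) ≡ᵇ face# d) (darts d)))
      ... | p , q = _ , nth-∈ (v₀ , zero) R (<ᵇ⇒< _ _ (Equivalence.from T-≡ p)) , reachᵇ-sound 6 (nth (v₀ , zero) R (face# d)) d q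

      faceReps : FaceReps M R
      faceReps = cover , λ i i′ j e → Fin.toℕ-injective
          (trans (sym (indexed i)) (trans (sym (face#-iter j _)) (trans (cong face# e) (indexed i′))))
        where
        cover : ∀ d → ∃ λ i → ∃ λ j → iter M j (lookup R i) ≡ d
        cover d with covering d
        ... | r , r∈ , j , e = Any.index r∈ , j , trans (cong (iter M j) (sym (lookup-index r∈))) e

      faces : ∀ d → FaceLen M d 5 ⊎ FaceLen M d 6
      faces d with covering d
      ... | r , r∈ , j , refl with lens-sound R (proj₁ (∧-true (lensᵇ R) (proj₂ (∧-true (indexedᵇ 0 R) ok)))) r∈
      ...   | inj₁ l = inj₁ (FaceLen-iter j l)
      ...   | inj₂ l = inj₂ (FaceLen-iter j l)

  descendsᵇ : Fin n → Bool
  descendsᵇ v = (toℕ v ≡ᵇ 0) ∨ (toℕ (nbr M v zero) <ᵇ toℕ v)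

  -- Dart 0 leads to a vertex with a smaller number, so following it ends at vertex 0, to which all
  -- vertices are thus connected.
  descends-sound : all-Fin n descendsᵇ ≡ true → Connected M
  descends-sound e u v _ _ with to-root u (<-wellFounded (toℕ u)) | to-root v (<-wellFounded (toℕ v))
    where
    to-root : ∀ v → Acc _<_ (toℕ v) → ∃ λ r → toℕ r ≡ 0 × PathAvoiding M (λ _ → ⊥) v r
    to-root v (acc rec) with toℕ v ≡ᵇ 0 in z | all-Fin-sound n descendsᵇ e v
    ... | true | _ = v , ≡ᵇ-sound _ 0 z , here
    ... | false | q with to-root (nbr M v zero) (rec (<ᵇ⇒< _ _ (Equivalence.from T-≡ q)))
    ...   | r , r≡0 , p = r , r≡0 , step (zero , refl) (λ ()) p
  ... | r , r≡0 , p | r′ , r′≡0 , p′ with Fin.toℕ-injective (trans r≡0 (sym r′≡0))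
  ...   | refl = PathAvoiding-++ p (PathAvoiding-sym M (λ ()) p′)

  adjᵇ : Fin n → Fin n → Bool
  adjᵇ u v = (nbr M u zero ≡ᶠ v) ∨ (nbr M u (suc zero) ≡ᶠ v) ∨ (nbr M u (suc (suc zero)) ≡ᶠ v)

  adj-sound : ∀ u v → adjᵇ u v ≡ true → Adj M u v
  adj-sound u v e with nbr M u zero ≡ᶠ v in p | nbr M u (suc zero) ≡ᶠ v in q
  ... | true | _ = zero , ≡ᶠ-sound p
  ... | false | true = suc zero , ≡ᶠ-sound q
  ... | false | false = suc (suc zero) , ≡ᶠ-sound e

  -- 3-connectedness

  -- The list contains the vertices strictly between the two ends, so that a cycle can be opened at
  -- any of its vertices.
  data Walk : Fin n → List (Fin n) → Fin n → Set where
    end : ∀ {u v} → Adj M u v → Walk u [] v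
    _∷_ : ∀ {u v vs w} → Adj M u v → Walk v vs w → Walk u (v ∷ vs) w

  Walk-join : ∀ {u v w xs ys} → Walk u xs v → Walk v ys w → Walk u (xs ++ v ∷ ys) w
  Walk-join (end a) q = a ∷ q
  Walk-join (a ∷ p) q = a ∷ Walk-join p q

  Walk-split : ∀ {u v w} xs {ys} → Walk u (xs ++ v ∷ ys) w → Walk u xs v × Walk v ys w
  Walk-split [] (a ∷ p) = end a , p
  Walk-split (x ∷ xs) (a ∷ p) with Walk-split xs p
  ... | q , r = a ∷ q , r

  Walk-path : ∀ {S u vs w} → Walk u vs w → (∀ {v} → v ∈ vs → ¬ S v) → ∀ {v} → v ∈ u ∷ vs → PathAvoiding M S u v
  Walk-path p out (here refl) = here
  Walk-path (a ∷ p) out (there i) = step a (out (here refl)) (Walk-path p (out ∘ there) i)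

  walkᵇ : Fin n → List (Fin n) → Fin n → Bool
  walkᵇ u [] w = adjᵇ u w
  walkᵇ u (v ∷ vs) w = adjᵇ u v ∧ walkᵇ v vs w

  walk-sound : ∀ u vs w → walkᵇ u vs w ≡ true → Walk u vs w
  walk-sound u [] w e = end (adj-sound u w e)
  walk-sound u (v ∷ vs) w e = let p , q = ∧-true (adjᵇ u v) e in adj-sound u v p ∷ walk-sound v vs w q

  distinctᶠ : List (Fin n) → Bool
  distinctᶠ [] = true
  distinctᶠ (v ∷ vs) = not (v ∈ᶠ vs) ∧ distinctᶠ vs

  distinct-sound : ∀ vs → distinctᶠ vs ≡ true → Unique vs
  distinct-sound [] e = []
  distinct-sound (v ∷ vs) e with ∧-true (not (v ∈ᶠ vs)) e
  ... | p , q = All.tabulate (λ i r → not-true p (∈ᶠ-complete (subst (_∈ vs) (sym r) i))) ∷ distinct-sound vs q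

  -- The vertices around z: the boundary of the union of its three faces.
  arc : ℕ → Fin n → Dart n → List (Fin n)
  arc zero z e = []
  -- The last vertex before `z` is left out, as it is the first of the next arc.
  arc (suc k) z e = if proj₁ (φ M e) ≡ᶠ z then [] else proj₁ e ∷ arc k z (φ M e)

  link : Fin n → List (Fin n)
  -- The face that leaves `z` along dart i returns along dart i + 2 modulo 3, hence the order 0, 2,
  -- 1.
  link z = arc 6 z (φ M (z , zero)) ++ arc 6 z (φ M (z , suc (suc zero))) ++ arc 6 z (φ M (z , suc zero))

  around-edgeᵇ : List (Fin n) → Dart n → Bool
  around-edgeᵇ c d = (proj₁ (α d) ∈ᶠ c) ∧ (proj₁ (φ M (φ M d)) ∈ᶠ c)

  cycleᵇ : Fin n → List (Fin n) → Bool
  cycleᵇ z [] = false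
  cycleᵇ z c@(v ∷ vs) = walkᵇ v vs v ∧ distinctᶠ c ∧ not (z ∈ᶠ c) ∧ all-Fin 3 (λ i → around-edgeᵇ c (z , i))

  record Surrounds (z : Fin n) (c : List (Fin n)) : Set where
    field
      {first} : Fin n
      {others} : List (Fin n)
      is-cycle : c ≡ first ∷ others
      cycle : Walk first others first
      distinct : Unique (first ∷ others)
      avoids : z ∉ c
      nbrs : ∀ i → nbr M z i ∈ c
      common : ∀ i → proj₁ (φ M (φ M (z , i))) ∈ c

  cycle-sound : ∀ z c → cycleᵇ z c ≡ true → Surrounds z c
  cycle-sound z c@(v ∷ vs) e with ∧-true (walkᵇ v vs v) e
  ... | p , e₁ with ∧-true (distinctᶠ c) e₁
  ...   | q , e₂ with ∧-true (not (z ∈ᶠ c)) e₂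
  ...     | r , e₃ = record
    { is-cycle = refl ; cycle = walk-sound v vs v p ; distinct = distinct-sound c q
    ; avoids = λ i → not-true r (∈ᶠ-complete i)
    ; nbrs = λ i → ∈ᶠ-sound c (proj₁ (edge i)) ; common = λ i → ∈ᶠ-sound c (proj₂ (edge i)) }
    where
    edge : ∀ i → proj₁ (α (z , i)) ∈ᶠ c ≡ true × proj₁ (φ M (φ M (z , i))) ∈ᶠ c ≡ true
    edge i = ∧-true (proj₁ (α (z , i)) ∈ᶠ c) (all-Fin-sound 3 (λ i → around-edgeᵇ c (z , i)) e₃ i)

  Unique-middle : ∀ {xs ys} {b : Fin n} → Unique (xs ++ b ∷ ys) → ∀ {v} → v ∈ xs ⊎ v ∈ ys → v ≢ b
  Unique-middle {[]} (a ∷ u) (inj₂ i) refl = All.lookup a i refl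
  Unique-middle {x ∷ xs} (a ∷ u) (inj₁ (here refl)) refl = All.lookup a (∈-++⁺ʳ xs (here refl)) refl
  Unique-middle {x ∷ xs} (a ∷ u) (inj₁ (there i)) e = Unique-middle {xs} u (inj₁ i) e
  Unique-middle {x ∷ xs} (a ∷ u) (inj₂ i) e = Unique-middle {xs} u (inj₂ i) e

  -- A cycle minus a vertex is a path, hence still connected.
  cut : ∀ {v vs b} → Walk v vs v → Unique (v ∷ vs) → b ∈ v ∷ vs → ∃ λ zs → Walk b zs b ×
    (∀ {x} → x ∈ zs → x ∈ v ∷ vs × x ≢ b) × (∀ {x} → x ∈ v ∷ vs → x ≢ b → x ∈ zs)
  cut {vs = vs} w u (here refl) = vs , w , (λ i → there i , Unique-middle {[]} u (inj₂ i)) ,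
    λ { (here refl) x≢b → ⊥-elim (x≢b refl) ; (there i) _ → i }
  cut {v} {vs} {b} w u (there i) with ∈-∃++ i
  ... | ps , qs , refl with Walk-split ps w
  ...   | w₁ , w₂ = qs ++ v ∷ ps , Walk-join w₂ w₁ , inside , outside
    where
    inside : ∀ {x} → x ∈ qs ++ v ∷ ps → x ∈ v ∷ ps ++ b ∷ qs × x ≢ b
    inside j with ∈-++⁻ qs j
    ... | inj₁ k = there (∈-++⁺ʳ ps (there k)) , Unique-middle {v ∷ ps} u (inj₂ k)
    ... | inj₂ (here refl) = here refl , Unique-middle {v ∷ ps} u (inj₁ (here refl))
    ... | inj₂ (there k) = there (∈-++⁺ˡ k) , Unique-middle {v ∷ ps} u (inj₁ (there k))
    outside : ∀ {x} → x ∈ v ∷ ps ++ b ∷ qs → x ≢ b → x ∈ qs ++ v ∷ ps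
    outside (here refl) _ = ∈-++⁺ʳ qs (here refl)
    outside (there j) x≢b with ∈-++⁻ ps j
    ... | inj₁ k = ∈-++⁺ʳ qs (there k)
    ... | inj₂ (here refl) = ⊥-elim (x≢b refl)
    ... | inj₂ (there k) = ∈-++⁺ˡ k

  module ThreeConn (ring : Fin n → List (Fin n)) (links : ∀ z → Surrounds z (ring z)) (connected : Connected M) where

    Walk-connects : ∀ {S b zs} → Walk b zs b → (∀ {x} → x ∈ zs → ¬ S x) →
      ∀ {x y} → x ∈ zs → y ∈ zs → PathAvoiding M S x y
    Walk-connects (a ∷ w) out i j = PathAvoiding-++
      (PathAvoiding-sym M (out (here refl)) (Walk-path w (out ∘ there) i)) (Walk-path w (out ∘ there) j)

    -- The ring of `s` avoids `s`, so it loses at most the vertex `t`, and a cycle minus one vertex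
    -- is still connected.
    link-connects : ∀ {S : Fin n → Set} s t → (∀ {x} → S x → x ≡ s ⊎ x ≡ t) → S t →
      ∀ {x y} → x ∈ ring s → y ∈ ring s → ¬ S x → ¬ S y → PathAvoiding M S x y
    link-connects {S} s t only St {x} {y} i j ¬x ¬y = by (links s)
      where
      by : Surrounds s (ring s) → PathAvoiding M S x y
      by K with Any.any? (t Fin.≟_) (ring s)
        where open Surrounds K
      ... | no t∉ = PathAvoiding-++
          (PathAvoiding-sym M (out (first∈)) (Walk-path cycle (λ k → out (other∈ k)) (subst (x ∈_) is-cycle i)))
          (Walk-path cycle (λ k → out (other∈ k)) (subst (y ∈_) is-cycle j))
        where
        open Surrounds K
        first∈ : first ∈ ring s
        first∈ = subst (first ∈_) (sym is-cycle) (here refl)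
        other∈ : ∀ {z} → z ∈ others → z ∈ ring s
        other∈ {z} k = subst (z ∈_) (sym is-cycle) (there k)
        out : ∀ {z} → z ∈ ring s → ¬ S z
        out k Sz with only Sz
        ... | inj₁ refl = avoids k
        ... | inj₂ refl = t∉ k
      ... | yes t∈ with cut (Surrounds.cycle K) (Surrounds.distinct K) (subst (t ∈_) (Surrounds.is-cycle K) t∈)
      ...   | zs , w , inside , outside = Walk-connects w out (outside′ i ¬x) (outside′ j ¬y)
        where
        open Surrounds K
        out : ∀ {z} → z ∈ zs → ¬ S z
        out {z} k Sz with only Sz
        ... | inj₁ refl = avoids (subst (z ∈_) (sym is-cycle) (proj₁ (inside k)))
        ... | inj₂ refl = proj₂ (inside k) refl
        outside′ : ∀ {z} → z ∈ ring s → ¬ S z → z ∈ zs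
        outside′ {z} k ¬z = outside (subst (z ∈_) is-cycle k) λ { refl → ¬z St }

    module _ (a b : Fin n) where

      S : Fin n → Set
      S x = x ≡ a ⊎ x ≡ b

      S? : ∀ x → Dec (S x)
      S? x with x Fin.≟ a | x Fin.≟ b
      ... | yes p | _ = yes (inj₁ p)
      ... | no _ | yes p = yes (inj₂ p)
      ... | no p | no q = no λ { (inj₁ r) → p r ; (inj₂ r) → q r }

      around : ∀ {s} → S s → ∀ {x y} → x ∈ ring s → y ∈ ring s → ¬ S x → ¬ S y → PathAvoiding M S x y
      around (inj₁ refl) = link-connects a b (λ s → s) (inj₂ refl)
      around (inj₂ refl) = link-connects b a (λ { (inj₁ p) → inj₂ p ; (inj₂ p) → inj₁ p }) (inj₁ refl)

      -- When both deleted vertices are adjacent, a rerouted walk must change rings. The vertex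
      -- after `t` on the face of the dart from `s` to `t` lies on both: it is a neighbour of `t`
      -- and on a face around `s`.
      shared : ∀ {s t} → S s → S t → Adj M s t → ∃ λ x → x ∈ ring s × x ∈ ring t × ¬ S x
      shared {s} {t} Ss St (i , refl) = x , x∈s , x∈t , out Ss St
        where
        x : Fin n
        x = proj₁ (φ M (φ M (s , i)))
        x∈s : x ∈ ring s
        x∈s = Surrounds.common (links s) i
        x∈t : x ∈ ring t
        x∈t = Surrounds.nbrs (links t) _
        s≢t : s ≢ t
        s≢t e = Surrounds.avoids (links s) (subst (_∈ ring s) (sym e) (Surrounds.nbrs (links s) i))
        x≢s : x ≢ s
        x≢s e = Surrounds.avoids (links s) (subst (_∈ ring s) e x∈s)
        x≢t : x ≢ t
        x≢t e = Surrounds.avoids (links t) (subst (_∈ ring t) e x∈t)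
        out : S s → S t → ¬ S x
        out (inj₁ p) (inj₁ q) _ = s≢t (trans p (sym q))
        out (inj₂ p) (inj₂ q) _ = s≢t (trans p (sym q))
        out (inj₁ p) (inj₂ q) (inj₁ r) = x≢s (trans r (sym p))
        out (inj₁ p) (inj₂ q) (inj₂ r) = x≢t (trans r (sym q))
        out (inj₂ p) (inj₁ q) (inj₁ r) = x≢t (trans r (sym q))
        out (inj₂ p) (inj₁ q) (inj₂ r) = x≢s (trans r (sym p))

      -- A walk through a deleted vertex is rerouted along the vertices around it.
      Reached : Fin n → Fin n → Set
      Reached u z = (¬ S z → PathAvoiding M S u z) ×
                    (S z → ∀ {x} → x ∈ ring z → ¬ S x → PathAvoiding M S u x)

      extend-reach : ∀ {u z z′} → Adj M z z′ → Reached u z → Reached u z′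
      extend-reach {u} {z} {z′} adj (free , cut) with S? z
      ... | no ¬z = (λ ¬z′ → PathAvoiding-++ (free ¬z) (step adj ¬z′ here)) ,
                    λ Sz′ i ¬x → PathAvoiding-++ (free ¬z) (around Sz′ (z∈ (Adj-sym M adj)) i ¬z ¬x)
        where
        z∈ : Adj M z′ z → z ∈ ring z′
        z∈ (i , refl) = Surrounds.nbrs (links z′) i
      ... | yes Sz = (λ ¬z′ → cut Sz (z′∈ adj) ¬z′) ,
                     λ Sz′ i ¬x → let y , y∈z , y∈z′ , ¬y = shared Sz Sz′ adj in
                       PathAvoiding-++ (cut Sz y∈z ¬y) (around Sz′ y∈z′ i ¬y ¬x)
        where
        z′∈ : Adj M z z′ → z′ ∈ ring z
        z′∈ (i , refl) = Surrounds.nbrs (links z) i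

      reach : ∀ {u z w} → PathAvoiding M (λ _ → ⊥) z w → Reached u z → Reached u w
      reach here r = r
      reach (step adj _ p) r = reach p (extend-reach adj r)

      avoiding : ConnectedAvoiding M S
      avoiding u v ¬u ¬v = proj₁ (reach (connected u v (λ ()) (λ ()))
        ((λ _ → here) , λ Su → ⊥-elim (¬u Su))) ¬v

  -- Verification of sextet patterns and isolated pentagons

  module Sextet (H pairs : List (Dart n)) where

    vertsFrom : ℕ → Dart n → List (Fin n)
    vertsFrom zero d = []
    vertsFrom (suc k) d = proj₁ d ∷ vertsFrom k (φ M d)

    ∈-vertsFrom⁺ : ∀ k d {j} → j < k → proj₁ (iter M j d) ∈ vertsFrom k d
    ∈-vertsFrom⁺ (suc k) d {zero} _ = here refl
    ∈-vertsFrom⁺ (suc k) d {suc j} (s≤s j<k) =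
      there (subst (_∈ vertsFrom k (φ M d)) (cong proj₁ (iter-suc j d)) (∈-vertsFrom⁺ k (φ M d) j<k))

    ∈-vertsFrom⁻ : ∀ k d {v} → v ∈ vertsFrom k d → OnFace M d v
    ∈-vertsFrom⁻ (suc k) d (here refl) = 0 , refl
    ∈-vertsFrom⁻ (suc k) d (there i) with ∈-vertsFrom⁻ k (φ M d) i
    ... | j , e = suc j , trans (cong proj₁ (sym (iter-suc j d))) e

    -- The position of the first hexagon through `v`, or the length of the list for an uncovered
    -- vertex. Hexagons are disjoint once all vertices of hexagon k get the number k.
    hexOf : List (Dart n) → Fin n → ℕ
    hexOf [] v = 0
    hexOf (d ∷ ds) v = if v ∈ᶠ vertsFrom 6 d then 0 else suc (hexOf ds v)

    hexOf-covers : ∀ ds v → hexOf ds v < length ds → ∃ λ i → OnFace M (lookup ds i) v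
    hexOf-covers (d ∷ ds) v l with v ∈ᶠ vertsFrom 6 d in e
    ... | true = zero , ∈-vertsFrom⁻ 6 d (∈ᶠ-sound (vertsFrom 6 d) e)
    hexOf-covers (d ∷ ds) v (s≤s l) | false with hexOf-covers ds v l
    ... | i , o = suc i , o

    hexesᵇ : ℕ → List (Dart n) → Bool
    hexesᵇ k [] = true
    hexesᵇ k (d ∷ ds) = lenᵇ 5 d (φ M d) ∧ all-List (λ u → hexOf H u ≡ᵇ k) (vertsFrom 6 d) ∧ hexesᵇ (suc k) ds

    hexes-sound : ∀ k ds → hexesᵇ k ds ≡ true → ∀ i → FaceLen M (lookup ds i) 6 ×
      (∀ {u} → u ∈ vertsFrom 6 (lookup ds i) → hexOf H u ≡ k + toℕ i)
    hexes-sound k (d ∷ ds) e i with ∧-true (lenᵇ 5 d (φ M d)) e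
    ... | p , e₁ with ∧-true (all-List (λ u → hexOf H u ≡ᵇ k) (vertsFrom 6 d)) e₁
    hexes-sound k (d ∷ ds) e zero | p , e₁ | q , _ = lenᵇ-sound 5 d p ,
      λ {u} j → trans (≡ᵇ-sound (hexOf H u) k (all-List-sound (λ u → hexOf H u ≡ᵇ k) (vertsFrom 6 d) q j)) (sym (+-identityʳ k))
    hexes-sound k (d ∷ ds) e (suc i) | p , e₁ | q , e₂ with hexes-sound (suc k) ds e₂ i
    ... | l , o = l , λ j → trans (o j) (sym (+-suc k (toℕ i)))

    partner : List (Dart n) → Fin n → Fin n
    partner [] v = v
    partner (d ∷ ds) v = if proj₁ d ≡ᶠ v then proj₁ (α d) else
      (if proj₁ (α d) ≡ᶠ v then proj₁ d else partner ds v)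

    matchedᵇ : Fin n → Fin n → Bool
    matchedᵇ v w = (hexOf H v <ᵇ length H) ∨ (adjᵇ v w ∧ (hexOf H w ≡ᵇ length H) ∧ (partner pairs w ≡ᶠ v))

    sextetᵇ : Bool
    sextetᵇ = hexesᵇ 0 H ∧ all-Fin n (λ v → matchedᵇ v (partner pairs v))

    sextet-sound : sextetᵇ ≡ true → SextetPattern M H
    sextet-sound e = (λ i → proj₁ (hex i)) , disjoint , partner pairs , matched
      where
      hex : ∀ i → FaceLen M (lookup H i) 6 × (∀ {u} → u ∈ vertsFrom 6 (lookup H i) → hexOf H u ≡ toℕ i)
      hex = hexes-sound 0 H (proj₁ (∧-true (hexesᵇ 0 H) e))
      owned : ∀ i {u} → OnFace M (lookup H i) u → hexOf H u ≡ toℕ i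
      owned i (j , refl) with iter-reduce (s≤s z≤n) (proj₁ (proj₂ (proj₁ (hex i)))) j
      ... | j′ , j′<6 , q = proj₂ (hex i) (subst (λ d → proj₁ d ∈ vertsFrom 6 (lookup H i)) (sym q)
                              (∈-vertsFrom⁺ 6 (lookup H i) j′<6))
      disjoint : ∀ i i′ → i ≢ i′ → ∀ u → OnFace M (lookup H i) u → ¬ OnFace M (lookup H i′) u
      disjoint i i′ i≢i′ u o o′ = i≢i′ (Fin.toℕ-injective (trans (sym (owned i o)) (owned i′ o′)))
      matched : ∀ v → ¬ Covered M H v → Adj M v (partner pairs v) × ¬ Covered M H (partner pairs v)
        × partner pairs (partner pairs v) ≡ v
      matched v bare with hexOf H v <ᵇ length H in q
                        | all-Fin-sound n (λ v → matchedᵇ v (partner pairs v)) (proj₂ (∧-true (hexesᵇ 0 H) e)) v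
      ... | true | _ = ⊥-elim (bare (hexOf-covers H v (<ᵇ⇒< _ _ (Equivalence.from T-≡ q))))
      ... | false | r with ∧-true (adjᵇ v (partner pairs v)) r
      ...   | a , r′ with ∧-true (hexOf H (partner pairs v) ≡ᵇ length H) r′
      ...     | b , s = adj-sound v (partner pairs v) a ,
        (λ { (i , o) → <-irrefl (trans (sym (owned i o)) (≡ᵇ-sound (hexOf H (partner pairs v)) (length H) b)) (Fin.toℕ<n i) }) ,
        ≡ᶠ-sound s

  isolatedᵇ : Dart n → Bool
  isolatedᵇ d = lenᵇ 5 d (φ M d) ∨ lenᵇ 5 (α d) (φ M (α d))

  isolated-sound : all-Darts n isolatedᵇ ≡ true → IsolatedPentagons M
  isolated-sound e d l l′ with lenᵇ 5 d (φ M d) in p | all-Darts-sound isolatedᵇ e d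
  ... | true | _ = FaceLen-unique l (lenᵇ-sound 5 d p) ≤-refl
  ... | false | q = FaceLen-unique l′ (lenᵇ-sound 5 (α d) q) ≤-refl

-- A numerical isomorphism invariant

module Invariant {n : ℕ} (M : CubicMap n) where

  spread : (Fin n → ℕ) → Fin n → ℕ
  spread x v = sum {3} (λ i → x (nbr M v i))

  ends : ℕ → Fin n → List (Fin n)
  ends zero v = v ∷ []
  ends (suc k) v = ends k (nbr M v zero) ++ ends k (nbr M v (suc zero)) ++ ends k (nbr M v (suc (suc zero)))

  δ : Fin n → Fin n → ℕ
  δ u v = if v ≡ᶠ u then 1 else 0

  count : Fin n → List (Fin n) → ℕ
  count u [] = 0
  count u (v ∷ vs) = if v ≡ᶠ u then suc (count u vs) else count u vs

  powers : ℕ → (Fin n → ℕ) → Fin n → ℕ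
  powers zero x = x
  powers (suc k) x = spread (powers k x)

  count-++ : ∀ u xs ys → count u (xs ++ ys) ≡ count u xs + count u ys
  count-++ u [] ys = refl
  count-++ u (x ∷ xs) ys with x ≡ᶠ u
  ... | true = cong suc (count-++ u xs ys)
  ... | false = count-++ u xs ys

  -- Both sides count the walks of length `k` from `v` to `u`. The list of ends is what gets
  -- evaluated, the powers of the adjacency matrix are what isomorphisms respect.
  count-ends : ∀ k u v → count u (ends k v) ≡ powers k (δ u) v
  count-ends zero u v with v ≡ᶠ u
  ... | true = refl
  ... | false = refl
  count-ends (suc k) u v = trans (count-++ u (ends k (nbr M v zero)) _)
    (cong₂ _+_ (count-ends k u _) (trans (count-++ u (ends k (nbr M v (suc zero))) _)
      (cong₂ _+_ (count-ends k u _) (trans (count-ends k u _) (sym (+-identityʳ _))))))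

  meet : List (Fin n) → Fin n → ℕ
  meet vs = spread (spread (λ u → count u vs))

  -- Closed walks of length five, as pairs of a walk of length two and one of length three.
  closed₅ : Fin n → ℕ
  closed₅ v = meet (ends 3 v) v

  -- Evaluates every entry of x once only.
  memo : (Fin n → ℕ) → Fin n → ℕ
  memo x = Vec.lookup (Vec.tabulate x)

  memo-≗ : ∀ x v → memo x v ≡ x v
  memo-≗ x v = lookup∘tabulate x v

  memo-powers : ℕ → (Fin n → ℕ) → Fin n → ℕ
  memo-powers zero x = x
  memo-powers (suc k) x = memo-powers k (memo (spread x))

  pairing : (x y : Fin n → ℕ) → ℕ
  pairing x y = sum {n} (λ v → x v * y v)

  correlation : (Fin n → ℕ) → ℕ
  correlation x = pairing x (memo-powers 5 x)

  -- ⟨ x , A⁵ x ⟩ for the adjacency matrix A and the vector x of closed walk counts.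
  invariant : ℕ
  invariant = correlation (memo closed₅)

module _ {n : ℕ} {M N : CubicMap n} (M-simple : Simple M) (N-simple : Simple N) (iso : Iso M N) where
  private
    module IM = Invariant M
    module IN = Invariant N
    f g : Fin n → Fin n
    f = proj₁ iso
    g = proj₁ (proj₂ iso)
    gf : ∀ v → g (f v) ≡ v
    gf = proj₁ (proj₂ (proj₂ iso))
    fg : ∀ v → f (g v) ≡ v
    fg = proj₁ (proj₂ (proj₂ (proj₂ iso)))
    to : ∀ {u v} → Adj M u v → Adj N (f u) (f v)
    to = proj₁ (proj₂ (proj₂ (proj₂ (proj₂ iso)))) _ _
    from : ∀ {u v} → Adj N (f u) (f v) → Adj M u v
    from = proj₂ (proj₂ (proj₂ (proj₂ (proj₂ iso)))) _ _

    nbr-inj : ∀ {K : CubicMap n} → Simple K → ∀ v {i j} → nbr K v i ≡ nbr K v j → i ≡ j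
    nbr-inj simple v {i} {j} e with i Fin.≟ j
    ... | yes p = p
    ... | no p = ⊥-elim (proj₂ simple v i j p e)

    Related : (Fin n → ℕ) → (Fin n → ℕ) → Set
    Related x y = ∀ v → y (f v) ≡ x v

    -- In a simple graph a neighbour determines its dart, so an isomorphism permutes the three darts
    -- at each vertex, whether or not it respects the rotation. Sums over neighbours are therefore
    -- preserved.
    nbr-permutation : Fin n → Permutation 3 3
    nbr-permutation v = permutation k k′ kk′ k′k
      where
      k k′ : Fin 3 → Fin 3
      k i = proj₁ (to {v} (i , refl))
      k-nbr : ∀ i → nbr N (f v) (k i) ≡ f (nbr M v i)
      k-nbr i = proj₂ (to {v} (i , refl))
      back : ∀ j → Adj M v (g (nbr N (f v) j))
      back j = from (j , sym (fg _))
      k′ j = proj₁ (back j)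
      k′-nbr : ∀ j → nbr M v (k′ j) ≡ g (nbr N (f v) j)
      k′-nbr j = proj₂ (back j)
      kk′ : ∀ j → k (k′ j) ≡ j
      kk′ j = nbr-inj {N} N-simple (f v) (trans (k-nbr (k′ j)) (trans (cong f (k′-nbr j)) (fg _)))
      k′k : ∀ i → k′ (k i) ≡ i
      k′k i = nbr-inj {M} M-simple v (trans (k′-nbr (k i)) (trans (cong g (k-nbr i)) (gf _)))

    spread-related : ∀ {x y} → Related x y → Related (IM.spread x) (IN.spread y)
    spread-related {x} {y} r v = trans (sum-permute (λ i → y (nbr N (f v) i)) (nbr-permutation v))
      (sum-cong-≗ λ i → trans (cong y (proj₂ (to {v} (i , refl)))) (r (nbr M v i)))

    powers-related : ∀ k {x y} → Related x y → Related (IM.powers k x) (IN.powers k y)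
    powers-related zero r = r
    powers-related (suc k) {x} {y} r = spread-related {IM.powers k x} {IN.powers k y} (powers-related k {x} {y} r)

    δ-related : ∀ u → Related (IM.δ u) (IN.δ (f u))
    δ-related u v with v ≡ᶠ u in p | f v ≡ᶠ f u in q
    ... | true | true = refl
    ... | false | false = refl
    ... | true | false with ≡ᶠ-sound {i = v} p
    ...   | refl with trans (sym q) (≡ᶠ-refl (f v))
    ...     | ()
    δ-related u v | false | true with trans (sym (gf v)) (trans (cong g (≡ᶠ-sound q)) (gf u))
    ...   | refl with trans (sym p) (≡ᶠ-refl v)
    ...     | ()

    count-related : ∀ k v → Related (λ u → IM.count u (IM.ends k v)) (λ u → IN.count u (IN.ends k (f v)))
    count-related k v u = trans (IN.count-ends k (f u) (f v))
      (trans (powers-related k {IM.δ u} {IN.δ (f u)} (δ-related u) v) (sym (IM.count-ends k u v)))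

    closed-related : Related IM.closed₅ IN.closed₅
    closed-related v = spread-related {IM.spread cM} {IN.spread cN} (spread-related {cM} {cN} (count-related 3 v)) v
      where
      cM cN : Fin n → ℕ
      cM u = IM.count u (IM.ends 3 v)
      cN u = IN.count u (IN.ends 3 (f v))

    memo-related : ∀ {x y} → Related x y → Related (IM.memo x) (IN.memo y)
    memo-related {x} {y} r v = trans (IN.memo-≗ y (f v)) (trans (r v) (sym (IM.memo-≗ x v)))

    memo-powers-related : ∀ k {x y} → Related x y → Related (IM.memo-powers k x) (IN.memo-powers k y)
    memo-powers-related zero r = r
    memo-powers-related (suc k) {x} {y} r = memo-powers-related k {IM.memo (IM.spread x)} {IN.memo (IN.spread y)}
      (memo-related {IM.spread x} {IN.spread y} (spread-related {x} {y} r))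

    correlation-related : ∀ {x y} → Related x y → IN.correlation y ≡ IM.correlation x
    correlation-related {x} {y} r = trans (sum-permute (λ v → y v * IN.memo-powers 5 y v) (permutation f g fg gf))
      (sum-cong-≗ λ v → cong₂ _*_ (r v) (memo-powers-related 5 {x} {y} r v))

  Iso-invariant : IN.invariant ≡ IM.invariant
  Iso-invariant = correlation-related {IM.memo IM.closed₅} {IN.memo IN.closed₅}
    (memo-related {IM.closed₅} {IN.closed₅} closed-related)

-- The eighteen graphs

-- A dart (v , i) is coded as 3 v + i, and a list of darts as the number with these
-- base-180 digits, least significant first.  The involution lists the images of all
-- darts, hexagons and matching describe a sextet pattern, and value is the invariant.
-- The vertices are numbered by breadth-first search, dart 0 leading to the parent.
record GraphData : Set where
  constructor graph-data
  field
    involution hexagons matching value : ℕ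

graphData : List GraphData
graphData =
  graph-data 8546101030614139956382751482506223416784093579421975308454506871315150723721242362941460260652715192556026577431309874506749637012627066647676773020063592909679854806136268868333364331660596341939048782431101187217050444150705394549713512931510703049174549652571943982019368347638275556101717048727326843730503053158673984785157408369510214674156954708045258175015139881075917488952448978174474570533412683
      821566851322801346 16231331287718 62128
  ∷ graph-data 8546101030614139956382751482506224734928887280002055300268574791991413567594232270207307251970666886916693229671747637917160275211637836190935634865317426205932623840259511140786049014461283826810068952718046336880022830808212169276318184951917589947128590882278939344704693314962063723195303740624232191363642806748975410338343896689510214674156954708045258175015139881075917488952448978174474570533412683
      729428882896819475 18508208046410 63984
  ∷ graph-data 8249931359246799744023857286068961874544009649294096743676405803691760007386448146609676323887387780257056726939398884075298486983770348456849733186470809217787579614298521012085479705294138131798491369713339036993957693373518322022725744378681263811402633008391582701098764665972589642501717048727326843730503053158673984785157408369510214674156954708045258175015139881075917488952448978174474570533412683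
      89068792561919906 19856227470725 61520
  ∷ graph-data 8546101030614139956382751482506223416784093579421975308565264340656279903380404076908666244115330967169556334861179738001399441811166716374027924466314887507647349322402550019182865890985114171534342403036316375471147888592364135203915794884465181377694970046733125521789621055631434695740964706834786190854538002839852803310255480537555168274156954708045258175015139881075917488952448978174474570533412683
      51924600189365135 16448724202217 63016
  ∷ graph-data 8397878867612754332137140189803926587165993681601700145449218020649124503670183560037159556674409119431433323402107887864872537730387056848841856737018973308606172539572007806705106496805798675875746348106984835494976248690995170565778047455809537731402633008391582701098764665972589642501717048727326843730503053158673984785157408369510214674156954708045258175015139881075917488952448978174474570533412683
      803201418728475866 14725998774450 61136
  ∷ graph-data 8249931359246799744023857286068961874544009649294096743676405822683092371892074887613615446532597111088065605972471311509555109535830481550270036857223546413539941295605489827051483165238422708362543531205583015123584933503732055835223499922010981057694970046733125521789621055631434695740964706834786190854538002839852803310255480537555168274156954708045258175015139881075917488952448978174474570533412683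
      711061157627336555 12275876236602 62256
  ∷ graph-data 8546101030614139956382751482506224734928887280002055300379332261332542753288042269690617734272141833656324514698535805262816024444795296722428293774909488718733488692189558222220273886805952932915543158077620957706998867919837512033286746792524157756749609651246861870264331761495741470751455648192003502747563930917243251055689080537555168274156954708045258175015139881075917488952448978174474570533412683
      218546504842102766 18712980808084 64616
  ∷ graph-data 8249931359246799744023857286068963192688803349874176735490473743359355221799713080395566936689407977574833785809827378770971692169459061898670406165818147624626080665392498030088891161059261469743744286246887597359435912831205432664594451830069957436749609651246861870264331761495741470751455648192003502747563930917243251055689080537555168274156954708045258175015139881075917488952448978174474570533412683
      218546504842102766 18712986672484 63488
  ∷ graph-data 8397878842197431458099837085466985869617429837552856674947013678568649644015617765445847361850577843389774267953479850727841361409110090307761410193768131783086568467622721347202551164913919883608219046447504786979139691685299019381120571144864645451645647750040807195544222218631620299807774215417741840724920152259061897099653527061976497930767216872397136103341406761075917488952448978174474570533412683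
      362604704064531713 3959223898843 58832
  ∷ graph-data 8397055461557921368239760533432715314106275513103430544382994892910721114244084956133790647081747838058814310551303616676482198978306422057632307392121727214334486382605838767052163870147920973431429357763300940158205199636802817657072026834391071902368566936173963962170092039882488269310476016902792918351745644964164949899653527061976497930767216872397136103341406761075917488952448978174474570533412683
      877286309315130401 30889353624156 58688
  ∷ graph-data 8546101005198812724482442540906634920806517458366424022940587668732431976351724999580055051086649219916363964182902494265878412005085582964581112518265365540408936944793734304778360350123432361683892523357156288974983925836502325879106391378080321372518132455259817202515800285821380299807774215417741840724920152259061897099653527061976497930767216872397136103341406761075917488952448978174474570533412683
      877286309315130401 31108753464156 58752
  ∷ graph-data 8546101005198817082390281406469640180374103879751850712001631935408387061675608190688219740156020602914539556839928827914041890884462910597706665348785181224278011752946545659473797035677714336015148039618876796149622936156899544152516396224760614590194406838963849528375487892317406250146022592877442482108548343591465082116158853781735090118844264953286738610586029451669737927687188843774474570533412683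
      677920779617860805 33526770306301 58320
  ∷ graph-data 8397878842197431458099837085466985869617429837552856674947013678568649644015617765445847361850577843389774267953479850727841361409110090307761397926573647294825936869890766160358984630453226339086022456687078725719446389450961884113657857845905186761303900404411010275198513972692728269310476016902792918351745644964164949899653527061976497930767216872397136103341406761075917488952448978174474570533412683
      366083587114467662 22078443070871 59152
  ∷ graph-data 8248833298415339602512668086499312414550650275478383735280166707662888153271283021075557940383749520317649917152439729876725046115336107819552247717740166466032974819588564407101400418322721886519468665214957610330768032274984128818032761502600081751517829576584750875544222218631620299807774215417741840724920152259061897099653527061976497930767216872397136103341406761075917488952448978174474570533412683
      366083587114467662 16409826550871 59120
  ∷ graph-data 8248833298415339602512668086499312414550650275478383735280166707662888153271283021075557940383749520317649917152439729876725046115336107819552235450545681977772343221856609220257833883862028341997272075454531549071074730040646993550570048203640623061176082230954953955198513972692728269310476016902792918351745644964164949899653527061976497930767216872397136103341406761075917488952448978174474570533412683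
      366083587114467662 22078530550871 59216
  ∷ graph-data 8546101030614139956382751482506224734928887280002055300268574791991413567594232270207307251970666886916693229671747637917160275211637836190935634865317426206293294006505865999309788360503072907304612934715427576912524534131277198163401230130799444781410218452948214741126931501647425654122164892413360448383692576267990936738343896689510214674156954708045258175015139881075917488952448978174474570533412683
      218744903218244246 20413580278057 65936
  ∷ graph-data 8398151971915559970294106090920767207546129387003246456025523633606847850284593196089930682212569543274932819913395951957975767537702172732509009298317611533359805686634129113955849435295130732287277753926231879055093988206721343963915918762674103598418027390003761122467004260332043443413071556710529380810889229961238004944911585985482385222205090833280470085024971445286137371858048978174474570533412683
      712715848665751811 28153379984414 77328
  ∷ graph-data 8398151971915302861802312253228950843831107277302257523459994378247015999857673146144904029185777588068905687170884669377694948791798057361040979091408257273592527340428298492104714603404682959195510317987212215237926903818956794100859499748799407782409195267123761122467004260332043443413071556710529380810889229961238004944911585985482385222205090833280470085024971445286137371858048978174474570533412683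
      731487755680591148 30418820481616 77456
  ∷ []

decode : ℕ → Dart 60
decode d = clamp 59 (d / 3) , clamp 2 (d % 3)

mutual
  -- Powers of 180 by repeated squaring. The first argument bounds the halvings of the exponent; 8
  -- suffice for the dart codes, which are less than 180 < 2⁸.
  180^ : ℕ → ℕ → ℕ
  180^ zero _ = 1
  180^ (suc f) zero = 1
  180^ (suc f) k@(suc _) = square (180^ f (k / 2)) (k % 2)

  square : ℕ → ℕ → ℕ
  square p zero = p * p
  square p (suc _) = p * p * 180

quotient : ℕ → ℕ → ℕ
quotient a zero = 0
quotient a (suc b) = a / suc b

digits : ℕ → ℕ → List (Dart 60)
digits zero a = []
digits (suc k) a = decode (a % 180) ∷ digits k (a / 180)

dataOf : Fin 18 → GraphData
dataOf g = nth (graph-data 0 0 0 0) graphData (toℕ g)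

αᴸ : Fin 18 → Dart 60 → Dart 60
αᴸ g (v , i) = decode (quotient (GraphData.involution (dataOf g)) (180^ 8 (3 * toℕ v + toℕ i)) % 180)

involutiveᵇ : Fin 18 → Dart 60 → Bool
involutiveᵇ g d = αᴸ g (αᴸ g d) ≡ᵈ d

abstract
  αᴸ-invol : ∀ g d → αᴸ g (αᴸ g d) ≡ d
  αᴸ-invol g d = ≡ᵈ-sound (all-Darts-sound (involutiveᵇ g)
    (all-Fin-sound 18 (λ g → all-Darts 60 (involutiveᵇ g)) refl g) d)

L : Fin 18 → CubicMap 60
L g = record { α = αᴸ g ; α-invol = αᴸ-invol g }

module _ (g : Fin 18) where
  open Check (L g)

  facesᵇ : List (Dart 60) × List (List ℕ) → Bool
  facesᵇ Rfs = Reps.repsᵇ zero Rfs ∧ (length (Reps.R zero Rfs) ≡ᵇ 32)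

  faceTable : List (Dart 60) × List (List ℕ)
  faceTable = collect (allDarts 60) [] []
    where
    allDarts : ∀ n → List (Dart n)
    allDarts n = concatMap (λ v → map (v ,_) (allFin 3)) (allFin n)

  hexagons matching : List (Dart 60)
  -- Eight hexagons cover 48 vertices, and six edges match the other twelve.
  hexagons = digits 8 (GraphData.hexagons (dataOf g))
  matching = digits 6 (GraphData.matching (dataOf g))

abstract
  L-simple : ∀ g → Simple (L g)
  L-simple g = Check.simple-sound (L g) (all-Fin-sound 18 (λ g → Check.simpleᵇ (L g)) refl g)

  L-connected : ∀ g → Connected (L g)
  L-connected g = Check.descends-sound (L g)
    (all-Fin-sound 18 (λ g → all-Fin 60 (Check.descendsᵇ (L g))) refl g)

  L-facesᵇ : ∀ g → facesᵇ g (faceTable g) ≡ true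
  L-facesᵇ = all-Fin-sound 18 (λ g → facesᵇ g (faceTable g)) refl

  L-surrounds : ∀ g z → Check.Surrounds (L g) z (Check.link (L g) z)
  L-surrounds g z = Check.cycle-sound (L g) z (Check.link (L g) z)
    (all-Fin-sound 60 (λ z → Check.cycleᵇ (L g) z (Check.link (L g) z))
      (all-Fin-sound 18 (λ g → all-Fin 60 λ z → Check.cycleᵇ (L g) z (Check.link (L g) z)) refl g) z)

  L-sextet : ∀ g → SextetPattern (L g) (hexagons g)
  L-sextet g = Check.Sextet.sextet-sound (L g) (hexagons g) (matching g)
    (all-Fin-sound 18 (λ g → Check.Sextet.sextetᵇ (L g) (hexagons g) (matching g)) refl g)

  L-invariant : ∀ g → Invariant.invariant (L g) ≡ GraphData.value (dataOf g)
  L-invariant g = ≡ᵇ-sound _ _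
    (all-Fin-sound 18 (λ g → Invariant.invariant (L g) ≡ᵇ GraphData.value (dataOf g)) refl g)

  values-distinct : ∀ g h → GraphData.value (dataOf g) ≡ GraphData.value (dataOf h) → g ≡ h
  values-distinct g h e = go (all-Fin-sound 18 (differ g) (all-Fin-sound 18 (λ g → all-Fin 18 (differ g)) refl g) h)
    where
    differ : Fin 18 → Fin 18 → Bool
    differ g h = (g ≡ᶠ h) ∨ not (GraphData.value (dataOf g) ≡ᵇ GraphData.value (dataOf h))
    go : differ g h ≡ true → g ≡ h
    go p with g ≡ᶠ h in q
    ... | true = ≡ᶠ-sound q
    ... | false = ⊥-elim (not-true p (trans (cong (_≡ᵇ GraphData.value (dataOf h)) e) (≡ᵇ-refl (GraphData.value (dataOf h)))))

-- Each vertex of this graph lies on exactly one pentagon, so `closed₅` is constantly 2, in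
-- agreement with the invariant 60 · 2 · 2 · 3⁵ = 58320.
buckminster : Fin 18
buckminster = clamp 17 11

abstract
  L-isolated : IsolatedPentagons (L buckminster)
  L-isolated = Check.isolated-sound (L buckminster) refl

-- In the order in which the search meets its closed states on 60 vertices. A graph recurs because a
-- state also fixes a sextet pattern, a matching of the rest and an exit at the root.
quadCerts : List (Cert 17)
quadCerts =
  cert 0 (quadn 7 2) 0 true ∷ cert 1 (quadn 8 2) 0 true ∷ cert 2 (quadn 11 0) 2 false
  ∷ cert 3 (quadn 12 2) 2 false ∷ cert 2 (quadn 7 0) 2 false ∷ cert 3 (quadn 8 2) 2 false
  ∷ cert 4 (quadn 7 0) 2 false ∷ cert 5 (quadn 8 2) 2 false ∷ cert 1 (quadn 6 0) 2 false
  ∷ cert 0 (quadn 6 0) 2 false ∷ cert 3 (quadn 10 0) 0 true ∷ cert 2 (quadn 10 0) 0 true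
  ∷ cert 3 (quadn 6 0) 0 true ∷ cert 2 (quadn 6 0) 0 true ∷ cert 5 (quadn 6 0) 0 true
  ∷ cert 4 (quadn 6 0) 0 true ∷ cert 3 (quadn 5 2) 0 true ∷ cert 6 (quadn 5 2) 0 true
  ∷ cert 5 (quadn 5 2) 0 true ∷ cert 7 (quadn 5 2) 0 true ∷ cert 8 (hexn 8 2) 0 false
  ∷ cert 9 (hexn 2 5) 0 false ∷ cert 10 (hexn 2 5) 0 false ∷ cert 8 (hexn 3 1) 0 false
  ∷ cert 9 (hexn 6 4) 0 false ∷ cert 11 (quadn 0 0) 0 false ∷ cert 8 (hexn 10 0) 0 true
  ∷ cert 9 (hexn 3 3) 0 true ∷ cert 10 (hexn 1 3) 0 true ∷ cert 8 (hexn 2 5) 0 true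
  ∷ cert 8 (hexn 1 3) 0 true ∷ cert 12 (hexn 1 3) 0 true ∷ cert 8 (hexn 6 0) 0 true
  ∷ cert 9 (hexn 1 3) 0 true ∷ cert 13 (hexn 1 3) 0 true ∷ cert 14 (hexn 1 3) 0 true
  ∷ cert 3 (quadn 5 0) 2 false ∷ cert 6 (quadn 5 0) 2 false ∷ cert 5 (quadn 5 0) 2 false
  ∷ cert 7 (quadn 5 0) 2 false ∷ cert 1 (quadn 5 0) 2 false ∷ cert 15 (quadn 5 0) 2 false
  ∷ cert 3 (quadn 9 2) 0 true ∷ cert 6 (quadn 8 0) 0 true ∷ cert 12 (hexn 1 1) 0 true
  ∷ cert 14 (hexn 1 1) 0 true ∷ cert 8 (hexn 1 1) 0 true ∷ cert 13 (hexn 1 1) 0 true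
  ∷ cert 8 (hexn 6 4) 0 true ∷ cert 9 (hexn 1 1) 0 true ∷ cert 10 (hexn 1 1) 0 true
  ∷ cert 8 (hexn 4 5) 0 true ∷ cert 8 (hexn 3 1) 0 true ∷ cert 13 (hexn 1 1) 0 false
  ∷ cert 9 (hexn 1 1) 0 false ∷ cert 14 (hexn 1 1) 0 false ∷ cert 10 (hexn 1 1) 0 false
  ∷ cert 8 (hexn 1 1) 0 false ∷ cert 8 (hexn 2 3) 0 false ∷ cert 12 (hexn 1 1) 0 false
  ∷ cert 1 (quadn 5 0) 0 true ∷ cert 15 (quadn 5 0) 0 true ∷ cert 3 (quadn 9 0) 2 false
  ∷ cert 6 (quadn 9 0) 2 false ∷ cert 6 (quadn 0 0) 2 false ∷ cert 7 (quadn 0 0) 2 false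
  ∷ cert 3 (quadn 0 0) 2 false ∷ cert 5 (quadn 0 0) 2 false ∷ cert 3 (quadn 4 2) 2 false
  ∷ cert 5 (quadn 4 2) 2 false ∷ cert 2 (quadn 0 0) 2 false ∷ cert 4 (quadn 0 0) 2 false
  ∷ cert 3 (quadn 13 2) 0 true ∷ cert 1 (quadn 0 0) 2 false ∷ cert 2 (quadn 12 2) 0 true
  ∷ cert 0 (quadn 0 0) 2 false ∷ cert 6 (quadn 12 2) 0 true ∷ cert 15 (quadn 0 0) 2 false
  ∷ cert 3 (quadn 12 2) 0 true ∷ cert 1 (quadn 4 2) 2 false ∷ cert 16 (quadn 4 0) 1 false
  ∷ cert 17 (quadn 4 0) 1 true ∷ cert 17 (quadn 3 0) 1 false ∷ cert 16 (quadn 3 0) 1 false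
  ∷ cert 5 (quadn 0 2) 0 true ∷ cert 3 (quadn 0 2) 0 true ∷ cert 7 (quadn 0 2) 0 true
  ∷ cert 6 (quadn 0 2) 0 true ∷ cert 4 (quadn 0 2) 0 true ∷ cert 2 (quadn 0 2) 0 true
  ∷ cert 5 (quadn 3 0) 0 true ∷ cert 3 (quadn 3 0) 0 true ∷ cert 3 (quadn 12 2) 2 false
  ∷ cert 1 (quadn 3 0) 0 true ∷ cert 2 (quadn 11 0) 2 false ∷ cert 0 (quadn 0 2) 0 true
  ∷ cert 6 (quadn 11 0) 2 false ∷ cert 15 (quadn 0 2) 0 true ∷ cert 3 (quadn 11 0) 2 false
  ∷ cert 1 (quadn 0 2) 0 true ∷ cert 16 (quadn 2 0) 1 false ∷ cert 17 (quadn 2 0) 1 true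
  ∷ cert 6 (quadn 0 2) 2 false ∷ cert 7 (quadn 0 2) 2 false ∷ cert 3 (quadn 2 2) 2 false
  ∷ cert 5 (quadn 2 2) 2 false ∷ cert 3 (quadn 0 2) 2 false ∷ cert 5 (quadn 0 2) 2 false
  ∷ cert 2 (quadn 0 2) 2 false ∷ cert 4 (quadn 0 2) 2 false ∷ cert 2 (quadn 11 2) 0 true
  ∷ cert 0 (quadn 0 2) 2 false ∷ cert 3 (quadn 13 2) 0 true ∷ cert 1 (quadn 2 2) 2 false
  ∷ cert 3 (quadn 11 2) 0 true ∷ cert 1 (quadn 0 2) 2 false ∷ cert 6 (quadn 11 2) 0 true
  ∷ cert 15 (quadn 0 2) 2 false ∷ cert 16 (quadn 0 0) 1 false ∷ cert 17 (quadn 0 0) 1 true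
  ∷ cert 15 (quadn 0 0) 0 true ∷ cert 6 (quadn 12 0) 2 false ∷ cert 1 (quadn 0 0) 0 true
  ∷ cert 3 (quadn 12 0) 2 false ∷ cert 1 (quadn 1 0) 0 true ∷ cert 3 (quadn 13 2) 2 false
  ∷ cert 0 (quadn 0 0) 0 true ∷ cert 2 (quadn 12 0) 2 false ∷ cert 5 (quadn 0 0) 0 true
  ∷ cert 3 (quadn 0 0) 0 true ∷ cert 4 (quadn 0 0) 0 true ∷ cert 2 (quadn 0 0) 0 true
  ∷ cert 7 (quadn 0 0) 0 true ∷ cert 6 (quadn 0 0) 0 true ∷ cert 5 (quadn 1 0) 0 true
  ∷ cert 3 (quadn 1 0) 0 true ∷ cert 17 (quadn 1 0) 1 false ∷ cert 16 (quadn 1 0) 1 false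
  ∷ cert 17 (quadn 0 0) 1 false ∷ cert 16 (quadn 0 0) 1 false ∷ []

-- The two searches and the conclusion

-- With 60 vertices `size-bound` reads 6|H| + 12 ≤ 48 + 12.
clar-bound : ∀ {M : CubicMap 60} → Fullerene M → ∀ H → SextetPattern M H → length H ≤ 8
clar-bound {M} (simple , (_ , R , reps , euler) , _ , faces) H sextet =
  *-cancelʳ-≤ (length H) 8 6 (+-cancelʳ-≤ 12 (length H * 6) 48 size-bound)
  where
  open FaceCount.Pattern.Exits M simple faces H sextet R reps euler using (size-bound)

abstract
  -- The caps are the 8 · 6 spokes of the hexagons and the 12 exits, each being one spoke of class
  -- `ax`.
  quad-search : Leaves.Exhausted 5 L 48 12 (Engine.addQuad 5 (st 0 [] [])) (quadn 0 0)
  quad-search = Leaves.exhausted {fuel = 50} {certs = quadCerts} {rest = []} refl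

  -- The caps are the 12 · 5 spokes of the pentagons and no exit at all. The list of candidates has
  -- a single member, and one certificate is enough.
  hex-search : Leaves.Exhausted 4 (λ (_ : Fin 1) → L buckminster) 60 0 (Engine.addHex 4 (st 0 [] [])) (hexn 0 0)
  hex-search = Leaves.exhausted {fuel = 50} {certs = cert 0 (hexn 0 4) 1 true ∷ []} {rest = []} refl

classification : ∀ (M : CubicMap 60) → Fullerene M → IsClarNumber M 8 → ∃ λ g → Iso M (L g)
classification M (simple , (connected , R , reps , euler) , _ , faces) ((H , sextet , H≡8) , _) =
  FaceCount.Pattern.Exits.Extremal.Classification.classify M simple faces H sextet R reps euler
    (≤-reflexive (sym (cong (λ h → h * 6 + 12) H≡8))) H≡8 connected L L-simple quad-search

isolated-classification : ∀ (M : CubicMap 60) → Fullerene M → IsolatedPentagons M → Iso M (L buckminster)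
isolated-classification M (simple , (connected , R , reps , euler) , _ , faces) isolated =
  proj₂ (FaceCount.Isolated.Classification.classify M simple faces isolated R reps euler ≤-refl
    zero connected (λ _ → L buckminster) (λ _ → L-simple buckminster) hex-search)

L-fullerene : ∀ g → Fullerene (L g)
L-fullerene g = L-simple g , (L-connected g , R , faceReps , cong (λ r → 2 * (60 + r)) (≡ᵇ-sound (length R) 32 32-faces)) ,
  (m≤m+n 4 56 , L-connected g , avoiding) , faces
  where
  open Check.Reps (L g) zero (faceTable g)
  ok : repsᵇ ≡ true
  ok = proj₁ (∧-true repsᵇ (L-facesᵇ g))
  -- With 90 edges, Euler's formula is 60 - 90 + 32 = 2.
  32-faces : (length R ≡ᵇ 32) ≡ true
  32-faces = proj₂ (∧-true repsᵇ (L-facesᵇ g))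
  open Sound ok using (faceReps; faces)
  open Check.ThreeConn (L g) (Check.link (L g)) (L-surrounds g) (L-connected g) using (avoiding)

theorem4p10 : Σ (Fin 18 → CubicMap 60) λ L →
    (∀ i → Fullerene (L i) × IsClarNumber (L i) 8)
    × (∀ i j → i ≢ j → ¬ Iso (L i) (L j))
    × (∀ (M : CubicMap 60) → Fullerene M → IsClarNumber M 8 → ∃ λ i → Iso M (L i))
    × (∃ λ i → IsolatedPentagons (L i)
    × (∀ (M : CubicMap 60) → Fullerene M → IsolatedPentagons M → Iso M (L i)))
theorem4p10 = L ,
  (λ g → L-fullerene g , (hexagons g , L-sextet g , refl) , clar-bound {L g} (L-fullerene g)) ,
  (λ g h g≢h iso → g≢h (values-distinct g h (trans (sym (L-invariant g))
    (trans (sym (Iso-invariant {M = L g} {N = L h} (L-simple g) (L-simple h) iso)) (L-invariant h))))) ,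
  classification ,
  buckminster , L-isolated , isolated-classification
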